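{- Let $(\ell,\mathcal{S},d,y)$ be a WPCS instance with $\mathcal{S}$ non-interleaving, and let $c\in\mathbb{Q}^\ell$. Then there exists an integral selection $z$ for $\mathcal{S}$ with $D_{y,z}\le 2d_{\max}$ and $c^Tz\le c^Ty$, where $d_{\max}=\max_{S\in\mathcal{S}}d_S$. Moreover, such $z$ can be computed in time $O(\ell\cdot\langle\mathrm{input}\rangle)$, where $\langle\mathrm{input}\rangle$ is the bit length of the input.
   Context: $[\ell]=\{1,\dots,\ell\}$; for $q\in\mathbb{R}^\ell$ and $U\subseteq[\ell]$, $q(U)=\sum_{i\in U}q_i$. Two disjoint sets $S_1,S_2\subseteq\mathbb{Z}_{>0}$ are interleaving if there exist $a_1,b_1\in S_1$, $a_2,b_2\in S_2$ with $a_1<a_2<b_1<b_2$ or $a_2<a_1<b_2<b_1$; a partition of $[\ell]$ is non-interleaving if no two distinct members are interleaving. For a partition $\mathcal{S}$ of $[\ell]$, a fractional selection is a vector $y\in[0,1]^\ell$ (rational) with $y(S)=1$ for all $S\in\mathcal{S}$, and an integral selection is $z\in\{0,1\}^\ell$ with $z(S)=1$ for all $S\in\mathcal{S}$. A WPCS instance is a tuple $(\ell,\mathcal{S},d,y)$ with $\ell\in\mathbb{Z}_{\ge0}$, $\mathcal{S}$ a partition of $[\ell]$, $d\in\mathbb{Q}_{\ge0}^{\mathcal{S}}$, and $y$ a fractional selection for $\mathcal{S}$. For $q\in[0,1]^\ell$ the load vector $q^d$ is $q^d_i=d_S\,q_i$ where $S\in\mathcal{S}$ contains $i$. For $I\subseteq[\ell]$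 and selections $y,z$, $D_{y,z}(I)=|y^d(I)-z^d(I)|$. A circular interval is $\emptyset$, or for $i,j\in[\ell]$ the set $\{i,\dots,j\}$ if $i\le j$, or $\{i,\dots,\ell,1,\dots,j\}$ if $j<i$. The interval-discrepancy is $D_{y,z}=\max\{D_{y,z}(I): I\subseteq[\ell]\text{ circular interval}\}$. -}

module Defs where

open import Data.Bool.Base using (Bool; true; false; if_then_else_; not; _∧_; _∨_)
open import Data.Fin.Base as Fin using (Fin; toℕ; fromℕ<)
open import Data.Fin.Subset using (Subset; _∈_; Nonempty; ⊥)
open import Data.Integer.Base using (∣_∣)
open import Data.List.Base using (List; _∷_; map; foldr; tabulate; allFin; cartesianProductWith)
open import Data.Nat.Base as ℕ using (ℕ; zero; suc)
import Data.Fin.Properties as Fin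
import Data.Nat.Properties as ℕ
open import Data.Nat.Logarithm using (⌈log₂_⌉)
open import Data.Product.Base using (Σ-syntax; _×_; proj₁)
open import Data.Product using (∃!)
open import Data.Rational.Base as ℚ using (ℚ; 0ℚ; 1ℚ; _⊔_; ↥_; ↧ₙ_)
import Data.Rational.Properties as ℚ
open import Data.Sum.Base using (_⊎_)
import Data.Vec.Base as Vec
open import Relation.Binary.PropositionalEquality.Core using (_≡_; _≢_)
open import Relation.Nullary.Decidable.Core using (does; yes; no)
open import Relation.Nullary.Negation.Core using (¬_)

open import Algebra.Properties.CommutativeMonoid.Sum ℚ.+-0-commutativeMonoid
  using () renaming (sum to sumℚ)
open import Algebra.Properties.CommutativeMonoid.Sum ℕ.+-0-commutativeMonoid
  using () renaming (sum to sumℕ)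

------------------------------------------------------------------------
-- Partitions and selections

-- The ground set [ℓ] is Fin ℓ, with its usual order.  A partition is given
-- by listing its members S 0, …, S (m - 1).
record IsPartition {ℓ m : ℕ} (S : Fin m → Subset ℓ) : Set where
  field
    nonempty : ∀ k → Nonempty (S k)
    cover    : ∀ i → ∃! _≡_ λ k → i ∈ S k

  classOf : Fin ℓ → Fin m
  classOf i = proj₁ (cover i)

Interleaving : {ℓ : ℕ} → Subset ℓ → Subset ℓ → Set
Interleaving {ℓ} S₁ S₂ =
  Σ[ a₁ ∈ Fin ℓ ] Σ[ b₁ ∈ Fin ℓ ] Σ[ a₂ ∈ Fin ℓ ] Σ[ b₂ ∈ Fin ℓ ]
    (a₁ ∈ S₁ × b₁ ∈ S₁ × a₂ ∈ S₂ × b₂ ∈ S₂ ×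
     ((a₁ Fin.< a₂ × a₂ Fin.< b₁ × b₁ Fin.< b₂) ⊎
      (a₂ Fin.< a₁ × a₁ Fin.< b₂ × b₂ Fin.< b₁)))

-- Members of a partition with distinct indices are distinct and disjoint.
NonInterleaving : {ℓ m : ℕ} → (Fin m → Subset ℓ) → Set
NonInterleaving S = ∀ k k′ → k ≢ k′ → ¬ Interleaving (S k) (S k′)

infix 9 _⟨_⟩

_⟨_⟩ : {ℓ : ℕ} → (Fin ℓ → ℚ) → Subset ℓ → ℚ
q ⟨ U ⟩ = sumℚ λ i → if Vec.lookup U i then q i else 0ℚ

record FractionalSelection {ℓ m : ℕ} (S : Fin m → Subset ℓ) (y : Fin ℓ → ℚ) : Set where
  field
    0≤y  : ∀ i → 0ℚ ℚ.≤ y i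
    y≤1  : ∀ i → y i ℚ.≤ 1ℚ
    sums : ∀ k → y ⟨ S k ⟩ ≡ 1ℚ

record IntegralSelection {ℓ m : ℕ} (S : Fin m → Subset ℓ) (z : Fin ℓ → ℚ) : Set where
  field
    binary : ∀ i → z i ≡ 0ℚ ⊎ z i ≡ 1ℚ
    sums   : ∀ k → z ⟨ S k ⟩ ≡ 1ℚ

record WPCS : Set where
  field
    ℓ m         : ℕ
    S           : Fin m → Subset ℓ
    isPartition : IsPartition S
    d           : Fin m → ℚ
    0≤d         : ∀ k → 0ℚ ℚ.≤ d k
    y           : Fin ℓ → ℚ
    fractional  : FractionalSelection S y

  open IsPartition isPartition public

------------------------------------------------------------------------
-- Interval-discrepancy

-- {i,…,j} if i ≤ j, and {i,…,ℓ} ∪ {1,…,j} if j < i.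
arc : {ℓ : ℕ} → Fin ℓ → Fin ℓ → Subset ℓ
arc i j = Vec.tabulate λ k →
  if does (i Fin.≤? j)
  then does (i Fin.≤? k) ∧ does (k Fin.≤? j)
  else does (i Fin.≤? k) ∨ does (k Fin.≤? j)

circularIntervals : (ℓ : ℕ) → List (Subset ℓ)
circularIntervals ℓ = ⊥ ∷ cartesianProductWith arc (allFin ℓ) (allFin ℓ)

-- Only used for nonnegative entries, where the seed 0 merely fixes the
-- maximum of the empty list.
maximum : List ℚ → ℚ
maximum = foldr _⊔_ 0ℚ

infixl 7 _·_

_·_ : {ℓ : ℕ} → (Fin ℓ → ℚ) → (Fin ℓ → ℚ) → ℚ
c · q = sumℚ λ i → c i ℚ.* q i

module _ (I : WPCS) where
  open WPCS I

  load : (Fin ℓ → ℚ) → (Fin ℓ → ℚ)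
  load q i = d (classOf i) ℚ.* q i

  discrepancyOn : (y z : Fin ℓ → ℚ) → Subset ℓ → ℚ
  discrepancyOn y z U = ℚ.∣ load y ⟨ U ⟩ ℚ.- load z ⟨ U ⟩ ∣

  discrepancy : (y z : Fin ℓ → ℚ) → ℚ
  discrepancy y z = maximum (map (discrepancyOn y z) (circularIntervals ℓ))

  dmax : ℚ
  dmax = maximum (tabulate d)

------------------------------------------------------------------------
-- Encoding lengths

-- The usual binary encoding lengths: 1 + ⌈log₂ (|p| + 1)⌉ for an integer p
-- and 1 + ⌈log₂ (|p| + 1)⌉ + ⌈log₂ (q + 1)⌉ for a fraction p / q in lowest
-- terms.
bitsℕ : ℕ → ℕ
bitsℕ n = 1 ℕ.+ ⌈log₂ suc n ⌉

bitsℚ : ℚ → ℕ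
bitsℚ q = 1 ℕ.+ ⌈log₂ suc ∣ ↥ q ∣ ⌉ ℕ.+ ⌈log₂ suc (↧ₙ q) ⌉

-- The partition is encoded by the index of the member containing each i.
bitLength : (I : WPCS) → (Fin (WPCS.ℓ I) → ℚ) → ℕ
bitLength I c =
  bitsℕ ℓ ℕ.+ bitsℕ m
    ℕ.+ sumℕ (λ i → bitsℕ (toℕ (classOf i)))
    ℕ.+ sumℕ (λ k → bitsℚ (d k))
    ℕ.+ sumℕ (λ i → bitsℚ (y i))
    ℕ.+ sumℕ (λ i → bitsℚ (c i))
  where open WPCS I

------------------------------------------------------------------------
-- Model of computation
--
-- A random access machine in the arithmetic model: one time unit per
-- elementary arithmetic operation, comparison, memory access or branching
-- decision.  It is presented through structured programs acting on a
-- memory that consists of arrays of natural numbers (for indices) and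
-- arrays of rationals, each named by a numeral in the program.  A program
-- is fixed and finite, and works for inputs of all sizes.

infixl 6 _+ᴺ_ _∸ᴺ_ _+ᴿ_ _-ᴿ_
infixl 7 _*ᴺ_ _*ᴿ_ _÷ᴿ_
infix  4 _≤ᴺ_ _≤ᴿ_

data NatExpr : Set where
  con              : ℕ → NatExpr
  _[_]             : ℕ → NatExpr → NatExpr
  _+ᴺ_ _∸ᴺ_ _*ᴺ_  : NatExpr → NatExpr → NatExpr

data RatExpr : Set where
  con                    : ℚ → RatExpr
  _[_]                   : ℕ → NatExpr → RatExpr
  _+ᴿ_ _-ᴿ_ _*ᴿ_ _÷ᴿ_  : RatExpr → RatExpr → RatExpr

data Test : Set where
  _≤ᴺ_ : NatExpr → NatExpr → Test
  _≤ᴿ_ : RatExpr → RatExpr → Test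
  notᵀ : Test → Test
  andᵀ : Test → Test → Test

infixr 5 _⨾_

data Program : Set where
  skip  : Program
  setᴺ  : ℕ → NatExpr → NatExpr → Program
  setᴿ  : ℕ → NatExpr → RatExpr → Program
  _⨾_   : Program → Program → Program
  ifᵀ   : Test → Program → Program → Program
  while : Test → Program → Program

record Memory : Set where
  constructor mem
  field
    nat : ℕ → ℕ → ℕ
    rat : ℕ → ℕ → ℚ

open Memory public

update : {A : Set} → (ℕ → ℕ → A) → ℕ → ℕ → A → (ℕ → ℕ → A)
update M a i v a′ i′ = if does (a ℕ.≟ a′) ∧ does (i ℕ.≟ i′) then v else M a′ i′

-- Division, with p / 0 = 0.
divide : ℚ → ℚ → ℚ
divide p q with q ℚ.≟ 0ℚ
... | yes _   = 0ℚ
... | no  q≢0 = ℚ._÷_ p q {{ℚ.≢-nonZero q≢0}}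

evalᴺ : NatExpr → Memory → ℕ
evalᴺ (con n)  σ = n
evalᴺ (a [ e ]) σ = nat σ a (evalᴺ e σ)
evalᴺ (e +ᴺ f) σ = evalᴺ e σ ℕ.+ evalᴺ f σ
evalᴺ (e ∸ᴺ f) σ = evalᴺ e σ ℕ.∸ evalᴺ f σ
evalᴺ (e *ᴺ f) σ = evalᴺ e σ ℕ.* evalᴺ f σ

evalᴿ : RatExpr → Memory → ℚ
evalᴿ (con q)  σ = q
evalᴿ (a [ e ]) σ = rat σ a (evalᴺ e σ)
evalᴿ (e +ᴿ f) σ = evalᴿ e σ ℚ.+ evalᴿ f σ
evalᴿ (e -ᴿ f) σ = evalᴿ e σ ℚ.- evalᴿ f σ
evalᴿ (e *ᴿ f) σ = evalᴿ e σ ℚ.* evalᴿ f σ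
evalᴿ (e ÷ᴿ f) σ = divide (evalᴿ e σ) (evalᴿ f σ)

evalᵀ : Test → Memory → Bool
evalᵀ (e ≤ᴺ f)   σ = does (evalᴺ e σ ℕ.≤? evalᴺ f σ)
evalᵀ (e ≤ᴿ f)   σ = does (evalᴿ e σ ℚ.≤? evalᴿ f σ)
evalᵀ (notᵀ b)   σ = not (evalᵀ b σ)
evalᵀ (andᵀ b c) σ = evalᵀ b σ ∧ evalᵀ c σ

costᴺ : NatExpr → ℕ
costᴺ (con _)  = 1
costᴺ (_ [ e ]) = suc (costᴺ e)
costᴺ (e +ᴺ f) = suc (costᴺ e ℕ.+ costᴺ f)
costᴺ (e ∸ᴺ f) = suc (costᴺ e ℕ.+ costᴺ f)
costᴺ (e *ᴺ f) = suc (costᴺ e ℕ.+ costᴺ f)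

costᴿ : RatExpr → ℕ
costᴿ (con _)  = 1
costᴿ (_ [ e ]) = suc (costᴺ e)
costᴿ (e +ᴿ f) = suc (costᴿ e ℕ.+ costᴿ f)
costᴿ (e -ᴿ f) = suc (costᴿ e ℕ.+ costᴿ f)
costᴿ (e *ᴿ f) = suc (costᴿ e ℕ.+ costᴿ f)
costᴿ (e ÷ᴿ f) = suc (costᴿ e ℕ.+ costᴿ f)

costᵀ : Test → ℕ
costᵀ (e ≤ᴺ f)   = suc (costᴺ e ℕ.+ costᴺ f)
costᵀ (e ≤ᴿ f)   = suc (costᴿ e ℕ.+ costᴿ f)
costᵀ (notᵀ b)   = suc (costᵀ b)
costᵀ (andᵀ b c) = suc (costᵀ b ℕ.+ costᵀ c)

-- w ⊢ p , σ ⇓[ t ] σ′ : started in memory σ, program p halts after t time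
-- units in memory σ′, and every number it stores on the way has encoding
-- length at most w.  The bound w is what makes unit cost reasonable: without
-- it, a machine could pack unbounded amounts of work into huge numbers.
-- (Subexpressions have bounded depth in a fixed program, so their values
-- are longer than the stored ones by at most a constant factor.)
infix 3 _⊢_,_⇓[_]_

data _⊢_,_⇓[_]_ (w : ℕ) : Program → Memory → ℕ → Memory → Set where
  skip : ∀ {σ} → w ⊢ skip , σ ⇓[ 1 ] σ

  setᴺ : ∀ {σ a i e} → bitsℕ (evalᴺ e σ) ℕ.≤ w →
         w ⊢ setᴺ a i e , σ ⇓[ suc (costᴺ i ℕ.+ costᴺ e) ]
           mem (update (nat σ) a (evalᴺ i σ) (evalᴺ e σ)) (rat σ)

  setᴿ : ∀ {σ a i e} → bitsℚ (evalᴿ e σ) ℕ.≤ w →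
         w ⊢ setᴿ a i e , σ ⇓[ suc (costᴺ i ℕ.+ costᴿ e) ]
           mem (nat σ) (update (rat σ) a (evalᴺ i σ) (evalᴿ e σ))

  seq : ∀ {σ σ′ σ″ p q s t} →
        w ⊢ p , σ ⇓[ s ] σ′ → w ⊢ q , σ′ ⇓[ t ] σ″ →
        w ⊢ p ⨾ q , σ ⇓[ s ℕ.+ t ] σ″

  if-true : ∀ {σ σ′ b p q t} → evalᵀ b σ ≡ true →
            w ⊢ p , σ ⇓[ t ] σ′ →
            w ⊢ ifᵀ b p q , σ ⇓[ suc (costᵀ b ℕ.+ t) ] σ′

  if-false : ∀ {σ σ′ b p q t} → evalᵀ b σ ≡ false →
             w ⊢ q , σ ⇓[ t ] σ′ →
             w ⊢ ifᵀ b p q , σ ⇓[ suc (costᵀ b ℕ.+ t) ] σ′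

  while-true : ∀ {σ σ′ σ″ b p s t} → evalᵀ b σ ≡ true →
               w ⊢ p , σ ⇓[ s ] σ′ → w ⊢ while b p , σ′ ⇓[ t ] σ″ →
               w ⊢ while b p , σ ⇓[ suc (costᵀ b ℕ.+ s ℕ.+ t) ] σ″

  while-false : ∀ {σ b p} → evalᵀ b σ ≡ false →
                w ⊢ while b p , σ ⇓[ suc (costᵀ b) ] σ

------------------------------------------------------------------------
-- Input and output conventions

padded : {A : Set} {n : ℕ} → A → (Fin n → A) → ℕ → A
padded {n = n} default f i with i ℕ.<? n
... | yes i<n = f (fromℕ< i<n)
... | no  _   = default

-- Initially, nat 0 holds ℓ and m, nat 1 the member index of each i, and
-- rat 0, rat 1, rat 2 hold d, y, c; all other cells are zero.
inputMemory : (I : WPCS) → (Fin (WPCS.ℓ I) → ℚ) → Memory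
inputMemory I c = mem natIn ratIn
  where
  open WPCS I

  natIn : ℕ → ℕ → ℕ
  natIn 0 0 = ℓ
  natIn 0 1 = m
  natIn 1 i = padded 0 (λ j → toℕ (classOf j)) i
  natIn _ _ = 0

  ratIn : ℕ → ℕ → ℚ
  ratIn 0 i = padded 0ℚ d i
  ratIn 1 i = padded 0ℚ y i
  ratIn 2 i = padded 0ℚ c i
  ratIn _ _ = 0ℚ

-- On halting, the result is read off rat 3.
output : {ℓ : ℕ} → Memory → Fin ℓ → ℚ
output σ i = rat σ 3 (toℕ i)

{-# OPTIONS --safe #-}

-- Think of a class with fractional entries as a chord from the first to the
-- last element of its support; as the partition is non-interleaving, these
-- chords are nested or disjoint.  Take an outermost chord and the maximal
-- chords inside it, and shift load along the outer one in one direction and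
-- along the inner ones in the opposite direction, all by the same amount, until
-- some entry vanishes; of the two directions take one that does not increase
-- the cost.  A cut below at least two chords sees no change in its prefix load.
-- So the prefix loads only deviate from the original ones at cuts
-- below at most one chord.  Supports only shrink, so from then on the deviation
-- at such a cut is d_S times the change of a number in [0,1], for a fixed class
-- S.  Thus prefix deviations stay at most dmax, and circular intervals, being
-- differences of prefixes (up to the unchanged total), deviate by at most 2 dmax.
-- There are at most ℓ moves, each found in linear time.  In terms of loads all
-- values stay in one lattice (1/M)ℤ, which keeps the encodings short.

module Submission where

open import Defs
open import Data.Bool.Base using (Bool; true; false; T; _∧_; _∨_; not; if_then_else_)
open import Data.Empty using (⊥)
open import Data.Fin.Base using (Fin; toℕ; fromℕ<)
import Data.Fin.Base as Fin
import Data.Fin.Properties as Fin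
import Data.Fin.Subset as Subset
open import Data.Fin.Subset using (_∈_)
open import Data.Integer.Base using (+_; ℤ)
import Data.Integer.Base as ℤ
import Data.Integer.Properties as ℤ
open import Data.List.Base using ([]; _∷_; tabulate; allFin)
open import Data.List.Relation.Unary.All using (All; []; _∷_)
import Data.List.Relation.Unary.All.Properties as All
open import Data.Nat.Base using (ℕ; zero; suc; _+_; _*_; _∸_; _^_; _⊔_; _≤_; _<_; z≤n; s≤s; ⌈_/2⌉; ⌊_/2⌋; >-nonZero)
import Data.Nat.Coprimality as Coprime
open import Data.Nat.Divisibility using (_∣_; divides; ∣⇒≤; ∣-trans; ∣-refl; m∣m*n; n∣m*n; *-pres-∣; 1∣_)
open import Data.Nat.Induction using (<-rec)
open import Data.Nat.Logarithm using (⌈log₂_⌉; ⌈log₂⌉-mono-≤; ⌈log₂2^n⌉≡n; ⌈log₂⌈n/2⌉⌉≡⌈log₂n⌉∸1)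
import Data.Nat.Properties as ℕ
import Data.Nat.Solver
open import Data.Product.Base using (Σ-syntax; ∃-syntax; _×_; _,_; proj₁; proj₂)
open import Data.Rational.Base using (ℚ; 0ℚ; 1ℚ; _/_; mkℚ; *≤*; toℚᵘ; ↥_; ↧ₙ_) renaming (_≤_ to _≤ℚ_; _<_ to _<ℚ_; _+_ to _+ℚ_; _-_ to _-ℚ_; -_ to -ℚ_; _*_ to _*ℚ_)
import Data.Rational.Base as ℚ
open import Data.Rational.Literals using (fromℤ)
import Data.Rational.Properties as ℚ
open import Data.Rational.Solver using (module +-*-Solver)
import Data.Rational.Unnormalised.Base as ℚᵘ
import Data.Rational.Unnormalised.Properties as ℚᵘ
open import Data.Sum.Base using (_⊎_; inj₁; inj₂)
import Data.Vec.Base as Vec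
import Data.Vec.Properties as Vec
open import Function.Base using (_∘_; case_of_)
open import Relation.Binary using (tri<; tri≈; tri>)
open import Relation.Binary.PropositionalEquality using (_≡_; _≢_; refl; sym; trans; cong; cong₂; subst; subst₂; setoid; module ≡-Reasoning)
open import Relation.Nullary using (¬_; Dec; yes; no; does; Reflects; ofʸ; ofⁿ; contradiction)
open import Relation.Nullary.Decidable using (proof; dec-true; dec-false)
open import Relation.Nullary.Reflects using (¬-reflects; _×-reflects_)
open import Algebra.Properties.CommutativeMonoid.Sum ℚ.+-0-commutativeMonoid using () renaming (sum to sumℚ)
open import Algebra.Properties.CommutativeMonoid.Sum ℕ.+-0-commutativeMonoid using () renaming (sum to sumℕ)

-- Classes of demand 0 carry no load, so a shift along them cannot compensate one along another
-- chord, and cost per unit of load is undefined for them. They get the fictitious demand 1 and are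
-- only ever moved alone; a class weight `R`, 0 on them and 1 elsewhere, removes them again whenever
-- prefix loads are measured.
--
-- Measured in loads, every move adds the same amount with signs 0, 1 or -1, so the step length is
-- itself one of the current loads. Hence the loads are never divided, and one common denominator
-- fixed by the input serves all iterations. The only division is of a cost by a demand; this is why
-- the common denominator also has to absorb numerators.
--
-- The direction of a move is dictated by the cost, not by progress. Signs of both kinds must
-- therefore occur, so that some entry decreases either way.
--
-- The number of iterations is fixed at `ℓ` instead of being tested for. As the input length is at
-- least `ℓ`, quadratic time lies within the claimed bound.

open +-*-Solver using (solve; _:=_; _:+_; _:*_; _:-_; :-_; con)
module ℕ-Solver = Data.Nat.Solver.+-*-Solver

-- Program logic for the machine

record Reaches (w t : ℕ) (p : Program) (σ : Memory) (Q : Memory → Set) : Set where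
  constructor reaches
  field
    {time}  : ℕ
    {final} : Memory
    run     : w ⊢ p , σ ⇓[ time ] final
    time≤   : time ≤ t
    post    : Q final

Holds : Test → Memory → Set
Holds (e ≤ᴺ f)   σ = evalᴺ e σ ≤ evalᴺ f σ
Holds (e ≤ᴿ f)   σ = evalᴿ e σ ≤ℚ evalᴿ f σ
Holds (notᵀ b)   σ = ¬ Holds b σ
Holds (andᵀ b c) σ = Holds b σ × Holds c σ

reflects : ∀ b σ → Reflects (Holds b σ) (evalᵀ b σ)
reflects (e ≤ᴺ f)   σ = proof (evalᴺ e σ ℕ.≤? evalᴺ f σ)
reflects (e ≤ᴿ f)   σ = proof (evalᴿ e σ ℚ.≤? evalᴿ f σ)
reflects (notᵀ b)   σ = ¬-reflects (reflects b σ)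
reflects (andᵀ b c) σ = reflects b σ ×-reflects reflects c σ

holds⇒true : ∀ b {σ} → Holds b σ → evalᵀ b σ ≡ true
holds⇒true b {σ} h with evalᵀ b σ | reflects b σ
... | true  | _      = refl
... | false | ofⁿ ¬h = contradiction h ¬h

¬holds⇒false : ∀ b {σ} → ¬ Holds b σ → evalᵀ b σ ≡ false
¬holds⇒false b {σ} ¬h with evalᵀ b σ | reflects b σ
... | false | _     = refl
... | true  | ofʸ h = contradiction h ¬h

-- An upper bound for the running time of a loop-free program, and its weakest
-- precondition; loops get the junk values 0 and ⊥.
cost : Program → ℕ
cost skip         = 1
cost (setᴺ a i e) = suc (costᴺ i + costᴺ e)
cost (setᴿ a i e) = suc (costᴺ i + costᴿ e)
cost (p ⨾ q)      = cost p + cost q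
cost (ifᵀ b p q)  = suc (costᵀ b + (cost p + cost q))
cost (while b p)  = 0

wp : ℕ → Program → (Memory → Set) → Memory → Set
wp w skip         Q σ = Q σ
wp w (setᴺ a i e) Q σ = bitsℕ (evalᴺ e σ) ≤ w ×
  Q (mem (update (nat σ) a (evalᴺ i σ) (evalᴺ e σ)) (rat σ))
wp w (setᴿ a i e) Q σ = bitsℚ (evalᴿ e σ) ≤ w ×
  Q (mem (nat σ) (update (rat σ) a (evalᴺ i σ) (evalᴿ e σ)))
wp w (p ⨾ q)      Q σ = wp w p (wp w q Q) σ
wp w (ifᵀ b p q)  Q σ = (Holds b σ → wp w p Q σ) × (¬ Holds b σ → wp w q Q σ)
wp w (while b p)  Q σ = ⊥

infixr 5 _thenʳ_

_thenʳ_ : ∀ {w s t p q σ P Q} → Reaches w s p σ P →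
          (∀ {σ′} → P σ′ → Reaches w t q σ′ Q) → Reaches w (s + t) (p ⨾ q) σ Q
reaches r s≤ post thenʳ f with f post
... | reaches r′ t≤ post′ = reaches (seq r r′) (ℕ.+-mono-≤ s≤ t≤) post′

weaken : ∀ {w t t′ p σ P Q} → t ≤ t′ → (∀ {σ′} → P σ′ → Q σ′) →
         Reaches w t p σ P → Reaches w t′ p σ Q
weaken t≤ f (reaches r s≤ post) = reaches r (ℕ.≤-trans s≤ t≤) (f post)

wp-sound : ∀ {w} p {Q σ} → wp w p Q σ → Reaches w (cost p) p σ Q
wp-sound skip         q       = reaches skip ℕ.≤-refl q
wp-sound (setᴺ a i e) (b , q) = reaches (setᴺ b) ℕ.≤-refl q
wp-sound (setᴿ a i e) (b , q) = reaches (setᴿ b) ℕ.≤-refl q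
wp-sound (p ⨾ q)      h       = wp-sound p h thenʳ wp-sound q
wp-sound (ifᵀ b p q) {σ = σ} (h₁ , h₂) with evalᵀ b σ in eq | reflects b σ
... | true  | ofʸ h with wp-sound p (h₁ h)
...   | reaches r t≤ post = reaches (if-true eq r)
        (s≤s (ℕ.+-monoʳ-≤ (costᵀ b) (ℕ.≤-trans t≤ (ℕ.m≤m+n _ _)))) post
wp-sound (ifᵀ b p q) {σ = σ} (h₁ , h₂) | false | ofⁿ ¬h with wp-sound q (h₂ ¬h)
...   | reaches r t≤ post = reaches (if-false eq r)
        (s≤s (ℕ.+-monoʳ-≤ (costᵀ b) (ℕ.≤-trans t≤ (ℕ.m≤n+m _ _)))) post

-- For counting loops: under `Inv i` the guard is equivalent to `i < n`, so the number `k` of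
-- remaining passes is known in advance. The additional guard cost pays for the final, failing test.
while-rule : ∀ {w c b p} {n : ℕ} (Inv : ℕ → Memory → Set) →
  (∀ {i σ} → Inv i σ → i < n → Holds b σ) →
  (∀ {i σ} → Inv i σ → Holds b σ → i < n) →
  (∀ {i σ} → i < n → Inv i σ → Reaches w c p σ (Inv (suc i))) →
  ∀ k {i σ} → i + k ≡ n → Inv i σ →
  Reaches w (suc (costᵀ b) + k * (suc (costᵀ b) + c)) (while b p) σ (Inv n)
while-rule {b = b} Inv enter stay step zero {i} {σ} eq inv
  with trans (sym (ℕ.+-identityʳ i)) eq
... | refl = reaches (while-false (¬holds⇒false b λ h → ℕ.<-irrefl refl (stay inv h)))
               (ℕ.m≤m+n _ _) inv
while-rule {c = c} {b = b} {n = n} Inv enter stay step (suc k) {i} {σ} eq inv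
  with step i<n inv
  where
  i<n : i < n
  i<n = subst (i <_) eq (ℕ.m<m+n i (s≤s z≤n))
... | reaches {s} r s≤ inv′
  with while-rule {b = b} Inv enter stay step k (trans (sym (ℕ.+-suc i k)) eq) inv′
...   | reaches {t} r′ t≤ post = reaches
          (while-true (holds⇒true b (enter inv (subst (i <_) eq (ℕ.m<m+n i (s≤s z≤n))))) r r′)
          (begin
            suc (costᵀ b + s + t)                            ≡⟨⟩
            suc (costᵀ b) + s + t                            ≤⟨ ℕ.+-mono-≤ (ℕ.+-monoʳ-≤ (suc (costᵀ b)) s≤) t≤ ⟩
            B + (suc (costᵀ b) + k * B)                      ≡⟨ ℕ.+-assoc B (suc (costᵀ b)) (k * B) ⟨
            B + suc (costᵀ b) + k * B                        ≡⟨ cong (_+ k * B) (ℕ.+-comm B (suc (costᵀ b))) ⟩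
            suc (costᵀ b) + B + k * B                        ≡⟨ ℕ.+-assoc (suc (costᵀ b)) B (k * B) ⟩
            suc (costᵀ b) + (B + k * B)                      ∎)
          post
  where
  B = suc (costᵀ b) + c
  open ℕ.≤-Reasoning

update-same : ∀ {A : Set} (M : ℕ → ℕ → A) a i v → update M a i v a i ≡ v
update-same M a i v
  rewrite dec-true (a ℕ.≟ a) refl | dec-true (i ℕ.≟ i) refl = refl

update-other : ∀ {A : Set} (M : ℕ → ℕ → A) a {i} v {i′} → i ≢ i′ → update M a i v a i′ ≡ M a i′
update-other M a {i} v {i′} i≢i′
  rewrite dec-true (a ℕ.≟ a) refl | dec-false (i ℕ.≟ i′) i≢i′ = refl

-- Sums of rationals

-1ℚ : ℚ
-1ℚ = -ℚ 1ℚ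

-- Indexed by numbers rather than by `Fin`, since memory arrays are, and since a prefix load is then
-- the same sum with a smaller upper end.
∑ : (ℕ → ℚ) → ℕ → ℚ
∑ f zero    = 0ℚ
∑ f (suc n) = ∑ f n +ℚ f n

∑-cong : ∀ {f g} n → (∀ {p} → p < n → f p ≡ g p) → ∑ f n ≡ ∑ g n
∑-cong zero    eq = refl
∑-cong (suc n) eq = cong₂ _+ℚ_ (∑-cong n (eq ∘ ℕ.m<n⇒m<1+n)) (eq ℕ.≤-refl)

∑-linear : ∀ {f g h} η n → (∀ {p} → p < n → h p ≡ f p +ℚ η *ℚ g p) →
           ∑ h n ≡ ∑ f n +ℚ η *ℚ ∑ g n
∑-linear η zero eq = sym (trans (ℚ.+-identityˡ _) (ℚ.*-zeroʳ η))
∑-linear {f} {g} η (suc n) eq =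
  trans (cong₂ _+ℚ_ (∑-linear η n (eq ∘ ℕ.m<n⇒m<1+n)) (eq ℕ.≤-refl))
    (solve 5 (λ a b c d e → (a :+ c :* b) :+ (d :+ c :* e) := (a :+ d) :+ c :* (b :+ e))
      refl (∑ f n) (∑ g n) η (f n) (g n))

∑-*-distribˡ : ∀ c f n → ∑ (λ p → c *ℚ f p) n ≡ c *ℚ ∑ f n
∑-*-distribˡ c f zero    = sym (ℚ.*-zeroʳ c)
∑-*-distribˡ c f (suc n) =
  trans (cong (_+ℚ c *ℚ f n) (∑-*-distribˡ c f n)) (sym (ℚ.*-distribˡ-+ c (∑ f n) (f n)))

∑-zero : ∀ {f} n → (∀ {p} → p < n → f p ≡ 0ℚ) → ∑ f n ≡ 0ℚ
∑-zero zero    eq = refl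
∑-zero (suc n) eq = cong₂ _+ℚ_ (∑-zero n (eq ∘ ℕ.m<n⇒m<1+n)) (eq ℕ.≤-refl)

∑-single : ∀ {f p} n → p < n → (∀ {q} → q < n → q ≢ p → f q ≡ 0ℚ) → ∑ f n ≡ f p
∑-single {f} {p} (suc n) p<n zeros with p ℕ.≟ n
... | yes refl = trans (cong (_+ℚ f p) (∑-zero n λ q<n → zeros (ℕ.m<n⇒m<1+n q<n) (ℕ.<⇒≢ q<n)))
                   (ℚ.+-identityˡ _)
... | no  p≢n  = trans (cong₂ _+ℚ_ (∑-single n (ℕ.≤∧≢⇒< (ℕ.≤-pred p<n) p≢n) (zeros ∘ ℕ.m<n⇒m<1+n))
                                   (zeros ℕ.≤-refl (p≢n ∘ sym)))
                   (ℚ.+-identityʳ _)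

p≤p+q : ∀ p {q} → 0ℚ ≤ℚ q → p ≤ℚ p +ℚ q
p≤p+q p 0≤q = subst (_≤ℚ p +ℚ _) (ℚ.+-identityʳ p) (ℚ.+-monoʳ-≤ p 0≤q)

∑-mono : ∀ {f} {m n} → (∀ {p} → p < n → 0ℚ ≤ℚ f p) → m ≤ n → ∑ f m ≤ℚ ∑ f n
∑-mono {n = zero}  nn z≤n = ℚ.≤-refl
∑-mono {f} {m} {suc n} nn m≤ with m ℕ.≟ suc n
... | yes refl = ℚ.≤-refl
... | no  m≢   = ℚ.≤-trans (∑-mono (nn ∘ ℕ.m<n⇒m<1+n) (ℕ.≤-pred (ℕ.≤∧≢⇒< m≤ m≢)))
                   (p≤p+q (∑ f n) (nn ℕ.≤-refl))

∑-term : ∀ {f n p} → (∀ {q} → q < n → 0ℚ ≤ℚ f q) → p < n → f p ≤ℚ ∑ f n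
∑-term {f} {n} {p} nn p<n = ℚ.≤-trans
  (subst (_≤ℚ ∑ f p +ℚ f p) (ℚ.+-identityˡ (f p))
    (ℚ.+-monoˡ-≤ (f p) (∑-mono {f} (λ q<p → nn (ℕ.<-trans q<p p<n)) z≤n)))
  (∑-mono {f} nn p<n)

indicator : ℕ → ℕ → ℚ
indicator k k′ = if does (k ℕ.≟ k′) then 1ℚ else 0ℚ

indicator-yes : ∀ {k k′} → k ≡ k′ → indicator k k′ ≡ 1ℚ
indicator-yes {k} {k′} eq = cong (if_then 1ℚ else 0ℚ) (dec-true (k ℕ.≟ k′) eq)

indicator-no : ∀ {k k′} → k ≢ k′ → indicator k k′ ≡ 0ℚ
indicator-no {k} {k′} neq = cong (if_then 1ℚ else 0ℚ) (dec-false (k ℕ.≟ k′) neq)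

nonneg∧≮⇒≡0 : ∀ {q} → 0ℚ ≤ℚ q → ¬ 0ℚ <ℚ q → q ≡ 0ℚ
nonneg∧≮⇒≡0 0≤q ¬0<q = ℚ.≤-antisym (ℚ.≮⇒≥ ¬0<q) 0≤q

-- Scanning a support for nested hulls

module Supports (ℓ : ℕ) (cls : ℕ → ℕ) (R : ℕ → ℚ) where

  NonCrossing : Set
  NonCrossing = ∀ {a b a′ b′} → a < b → b < a′ → a′ < b′ → b′ < ℓ →
    cls a ≡ cls a′ → cls b ≡ cls b′ → cls a ≡ cls b

  -- The class weight `F` is left open because a balance proved for all `F` at once serves two
  -- purposes: `F = R` gives prefix loads, and `F = indicator k` gives the part of class `k` below a
  -- cut.
  weigh : (ℕ → ℚ) → (ℕ → ℚ) → ℕ → ℚ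
  weigh F f = ∑ (λ p → F (cls p) *ℚ f p)

  -- A condition on pairs of positive entries across the cut, hence inherited when supports shrink.
  -- Classes with `R = 0` are exempt, as they do not contribute to prefix loads.
  OnlySplit : (ℕ → ℚ) → ℕ → ℕ → Set
  OnlySplit w j k = ∀ {a b} → a < j → j ≤ b → b < ℓ → cls a ≡ cls b →
    0ℚ <ℚ w a → 0ℚ <ℚ w b → R (cls a) ≡ 0ℚ ⊎ cls a ≡ k

  -- Speaks only about classes with a positive entry below `n`. It is vacuous at `n = 0`, so the
  -- values left in the array by an earlier iteration do no harm.
  LastSupport : (ℕ → ℚ) → (ℕ → ℕ) → ℕ → Set
  LastSupport w last n = ∀ {p} → p < n → 0ℚ <ℚ w p →
    p ≤ last (cls p) × last (cls p) < n × 0ℚ <ℚ w (last (cls p)) × cls (last (cls p)) ≡ cls p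

  record Chord (w : ℕ → ℚ) (a b : ℕ) : Set where
    field
      b<ℓ   : b < ℓ
      class : cls a ≡ cls b
      a-pos : 0ℚ <ℚ w a
      b-pos : 0ℚ <ℚ w b
      final : ∀ {q} → q < ℓ → cls q ≡ cls b → 0ℚ <ℚ w q → q ≤ b

  -- In `two`, both weights being 1 makes the shifts cancel under `R`, and the classes being
  -- distinct rules this case out at a cut that only one class splits. In `one`, the shift is
  -- invisible to `R` or belongs to the only split class.
  data Cut (w sg : ℕ → ℚ) (j : ℕ) : Set where
    flat : (∀ F → weigh F sg j ≡ 0ℚ) → Cut w sg j
    one  : ∀ {a b} → Chord w a b → a < j → j ≤ b →
           (∀ F → weigh F sg j ≡ F (cls b)) →
           R (cls b) ≡ 0ℚ ⊎ OnlySplit w j (cls b) → Cut w sg j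
    two  : ∀ {a b a′ b′} → Chord w a b → a < j → j ≤ b →
           Chord w a′ b′ → a′ < j → j ≤ b′ →
           cls b ≢ cls b′ → R (cls b) ≡ 1ℚ → R (cls b′) ≡ 1ℚ →
           (∀ F → weigh F sg j ≡ F (cls b) -ℚ F (cls b′)) → Cut w sg j

  Sign : (w sg : ℕ → ℚ) → ℕ → Set
  Sign w sg p = sg p ≡ 0ℚ ⊎ (0ℚ <ℚ w p × (sg p ≡ 1ℚ ⊎ sg p ≡ -1ℚ))

  weigh-cong : ∀ {f g} F n → (∀ {p} → p < n → f p ≡ g p) → weigh F f n ≡ weigh F g n
  weigh-cong F n eq = ∑-cong n λ {p} p<n → cong (F (cls p) *ℚ_) (eq p<n)

  cut-cong : ∀ {w f g} j → (∀ {p} → p < j → g p ≡ f p) → Cut w f j → Cut w g j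
  cut-cong j eq (flat bal) = flat λ F → trans (weigh-cong F j eq) (bal F)
  cut-cong j eq (one c a b bal alone) = one c a b (λ F → trans (weigh-cong F j eq) (bal F)) alone
  cut-cong j eq (two c a b c′ a′ b′ n r r′ bal) =
    two c a b c′ a′ b′ n r r′ λ F → trans (weigh-cong F j eq) (bal F)

  Settled : (ℕ → ℚ) → Set
  Settled w = ∀ {p q} → p < q → q < ℓ → cls p ≡ cls q → 0ℚ <ℚ w p → ¬ 0ℚ <ℚ w q

  -- The second alternative of `exit` supplies both signs: whichever direction the cost prescribes,
  -- some entry then decreases.
  record Swept (w sg : ℕ → ℚ) : Set where
    field
      signs  : ∀ {p} → p < ℓ → Sign w sg p
      cuts   : ∀ {j} → j < ℓ → Cut w sg j
      closed : ∀ F → weigh F sg ℓ ≡ 0ℚ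
      exit   : Settled w ⊎ (∃[ s ] ∃[ r ] s < ℓ × sg s ≡ 1ℚ × r < ℓ × sg r ≡ -1ℚ)

  module Scan (w : ℕ → ℚ) (last : ℕ → ℕ) where

    -- Phases 0 to 3 of the scan.  seek: no class with two support elements met
    -- yet; top: inside the hull s, …, e of the first such class; child:
    -- moreover inside the hull u, …, t of a class nested in it; done: beyond e.
    data Phase (sg : ℕ → ℚ) (i : ℕ) : ℕ → ℕ → ℕ → Set where
      seek  : ∀ {e t} →
              (∀ {p} → p < i → 0ℚ <ℚ w p → ¬ p < last (cls p)) →
              (∀ F → weigh F sg i ≡ 0ℚ) → Phase sg i 0 e t
      top   : ∀ {s e t} → Chord w s e → s < i → i ≤ e → sg s ≡ 1ℚ →
              (∀ F → weigh F sg i ≡ F (cls e)) →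
              R (cls e) ≡ 0ℚ ⊎ OnlySplit w i (cls e) → Phase sg i 1 e t
      child : ∀ {s u e t} → Chord w s e → s < u → sg s ≡ 1ℚ →
              Chord w u t → u < i → i ≤ t → t < e → cls e ≢ cls t →
              R (cls e) ≡ 1ℚ → R (cls t) ≡ 1ℚ →
              (∀ F → weigh F sg i ≡ F (cls e) -ℚ F (cls t)) →
              OnlySplit w u (cls e) → Phase sg i 2 e t
      done  : ∀ {s r e t} → s < i → sg s ≡ 1ℚ → r < i → sg r ≡ -1ℚ →
              (∀ F → weigh F sg i ≡ 0ℚ) → Phase sg i 3 e t

    phase⇒cut : ∀ {sg i φ e t} → Phase sg i φ e t → Cut w sg i
    phase⇒cut (seek _ bal)                = flat bal
    phase⇒cut (top c s<i i≤e _ bal alone) = one c s<i i≤e bal alone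
    phase⇒cut (child c s<u _ c′ u<i i≤t t<e e≢t r r′ bal _) =
      two c (ℕ.<-trans s<u u<i) (ℕ.≤-trans i≤t (ℕ.<⇒≤ t<e)) c′ u<i i≤t e≢t r r′ bal
    phase⇒cut (done _ _ _ _ bal)          = flat bal

    record Scanned (sg : ℕ → ℚ) (i φ e t : ℕ) : Set where
      constructor scanned
      field
        phase : Phase sg i φ e t
        signs : ∀ {p} → p < i → Sign w sg p
        cuts  : ∀ {j} → j < i → Cut w sg j

    start : ∀ {sg e t} → Scanned sg 0 0 e t
    start = scanned (seek (λ ()) λ _ → refl) (λ ()) λ ()

    module Step {sg sg′ : ℕ → ℚ} {i φ e t φ′ e′ t′ : ℕ} {v : ℚ} (i<ℓ : i < ℓ)
                (agree : ∀ {p} → p < i → sg′ p ≡ sg p) (new : sg′ i ≡ v)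
                (S : Scanned sg i φ e t) where

      open Scanned S

      extend : Sign w sg′ i → Phase sg′ (suc i) φ′ e′ t′ → Scanned sg′ (suc i) φ′ e′ t′
      extend sign phase′ = scanned phase′ signs′ cuts′
        where
        signs′ : ∀ {p} → p < suc i → Sign w sg′ p
        signs′ {p} p<1+i with p ℕ.≟ i
        ... | yes refl = sign
        ... | no  p≢i  with signs p<i
          where p<i = ℕ.≤∧≢⇒< (ℕ.≤-pred p<1+i) p≢i
        ...   | σ = subst (λ x → x ≡ 0ℚ ⊎ (0ℚ <ℚ w p × (x ≡ 1ℚ ⊎ x ≡ -1ℚ)))
                      (sym (agree (ℕ.≤∧≢⇒< (ℕ.≤-pred p<1+i) p≢i))) σ
        cuts′ : ∀ {j} → j < suc i → Cut w sg′ j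
        cuts′ {j} j<1+i with j ℕ.≟ i
        ... | yes refl = cut-cong j agree (phase⇒cut phase)
        ... | no  j≢i  = cut-cong j (λ p<j → agree (ℕ.<-trans p<j j<i)) (cuts j<i)
          where j<i = ℕ.≤∧≢⇒< (ℕ.≤-pred j<1+i) j≢i

      balance : ∀ {x} F → weigh F sg i ≡ x → weigh F sg′ (suc i) ≡ x +ℚ F (cls i) *ℚ v
      balance F eq = cong₂ _+ℚ_ (trans (weigh-cong F i agree) eq) (cong (F (cls i) *ℚ_) new)

      balance₀ : ∀ {x} F → v ≡ 0ℚ → weigh F sg i ≡ x → weigh F sg′ (suc i) ≡ x
      balance₀ {x} F refl eq = trans (balance F eq)
        (solve 2 (λ x f → x :+ f :* con 0ℚ := x) refl x (F (cls i)))

    module Transitions (noncrossing : NonCrossing) (isLast : LastSupport w last ℓ) where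

      chord : ∀ {p} → p < ℓ → 0ℚ <ℚ w p → Chord w p (last (cls p))
      chord {p} p<ℓ pos with isLast p<ℓ pos
      ... | _ , last<ℓ , last-pos , same = record
        { b<ℓ   = last<ℓ
        ; class = sym same
        ; a-pos = pos
        ; b-pos = last-pos
        ; final = λ {q} q<ℓ q-class q-pos →
            subst (λ k → q ≤ last k) (trans q-class same) (proj₁ (isLast q<ℓ q-pos))
        }

      module _ {sg sg′ : ℕ → ℚ} {i e t : ℕ} (i<ℓ : i < ℓ)
               (agree : ∀ {p} → p < i → sg′ p ≡ sg p) where

        seek→seek : Scanned sg i 0 e t → ¬ (0ℚ <ℚ w i × i < last (cls i)) → sg′ i ≡ 0ℚ →
                    Scanned sg′ (suc i) 0 e t
        seek→seek S@(scanned (seek none bal) _ _) ¬open new =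
          extend (inj₁ new) (seek none′ λ F → balance₀ F refl (bal F))
          where
          open Step i<ℓ agree new S
          none′ : ∀ {p} → p < suc i → 0ℚ <ℚ w p → ¬ p < last (cls p)
          none′ {p} p<1+i pos p<last with p ℕ.≟ i
          ... | yes refl = ¬open (pos , p<last)
          ... | no  p≢i  = none (ℕ.≤∧≢⇒< (ℕ.≤-pred p<1+i) p≢i) pos p<last

        seek→top : Scanned sg i 0 e t → 0ℚ <ℚ w i → i < last (cls i) → sg′ i ≡ 1ℚ →
                   Scanned sg′ (suc i) 1 (last (cls i)) t
        seek→top S@(scanned (seek none bal) _ _) pos i<last new =
          extend (inj₂ (pos , inj₁ new))
            (top c ℕ.≤-refl i<last new
              (λ F → trans (balance F (bal F))
                (trans (solve 1 (λ f → con 0ℚ :+ f :* con 1ℚ := f) refl (F (cls i)))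
                  (cong F (Chord.class c))))
              (inj₂ only))
          where
          open Step i<ℓ agree new S
          c = chord i<ℓ pos
          -- A position before `i` with a partner beyond `i` would have opened a hull when the scan
          -- passed it.
          only : OnlySplit w (suc i) (cls (last (cls i)))
          only {a} {b} a<1+i i<b b<ℓ same a-pos b-pos with a ℕ.≟ i
          ... | yes refl = inj₂ (Chord.class c)
          ... | no  a≢i  = contradiction
            (ℕ.<-≤-trans (ℕ.<-trans a<i i<b)
              (Chord.final (chord (ℕ.<-trans a<i i<ℓ) a-pos) b<ℓ
                (trans (sym same) (Chord.class (chord (ℕ.<-trans a<i i<ℓ) a-pos))) b-pos))
            (none a<i a-pos)
            where a<i = ℕ.≤∧≢⇒< (ℕ.≤-pred a<1+i) a≢i

        top→done : Scanned sg i 1 e t → e ≤ i → sg′ i ≡ -1ℚ → Scanned sg′ (suc i) 3 e t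
        top→done S@(scanned (top c s<i i≤e s+ bal _) _ _) e≤i new
          with ℕ.≤-antisym e≤i i≤e
        ... | refl = extend (inj₂ (Chord.b-pos c , inj₂ new))
            (done (ℕ.m<n⇒m<1+n s<i) (trans (agree s<i) s+) ℕ.≤-refl new
              λ F → trans (balance F (bal F))
                (solve 1 (λ f → f :+ f :* con -1ℚ := con 0ℚ) refl (F (cls e))))
          where open Step i<ℓ agree new S

        -- Passing `i` without opening a child keeps the cut harmless for one of three reasons: the
        -- outer class has weight 0, the class of `i` has weight 0 and is exempt, or `i` belongs to
        -- the outer class itself.
        top→top : Scanned sg i 1 e t → ¬ e ≤ i →
                  (0ℚ <ℚ w i → i < last (cls i) → R (cls e) ≡ 0ℚ ⊎ R (cls i) ≡ 0ℚ ⊎ cls i ≡ cls e) →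
                  sg′ i ≡ 0ℚ → Scanned sg′ (suc i) 1 e t
        top→top S@(scanned (top c s<i i≤e s+ bal alone) _ _) e≰i ¬open new =
          extend (inj₁ new)
            (top c (ℕ.m<n⇒m<1+n s<i) (ℕ.≰⇒> e≰i) (trans (agree s<i) s+)
              (λ F → balance₀ F refl (bal F)) (alone′ alone))
          where
          open Step i<ℓ agree new S
          alone′ : R (cls e) ≡ 0ℚ ⊎ OnlySplit w i (cls e) →
                   R (cls e) ≡ 0ℚ ⊎ OnlySplit w (suc i) (cls e)
          alone′ (inj₁ r)    = inj₁ r
          alone′ (inj₂ only) with R (cls e) ℚ.≟ 0ℚ
          ... | yes r≡0 = inj₁ r≡0
          ... | no  r≢0 = inj₂ only′
            where
            only′ : OnlySplit w (suc i) (cls e)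
            only′ {a} {b} a<1+i i<b b<ℓ same a-pos b-pos with a ℕ.≟ i
            ... | no  a≢i  = only (ℕ.≤∧≢⇒< (ℕ.≤-pred a<1+i) a≢i) (ℕ.<⇒≤ i<b) b<ℓ same a-pos b-pos
            ... | yes refl with ¬open a-pos (ℕ.<-≤-trans i<b
                    (Chord.final (chord i<ℓ a-pos) b<ℓ (trans (sym same) (Chord.class (chord i<ℓ a-pos))) b-pos))
            ...   | inj₁ r≡0 = contradiction r≡0 r≢0
            ...   | inj₂ x   = x

        top→child : Scanned sg i 1 e t → ¬ e ≤ i → 0ℚ <ℚ w i → i < last (cls i) →
                    R (cls e) ≡ 1ℚ → R (cls i) ≡ 1ℚ → cls i ≢ cls e →
                    sg′ i ≡ -1ℚ → Scanned sg′ (suc i) 2 e (last (cls i))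
        top→child S@(scanned (top {s} c s<i i≤e s+ bal (inj₁ r≡0)) _ _) _ _ _ r≡1 =
          contradiction (trans (sym r≡1) r≡0) λ ()
        top→child S@(scanned (top {s} c s<i i≤e s+ bal (inj₂ only)) _ _) e≰i pos i<last re ri i≢e new =
          extend (inj₂ (pos , inj₂ new))
            (child c s<i (trans (agree s<i) s+) c′ ℕ.≤-refl i<last last<e
              (λ eq → i≢e (trans (Chord.class c′) (sym eq)))
              re (trans (cong R (sym (Chord.class c′))) ri)
              (λ F → trans (balance F (bal F))
                (trans (solve 2 (λ f g → f :+ g :* con -1ℚ := f :- g) refl (F (cls e)) (F (cls i)))
                  (cong (λ k → F (cls e) -ℚ F k) (Chord.class c′))))
              only)
          where
          open Step i<ℓ agree new S
          c′ = chord i<ℓ pos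
          -- Otherwise `s < i < e < last (cls i)` would be a crossing; equality is excluded because
          -- the classes differ.
          last<e : last (cls i) < e
          last<e = ℕ.≰⇒> λ e≤last → i≢e (sym (trans (sym (Chord.class c))
            (noncrossing s<i (ℕ.≰⇒> e≰i)
              (ℕ.≤∧≢⇒< e≤last λ eq → i≢e (trans (Chord.class c′) (cong cls (sym eq))))
              (Chord.b<ℓ c′) (Chord.class c) (Chord.class c′))))

        child→child : Scanned sg i 2 e t → ¬ t ≤ i → sg′ i ≡ 0ℚ → Scanned sg′ (suc i) 2 e t
        child→child S@(scanned (child c s<u s+ c′ u<i i≤t t<e e≢t r r′ bal only) _ _) t≰i new =
          extend (inj₁ new)
            (child c s<u (trans (agree (ℕ.<-trans s<u u<i)) s+) c′ (ℕ.m<n⇒m<1+n u<i) (ℕ.≰⇒> t≰i)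
              t<e e≢t r r′ (λ F → balance₀ F refl (bal F)) only)
          where open Step i<ℓ agree new S

        -- A class splitting the cut just after `t` cannot be that of the child, whose last support
        -- element is `t`, nor have an element strictly between `u` and `t`, as it would cross the
        -- child. So it already splits the cut at `u`, and this is why the child phase carries
        -- `OnlySplit` at `u` along.
        child→top : Scanned sg i 2 e t → t ≤ i → sg′ i ≡ 1ℚ → Scanned sg′ (suc i) 1 e t
        child→top S@(scanned (child {s} {u} c s<u s+ c′ u<i i≤t t<e e≢t r r′ bal only) _ _) t≤i new
          with ℕ.≤-antisym t≤i i≤t
        ... | refl =
          extend (inj₂ (Chord.b-pos c′ , inj₁ new))
            (top c (ℕ.m<n⇒m<1+n s<i) t<e (trans (agree s<i) s+)
              (λ F → trans (balance F (bal F))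
                (solve 2 (λ f g → (f :- g) :+ g :* con 1ℚ := f) refl (F (cls e)) (F (cls t))))
              (inj₂ only′))
          where
          open Step i<ℓ agree new S
          s<i = ℕ.<-trans s<u u<i
          only′ : OnlySplit w (suc t) (cls e)
          only′ {a} {b} a≤t t<b b<ℓ same a-pos b-pos with cls a ℕ.≟ cls t
          ... | yes a≡t = contradiction (Chord.final c′ b<ℓ (trans (sym same) a≡t) b-pos) (ℕ.<⇒≱ t<b)
          ... | no  a≢t with a ℕ.<? u
          ...   | yes a<u = only a<u (ℕ.<⇒≤ (ℕ.<-trans u<i t<b)) b<ℓ same a-pos b-pos
          ...   | no  a≮u = contradiction
                    (noncrossing
                      (ℕ.≤∧≢⇒< (ℕ.≮⇒≥ a≮u) λ eq → a≢t (trans (cong cls (sym eq)) (Chord.class c′)))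
                      (ℕ.≤∧≢⇒< (ℕ.≤-pred a≤t) λ eq → a≢t (cong cls eq))
                      t<b b<ℓ (Chord.class c′) same)
                    (λ eq → a≢t (trans (sym eq) (Chord.class c′)))

        done→done : Scanned sg i 3 e t → sg′ i ≡ 0ℚ → Scanned sg′ (suc i) 3 e t
        done→done S@(scanned (done s<i s+ r<i r- bal) _ _) new =
          extend (inj₁ new)
            (done (ℕ.m<n⇒m<1+n s<i) (trans (agree s<i) s+) (ℕ.m<n⇒m<1+n r<i) (trans (agree r<i) r-)
              λ F → balance₀ F refl (bal F))
          where open Step i<ℓ agree new S

      -- Open hulls are impossible at the end because their right ends are positions below `ℓ`. If
      -- the scan is still seeking, no class has two positive entries.
      finish : ∀ {sg φ e t} → Scanned sg ℓ φ e t → Swept w sg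
      finish (scanned (top c _ ℓ≤e _ _ _) _ _) = contradiction (Chord.b<ℓ c) (ℕ.≤⇒≯ ℓ≤e)
      finish (scanned (child _ _ _ c _ ℓ≤t _ _ _ _ _ _) _ _) = contradiction (Chord.b<ℓ c) (ℕ.≤⇒≯ ℓ≤t)
      finish (scanned (seek none bal) signs cuts) = record
        { signs = signs ; cuts = cuts ; closed = bal
        ; exit  = inj₁ λ {p} {q} p<q q<ℓ eq p-pos q-pos → none (ℕ.<-trans p<q q<ℓ) p-pos
            (ℕ.<-≤-trans p<q (subst (λ k → q ≤ last k) (sym eq) (proj₁ (isLast q<ℓ q-pos)))) }
      finish (scanned (done s<ℓ s+ r<ℓ r- bal) signs cuts) = record
        { signs = signs ; cuts = cuts ; closed = bal ; exit = inj₂ (_ , _ , s<ℓ , s+ , r<ℓ , r-) }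

-- Rounding moves

∣∣-least : ∀ {x y} → x ≤ℚ y → -ℚ x ≤ℚ y → ℚ.∣ x ∣ ≤ℚ y
∣∣-least {x} x≤y -x≤y with ℚ.∣p∣≡p∨∣p∣≡-p x
... | inj₁ eq = subst (_≤ℚ _) (sym eq) x≤y
... | inj₂ eq = subst (_≤ℚ _) (sym eq) -x≤y

p-q≤p : ∀ p {q} → 0ℚ ≤ℚ q → p -ℚ q ≤ℚ p
p-q≤p p 0≤q = subst (p -ℚ _ ≤ℚ_) (ℚ.+-identityʳ p) (ℚ.+-monoʳ-≤ p (ℚ.neg-antimono-≤ 0≤q))

*-monoˡ-≤ : ∀ {r x y} → 0ℚ ≤ℚ r → x ≤ℚ y → r *ℚ x ≤ℚ r *ℚ y
*-monoˡ-≤ {r} 0≤r x≤y = ℚ.*-monoˡ-≤-nonNeg r {{ℚ.nonNegative 0≤r}} x≤y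

0≤* : ∀ {p q} → 0ℚ ≤ℚ p → 0ℚ ≤ℚ q → 0ℚ ≤ℚ p *ℚ q
0≤* {p} {q} 0≤p 0≤q = subst (_≤ℚ p *ℚ q) (ℚ.*-zeroʳ p) (*-monoˡ-≤ 0≤p 0≤q)

-- The number of positive entries as a potential

tally : ∀ {P : Set} → Dec P → ℕ → ℕ
tally (yes _) n = suc n
tally (no  _) n = n

tally-≤ : ∀ {P : Set} (P? : Dec P) {m n} → m ≤ n → tally P? m ≤ suc n
tally-≤ (yes _) m≤n = s≤s m≤n
tally-≤ (no  _) m≤n = ℕ.m≤n⇒m≤1+n m≤n

tally-mono : ∀ {P Q : Set} (P? : Dec P) (Q? : Dec Q) {m n} → (P → Q) → m ≤ n → tally P? m ≤ tally Q? n
tally-mono (yes _) (yes _) f m≤n = s≤s m≤n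
tally-mono (yes p) (no ¬q) f m≤n = contradiction (f p) ¬q
tally-mono (no  _) Q?      f m≤n = ℕ.≤-trans m≤n (n≤tally Q?)
  where
  n≤tally : ∀ {Q : Set} (Q? : Dec Q) {n} → n ≤ tally Q? n
  n≤tally (yes _) = ℕ.n≤1+n _
  n≤tally (no  _) = ℕ.≤-refl

tally-no : ∀ {P : Set} (P? : Dec P) {n} → ¬ P → tally P? n ≡ n
tally-no (yes p) ¬p = contradiction p ¬p
tally-no (no  _) ¬p = refl

tally-yes : ∀ {P : Set} (P? : Dec P) {n} → P → tally P? n ≡ suc n
tally-yes (yes _) p = refl
tally-yes (no ¬p) p = contradiction p ¬p

support : (ℕ → ℚ) → ℕ → ℕ
support w zero    = 0
support w (suc n) = tally (0ℚ ℚ.<? w n) (support w n)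

support≤ : ∀ w n → support w n ≤ n
support≤ w zero    = z≤n
support≤ w (suc n) = tally-≤ (0ℚ ℚ.<? w n) (support≤ w n)

support-mono : ∀ {w w′} n → (∀ {p} → p < n → 0ℚ <ℚ w′ p → 0ℚ <ℚ w p) → support w′ n ≤ support w n
support-mono zero shrink = z≤n
support-mono {w} {w′} (suc n) shrink =
  tally-mono (0ℚ ℚ.<? w′ n) (0ℚ ℚ.<? w n) (shrink ℕ.≤-refl) (support-mono n (shrink ∘ ℕ.m<n⇒m<1+n))

support-strict : ∀ {w w′ r} n → (∀ {p} → p < n → 0ℚ <ℚ w′ p → 0ℚ <ℚ w p) →
                 r < n → 0ℚ <ℚ w r → ¬ 0ℚ <ℚ w′ r → support w′ n < support w n
support-strict {w} {w′} {r} (suc n) shrink r<1+n pos ¬pos with r ℕ.≟ n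
... | yes refl = subst₂ _<_ (sym (tally-no (0ℚ ℚ.<? w′ r) ¬pos)) (sym (tally-yes (0ℚ ℚ.<? w r) pos))
                   (s≤s (support-mono n (shrink ∘ ℕ.m<n⇒m<1+n)))
... | no r≢n = ℕ.≤-trans (s≤s-tally (0ℚ ℚ.<? w′ n))
    (tally-mono (0ℚ ℚ.<? w′ n) (0ℚ ℚ.<? w n) (shrink ℕ.≤-refl)
      (support-strict {w} {w′} n (shrink ∘ ℕ.m<n⇒m<1+n) (ℕ.≤∧≢⇒< (ℕ.≤-pred r<1+n) r≢n) pos ¬pos))
  where
  s≤s-tally : ∀ {P : Set} (P? : Dec P) {n} → suc (tally P? n) ≤ tally P? (suc n)
  s≤s-tally (yes _) = ℕ.≤-refl
  s≤s-tally (no  _) = ℕ.≤-refl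

support-pos : ∀ {w r} n → r < n → 0ℚ <ℚ w r → 0 < support w n
support-pos {w} {r} n r<n pos = ℕ.≤-<-trans z≤n
  (support-strict {w} {λ _ → 0ℚ} n (λ _ p → contradiction p (ℚ.<-irrefl refl)) r<n pos (ℚ.<-irrefl refl))

-- `G` is the total load of each class, `κ` the cost per unit of load at each position, and `w₀` the
-- load vector before any move.
module Rounding (ℓ : ℕ) (cls : ℕ → ℕ) (R G κ : ℕ → ℚ) (w₀ : ℕ → ℚ) where

  open Supports ℓ cls R public

  -- In split, u is the part of the class below the cut at the moment when it
  -- became the only class split there.
  data Prefix (w : ℕ → ℚ) (j : ℕ) : Set where
    exact : weigh R w j ≡ weigh R w₀ j → Prefix w j
    split : ∀ {q u} → q < ℓ → 0ℚ ≤ℚ u → u ≤ℚ G (cls q) →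
            weigh R w j ≡ weigh R w₀ j +ℚ R (cls q) *ℚ (weigh (indicator (cls q)) w j -ℚ u) →
            OnlySplit w j (cls q) → Prefix w j

  record Invariant (w : ℕ → ℚ) : Set where
    field
      nonneg : ∀ {p} → p < ℓ → 0ℚ ≤ℚ w p
      sums   : ∀ {p} → p < ℓ → weigh (indicator (cls p)) w ℓ ≡ G (cls p)
      total  : weigh R w ℓ ≡ weigh R w₀ ℓ
      prefix : ∀ {j} → j < ℓ → Prefix w j
      costs  : ∑ (λ p → κ p *ℚ w p) ℓ ≤ℚ ∑ (λ p → κ p *ℚ w₀ p) ℓ

    weigh-nonneg : ∀ k {p} → p < ℓ → 0ℚ ≤ℚ indicator k (cls p) *ℚ w p
    weigh-nonneg k {p} p<ℓ with k ℕ.≟ cls p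
    ... | yes eq = subst (λ x → 0ℚ ≤ℚ x *ℚ w p) (sym (indicator-yes eq))
                     (subst (0ℚ ≤ℚ_) (sym (ℚ.*-identityˡ (w p))) (nonneg p<ℓ))
    ... | no neq = subst (λ x → 0ℚ ≤ℚ x *ℚ w p) (sym (indicator-no neq))
                     (subst (0ℚ ≤ℚ_) (sym (ℚ.*-zeroˡ (w p))) ℚ.≤-refl)

    0≤part : ∀ k {j} → j ≤ ℓ → 0ℚ ≤ℚ weigh (indicator k) w j
    0≤part k j≤ℓ = ∑-mono {m = 0} (λ p<j → weigh-nonneg k (ℕ.<-≤-trans p<j j≤ℓ)) z≤n

    part≤ : ∀ {q j} → q < ℓ → j ≤ ℓ → weigh (indicator (cls q)) w j ≤ℚ G (cls q)
    part≤ {q} {j} q<ℓ j≤ℓ = subst (weigh (indicator (cls q)) w j ≤ℚ_) (sums q<ℓ)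
      (∑-mono (weigh-nonneg (cls q)) j≤ℓ)

    w≤G : ∀ {p} → p < ℓ → w p ≤ℚ G (cls p)
    w≤G {p} p<ℓ = subst₂ _≤ℚ_
      (trans (cong (_*ℚ w p) (indicator-yes {cls p} refl)) (ℚ.*-identityˡ (w p)))
      (sums p<ℓ) (∑-term (weigh-nonneg (cls p)) p<ℓ)

    settled⇒full : Settled w → ∀ {p} → p < ℓ → 0ℚ <ℚ w p → w p ≡ G (cls p)
    settled⇒full settled {p} p<ℓ pos =
      trans (sym (trans (cong (_*ℚ w p) (indicator-yes {cls p} refl)) (ℚ.*-identityˡ (w p))))
        (trans (sym (∑-single ℓ p<ℓ others)) (sums p<ℓ))
      where
      others : ∀ {q} → q < ℓ → q ≢ p → indicator (cls p) (cls q) *ℚ w q ≡ 0ℚ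
      others {q} q<ℓ q≢p with cls p ℕ.≟ cls q
      ... | no neq = trans (cong (_*ℚ w q) (indicator-no neq)) (ℚ.*-zeroˡ (w q))
      ... | yes eq = trans (cong (indicator (cls p) (cls q) *ℚ_)
                             (nonneg∧≮⇒≡0 (nonneg q<ℓ) ¬pos)) (ℚ.*-zeroʳ (indicator (cls p) (cls q)))
        where
        ¬pos : ¬ 0ℚ <ℚ w q
        ¬pos q-pos with ℕ.<-cmp p q
        ... | tri< p<q _ _ = settled p<q q<ℓ eq pos q-pos
        ... | tri≈ _ p≡q _ = q≢p (sym p≡q)
        ... | tri> _ _ q<p = settled q<p p<ℓ (sym eq) q-pos pos

    -- In the `split` case both the recorded part `u` and the present part of the class lie between
    -- 0 and `G`. Their difference is thus at most `G` in absolute value, however many moves lie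
    -- between the two.
    deviation : ∀ {D} → (∀ k → 0ℚ ≤ℚ R k) → 0ℚ ≤ℚ D → (∀ {q} → q < ℓ → R (cls q) *ℚ G (cls q) ≤ℚ D) →
                ∀ {j} → j < ℓ → ℚ.∣ weigh R w₀ j -ℚ weigh R w j ∣ ≤ℚ D
    deviation {D} 0≤R 0≤D RG≤D {j} j<ℓ with prefix j<ℓ
    ... | exact eq = subst (λ x → ℚ.∣ x ∣ ≤ℚ D)
                       (sym (trans (cong (λ x → weigh R w₀ j -ℚ x) eq) (ℚ.+-inverseʳ (weigh R w₀ j)))) 0≤D
    ... | split {q} {u} q<ℓ 0≤u u≤G eq _ = ∣∣-least
      (ℚ.≤-trans (ℚ.≤-reflexive (trans (cong (λ x → weigh R w₀ j -ℚ x) eq)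
          (solve 4 (λ a r p u → a :- (a :+ r :* (p :- u)) := r :* (u :- p)) refl
            (weigh R w₀ j) (R (cls q)) part u)))
        (bound (ℚ.≤-trans (p-q≤p u (0≤part (cls q) (ℕ.<⇒≤ j<ℓ))) u≤G)))
      (ℚ.≤-trans (ℚ.≤-reflexive (trans (cong (λ x → -ℚ (weigh R w₀ j -ℚ x)) eq)
          (solve 4 (λ a r p u → :- (a :- (a :+ r :* (p :- u))) := r :* (p :- u)) refl
            (weigh R w₀ j) (R (cls q)) part u)))
        (bound (ℚ.≤-trans (p-q≤p part 0≤u) (part≤ q<ℓ (ℕ.<⇒≤ j<ℓ)))))
      where
      part = weigh (indicator (cls q)) w j
      bound : ∀ {x} → x ≤ℚ G (cls q) → R (cls q) *ℚ x ≤ℚ D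
      bound x≤G = ℚ.≤-trans (*-monoˡ-≤ (0≤R (cls q)) x≤G) (RG≤D q<ℓ)

  -- Any chord of positive weight across such a cut must belong to `k`, and two chords of distinct
  -- classes cannot both do so. This keeps the formula in `split` valid through all later moves.
  only-cut : ∀ {w sg j k} → Cut w sg j → OnlySplit w j k →
             weigh R sg j ≡ R k *ℚ weigh (indicator k) sg j
  only-cut {k = k} (flat bal) only = trans (bal R)
    (sym (trans (cong (R k *ℚ_) (bal (indicator k))) (ℚ.*-zeroʳ (R k))))
  only-cut {k = k} (one {b = b} c a<j j≤b bal _) only with k ℕ.≟ cls b
  ... | yes refl = trans (bal R) (sym (trans
          (cong (R (cls b) *ℚ_) (trans (bal (indicator (cls b))) (indicator-yes {cls b} refl)))
          (ℚ.*-identityʳ _)))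
  ... | no neq with only a<j j≤b (Chord.b<ℓ c) (Chord.class c) (Chord.a-pos c) (Chord.b-pos c)
  ...   | inj₂ eq = contradiction (trans (sym eq) (Chord.class c)) neq
  ...   | inj₁ r≡0 = trans (bal R) (trans (trans (cong R (sym (Chord.class c))) r≡0)
            (sym (trans (cong (R k *ℚ_) (trans (bal (indicator k)) (indicator-no neq))) (ℚ.*-zeroʳ (R k)))))
  only-cut (two c a<j j≤b c′ a′<j j≤b′ b≢b′ r r′ bal) only
    with only a<j j≤b (Chord.b<ℓ c) (Chord.class c) (Chord.a-pos c) (Chord.b-pos c)
       | only a′<j j≤b′ (Chord.b<ℓ c′) (Chord.class c′) (Chord.a-pos c′) (Chord.b-pos c′)
  ... | inj₁ z  | _       = contradiction (trans (sym r) (trans (cong R (sym (Chord.class c))) z)) λ ()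
  ... | inj₂ _  | inj₁ z  = contradiction (trans (sym r′) (trans (cong R (sym (Chord.class c′))) z)) λ ()
  ... | inj₂ eq | inj₂ eq′ = contradiction
          (trans (sym (Chord.class c)) (trans eq (trans (sym eq′) (Chord.class c′)))) b≢b′

  record Move (w sg : ℕ → ℚ) (η : ℚ) (w′ : ℕ → ℚ) : Set where
    field
      swept   : Swept w sg
      moved   : ∀ {p} → p < ℓ → w′ p ≡ w p +ℚ η *ℚ sg p
      stays   : ∀ {p} → p < ℓ → 0ℚ ≤ℚ w′ p
      cheaper : η *ℚ ∑ (λ p → κ p *ℚ sg p) ℓ ≤ℚ 0ℚ

  module _ {w sg : ℕ → ℚ} {η : ℚ} {w′ : ℕ → ℚ} (I : Invariant w) (M : Move w sg η w′) where
    open Invariant I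
    open Move M
    open Swept swept

    -- Nonzero signs occur only at positive entries, so an entry that has vanished is never moved
    -- again.
    shrinks : ∀ {p} → p < ℓ → 0ℚ <ℚ w′ p → 0ℚ <ℚ w p
    shrinks {p} p<ℓ pos with signs p<ℓ
    ... | inj₂ (w-pos , _) = w-pos
    ... | inj₁ eq = subst (0ℚ <ℚ_) (trans (moved p<ℓ)
                      (trans (cong (λ x → w p +ℚ η *ℚ x) eq)
                        (solve 2 (λ a b → a :+ b :* con 0ℚ := a) refl (w p) η))) pos

    settled-move : Settled w → Settled w′
    settled-move settled p<q q<ℓ eq p-pos q-pos =
      settled p<q q<ℓ eq (shrinks (ℕ.<-trans p<q q<ℓ) p-pos) (shrinks q<ℓ q-pos)

    weigh-move : ∀ F {j} → j ≤ ℓ → weigh F w′ j ≡ weigh F w j +ℚ η *ℚ weigh F sg j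
    weigh-move F {j} j≤ℓ = ∑-linear η j λ {p} p<j →
      trans (cong (F (cls p) *ℚ_) (moved (ℕ.<-≤-trans p<j j≤ℓ)))
        (solve 4 (λ f a b s → f :* (a :+ b :* s) := f :* a :+ b :* (f :* s)) refl
          (F (cls p)) (w p) η (sg p))

    weigh-fixed : ∀ F {j} → j ≤ ℓ → weigh F sg j ≡ 0ℚ → weigh F w′ j ≡ weigh F w j
    weigh-fixed F {j} j≤ℓ eq = trans (weigh-move F j≤ℓ)
      (trans (cong (λ x → weigh F w j +ℚ η *ℚ x) eq)
        (solve 2 (λ a b → a :+ b :* con 0ℚ := a) refl (weigh F w j) η))

    only-move : ∀ {j k} → OnlySplit w j k → OnlySplit w′ j k
    only-move only a<j j≤b b<ℓ eq a-pos b-pos = only a<j j≤b b<ℓ eq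
      (shrinks (ℕ.<-trans (ℕ.<-≤-trans a<j j≤b) b<ℓ) a-pos) (shrinks b<ℓ b-pos)

    prefix-move : ∀ {j} → j < ℓ → Prefix w j → Cut w sg j → Prefix w′ j
    prefix-move j<ℓ (exact eq) (flat bal) =
      exact (trans (weigh-fixed R (ℕ.<⇒≤ j<ℓ) (bal R)) eq)
    prefix-move j<ℓ (exact eq) (two _ _ _ _ _ _ _ r r′ bal) =
      exact (trans (weigh-fixed R (ℕ.<⇒≤ j<ℓ) (trans (bal R) (cong₂ _-ℚ_ r r′))) eq)
    prefix-move j<ℓ (exact eq) (one _ _ _ bal (inj₁ r≡0)) =
      exact (trans (weigh-fixed R (ℕ.<⇒≤ j<ℓ) (trans (bal R) r≡0)) eq)
    -- The first possibly uncompensated shift across the cut: `u` records the part of the class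
    -- below it just before this move.
    prefix-move {j} j<ℓ (exact eq) (one {b = b} c _ _ bal (inj₂ only)) =
      split (Chord.b<ℓ c) (0≤part (cls b) j≤ℓ) (part≤ (Chord.b<ℓ c) j≤ℓ)
        (begin
          weigh R w′ j                                    ≡⟨ weigh-move R j≤ℓ ⟩
          weigh R w j +ℚ η *ℚ weigh R sg j                ≡⟨ cong₂ (λ x y → x +ℚ η *ℚ y) eq (bal R) ⟩
          weigh R w₀ j +ℚ η *ℚ R (cls b)                  ≡⟨ solve 4 (λ a e r u → a :+ e :* r := a :+ r :* ((u :+ e :* con 1ℚ) :- u))
                                                               refl (weigh R w₀ j) η (R (cls b)) u ⟩
          weigh R w₀ j +ℚ R (cls b) *ℚ ((u +ℚ η *ℚ 1ℚ) -ℚ u) ≡⟨ cong (λ x → weigh R w₀ j +ℚ R (cls b) *ℚ ((u +ℚ η *ℚ x) -ℚ u))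
                                                               (trans (bal (indicator (cls b))) (indicator-yes {cls b} refl)) ⟨
          weigh R w₀ j +ℚ R (cls b) *ℚ ((u +ℚ η *ℚ weigh (indicator (cls b)) sg j) -ℚ u)
                                                          ≡⟨ cong (λ x → weigh R w₀ j +ℚ R (cls b) *ℚ (x -ℚ u)) (weigh-move (indicator (cls b)) j≤ℓ) ⟨
          weigh R w₀ j +ℚ R (cls b) *ℚ (weigh (indicator (cls b)) w′ j -ℚ u) ∎)
        (only-move only)
      where
      open ≡-Reasoning
      j≤ℓ = ℕ.<⇒≤ j<ℓ
      u = weigh (indicator (cls b)) w j
    prefix-move {j} j<ℓ (split {q} {u} q<ℓ 0≤u u≤G eq only) cut =
      split q<ℓ 0≤u u≤G
        (begin
          weigh R w′ j                                    ≡⟨ weigh-move R j≤ℓ ⟩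
          weigh R w j +ℚ η *ℚ weigh R sg j                ≡⟨ cong₂ (λ x y → x +ℚ η *ℚ y) eq (only-cut cut only) ⟩
          (weigh R w₀ j +ℚ R k *ℚ (P w -ℚ u)) +ℚ η *ℚ (R k *ℚ P sg)
                                                          ≡⟨ solve 6 (λ a r p u e s → (a :+ r :* (p :- u)) :+ e :* (r :* s) := a :+ r :* ((p :+ e :* s) :- u))
                                                               refl (weigh R w₀ j) (R k) (P w) u η (P sg) ⟩
          weigh R w₀ j +ℚ R k *ℚ ((P w +ℚ η *ℚ P sg) -ℚ u) ≡⟨ cong (λ x → weigh R w₀ j +ℚ R k *ℚ (x -ℚ u)) (weigh-move (indicator k) j≤ℓ) ⟨
          weigh R w₀ j +ℚ R k *ℚ (P w′ -ℚ u)               ∎)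
        (only-move only)
      where
      open ≡-Reasoning
      j≤ℓ = ℕ.<⇒≤ j<ℓ
      k = cls q
      P = λ f → weigh (indicator k) f j

    invariant-move : Invariant w′
    invariant-move = record
      { nonneg = stays
      ; sums   = λ {p} p<ℓ → trans (weigh-fixed (indicator (cls p)) ℕ.≤-refl (closed (indicator (cls p)))) (sums p<ℓ)
      ; total  = trans (weigh-fixed R ℕ.≤-refl (closed R)) total
      ; prefix = λ j<ℓ → prefix-move j<ℓ (prefix j<ℓ) (cuts j<ℓ)
      ; costs  = ℚ.≤-trans (ℚ.≤-reflexive cost-move)
          (ℚ.≤-trans (ℚ.+-monoʳ-≤ (∑ (λ p → κ p *ℚ w p) ℓ) cheaper)
            (ℚ.≤-trans (ℚ.≤-reflexive (ℚ.+-identityʳ (∑ (λ p → κ p *ℚ w p) ℓ))) costs))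
      }
      where
      cost-move : ∑ (λ p → κ p *ℚ w′ p) ℓ ≡ ∑ (λ p → κ p *ℚ w p) ℓ +ℚ η *ℚ ∑ (λ p → κ p *ℚ sg p) ℓ
      cost-move = ∑-linear η ℓ λ {p} p<ℓ → trans (cong (κ p *ℚ_) (moved p<ℓ))
        (solve 4 (λ f a b s → f :* (a :+ b :* s) := f :* a :+ b :* (f :* s)) refl
          (κ p) (w p) η (sg p))

  Progress : (ℕ → ℚ) → ℕ → Set
  Progress w n = Settled w ⊎ n + support w ℓ ≤ ℓ

  -- After `ℓ` productive moves the count would leave no positive entry at all, so the second
  -- alternative satisfies `Settled` vacuously.
  progress⇒settled : ∀ {w} → Progress w ℓ → Settled w
  progress⇒settled (inj₁ settled) = settled
  progress⇒settled {w} (inj₂ le) {p} {q} p<q q<ℓ _ _ q-pos = contradiction le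
    (ℕ.<⇒≱ (ℕ.m<m+n ℓ (support-pos ℓ q<ℓ q-pos)))

  -- A running minimum in which `δ = 0` stands for no candidate so far. This is unambiguous once
  -- nonzero signs sit at positive entries, as then every candidate is positive.
  data Bottleneck (w sg : ℕ → ℚ) (dir δ : ℚ) (i : ℕ) : Set where
    none : δ ≡ 0ℚ → (∀ {p} → p < i → ¬ dir *ℚ sg p <ℚ 0ℚ) → Bottleneck w sg dir δ i
    some : ∀ {r} → r < i → dir *ℚ sg r <ℚ 0ℚ → δ ≡ w r →
           (∀ {p} → p < i → dir *ℚ sg p <ℚ 0ℚ → δ ≤ℚ w p) → Bottleneck w sg dir δ i

  module Moving {w sg : ℕ → ℚ} {dir δ : ℚ} (I : Invariant w) (S : Swept w sg) (dir± : dir ≡ 1ℚ ⊎ dir ≡ -1ℚ)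
                (cheap : dir *ℚ ∑ (λ p → κ p *ℚ sg p) ℓ ≤ℚ 0ℚ) (B : Bottleneck w sg dir δ ℓ) where
    open Invariant I
    open Swept S

    0≤δ : 0ℚ ≤ℚ δ
    0≤δ = from B
      where
      from : Bottleneck w sg dir δ ℓ → 0ℚ ≤ℚ δ
      from (none eq _)       = subst (0ℚ ≤ℚ_) (sym eq) ℚ.≤-refl
      from (some r<ℓ _ eq _) = subst (0ℚ ≤ℚ_) (sym eq) (nonneg r<ℓ)

    δ≤w : ∀ {p} → p < ℓ → dir *ℚ sg p <ℚ 0ℚ → δ ≤ℚ w p
    δ≤w {p} p<ℓ neg = from B
      where
      from : Bottleneck w sg dir δ ℓ → δ ≤ℚ w p
      from (none _ ¬neg)      = contradiction neg (¬neg p<ℓ)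
      from (some _ _ _ min) = min p<ℓ neg

    directed : ∀ {p} → p < ℓ → dir *ℚ sg p ≡ 0ℚ ⊎ (0ℚ <ℚ w p × (dir *ℚ sg p ≡ 1ℚ ⊎ dir *ℚ sg p ≡ -1ℚ))
    directed {p} p<ℓ = from (signs p<ℓ) dir±
      where
      from : Sign w sg p → dir ≡ 1ℚ ⊎ dir ≡ -1ℚ →
             dir *ℚ sg p ≡ 0ℚ ⊎ (0ℚ <ℚ w p × (dir *ℚ sg p ≡ 1ℚ ⊎ dir *ℚ sg p ≡ -1ℚ))
      from (inj₁ eq)              _          = inj₁ (trans (cong (dir *ℚ_) eq) (ℚ.*-zeroʳ dir))
      from (inj₂ (pos , inj₁ eq)) (inj₁ eq′) = inj₂ (pos , inj₁ (cong₂ _*ℚ_ eq′ eq))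
      from (inj₂ (pos , inj₁ eq)) (inj₂ eq′) = inj₂ (pos , inj₂ (cong₂ _*ℚ_ eq′ eq))
      from (inj₂ (pos , inj₂ eq)) (inj₁ eq′) = inj₂ (pos , inj₂ (cong₂ _*ℚ_ eq′ eq))
      from (inj₂ (pos , inj₂ eq)) (inj₂ eq′) = inj₂ (pos , inj₁ (cong₂ _*ℚ_ eq′ eq))

    -1<0 : -1ℚ <ℚ 0ℚ
    -1<0 = ℚ.negative⁻¹ -1ℚ

    module _ {w′ : ℕ → ℚ} (moved : ∀ {p} → p < ℓ → w′ p ≡ w p +ℚ (dir *ℚ δ) *ℚ sg p) where

      moved-by : ∀ {p x} → p < ℓ → dir *ℚ sg p ≡ x → w′ p ≡ w p +ℚ δ *ℚ x
      moved-by {p} p<ℓ refl = trans (moved p<ℓ)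
        (solve 4 (λ w d e s → w :+ (d :* e) :* s := w :+ e :* (d :* s)) refl (w p) dir δ (sg p))

      stays : ∀ {p} → p < ℓ → 0ℚ ≤ℚ w′ p
      stays {p} p<ℓ with directed p<ℓ
      ... | inj₁ eq = subst (0ℚ ≤ℚ_)
              (sym (trans (moved-by p<ℓ eq) (solve 2 (λ w e → w :+ e :* con 0ℚ := w) refl (w p) δ))) (nonneg p<ℓ)
      ... | inj₂ (_ , inj₁ eq) = subst (0ℚ ≤ℚ_)
              (sym (trans (moved-by p<ℓ eq) (cong (w p +ℚ_) (ℚ.*-identityʳ δ))))
              (ℚ.+-mono-≤ (nonneg p<ℓ) 0≤δ)
      ... | inj₂ (_ , inj₂ eq) = subst₂ _≤ℚ_ (ℚ.+-inverseʳ δ)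
              (sym (trans (moved-by p<ℓ eq) (solve 2 (λ w e → w :+ e :* con -1ℚ := w :- e) refl (w p) δ)))
              (ℚ.+-monoˡ-≤ (-ℚ δ) (δ≤w p<ℓ (subst (_<ℚ 0ℚ) (sym eq) -1<0)))

      move : Move w sg (dir *ℚ δ) w′
      move = record
        { swept   = S
        ; moved   = moved
        ; stays   = stays
        ; cheaper = ℚ.≤-trans
            (ℚ.≤-reflexive (solve 3 (λ d e g → (d :* e) :* g := e :* (d :* g)) refl
              dir δ (∑ (λ p → κ p *ℚ sg p) ℓ)))
            (ℚ.≤-trans (*-monoˡ-≤ 0≤δ cheap) (ℚ.≤-reflexive (ℚ.*-zeroʳ δ)))
        }

      empties : ∀ {r} → r < ℓ → dir *ℚ sg r <ℚ 0ℚ → δ ≡ w r → 0ℚ <ℚ w r × ¬ 0ℚ <ℚ w′ r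
      empties {r} r<ℓ neg eq with directed r<ℓ
      ... | inj₁ z = contradiction (subst (_<ℚ 0ℚ) z neg) (ℚ.<-irrefl refl)
      ... | inj₂ (_ , inj₁ z) = contradiction (subst (_<ℚ 0ℚ) z neg) (ℚ.<-asym (ℚ.positive⁻¹ 1ℚ))
      ... | inj₂ (pos , inj₂ z) = pos , λ pos′ → ℚ.<-irrefl (sym (trans (moved-by r<ℓ z)
              (trans (cong (λ x → w r +ℚ x *ℚ -1ℚ) eq)
                (solve 1 (λ w → w :+ w :* con -1ℚ := con 0ℚ) refl (w r))))) pos′

      -- If both signs occur, one of them is negative along `dir`, so the bottleneck cannot be
      -- `none`; the entry attaining it becomes 0 and the support loses an element.
      progress : ∀ {n} → Progress w n → Progress w′ (suc n)
      progress (inj₁ settled) = inj₁ (settled-move I move settled)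
      progress {n} (inj₂ le) = from exit B dir±
        where
        from : Settled w ⊎ (∃[ s ] ∃[ r ] s < ℓ × sg s ≡ 1ℚ × r < ℓ × sg r ≡ -1ℚ) →
               Bottleneck w sg dir δ ℓ → dir ≡ 1ℚ ⊎ dir ≡ -1ℚ → Progress w′ (suc n)
        from (inj₁ settled) _ _ = inj₁ (settled-move I move settled)
        from (inj₂ _) (some r<ℓ neg eq _) _ with empties r<ℓ neg eq
        ... | pos , ¬pos = inj₂ (ℕ.≤-trans
                (ℕ.+-monoʳ-< n (support-strict ℓ (shrinks I move) r<ℓ pos ¬pos)) le)
        from (inj₂ (s , r , s<ℓ , s+ , r<ℓ , r-)) (none _ ¬neg) (inj₁ eq) =
          contradiction (subst (_<ℚ 0ℚ) (sym (cong₂ _*ℚ_ eq r-)) -1<0) (¬neg r<ℓ)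
        from (inj₂ (s , r , s<ℓ , s+ , r<ℓ , r-)) (none _ ¬neg) (inj₂ eq) =
          contradiction (subst (_<ℚ 0ℚ) (sym (cong₂ _*ℚ_ eq s+)) -1<0) (¬neg s<ℓ)

-- Encoding lengths

fromℕ : ℕ → ℚ
fromℕ n = fromℤ (+ n)

fromℤ-+ : ∀ a b → fromℤ a +ℚ fromℤ b ≡ fromℤ (a ℤ.+ b)
fromℤ-+ a b = ℚ.toℚᵘ-injective (ℚᵘ.≃-trans (ℚ.toℚᵘ-homo-+ (fromℤ a) (fromℤ b))
  (ℚᵘ.*≡* (cong (ℤ._* + 1) (cong₂ ℤ._+_ (ℤ.*-identityʳ a) (ℤ.*-identityʳ b)))))

fromℤ-* : ∀ a b → fromℤ a *ℚ fromℤ b ≡ fromℤ (a ℤ.* b)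
fromℤ-* a b = ℚ.toℚᵘ-injective (ℚᵘ.≃-trans (ℚ.toℚᵘ-homo-* (fromℤ a) (fromℤ b)) (ℚᵘ.*≡* refl))

fromℕ-* : ∀ a b → fromℕ (a * b) ≡ fromℕ a *ℚ fromℕ b
fromℕ-* a b = trans (cong fromℤ (ℤ.pos-* a b)) (sym (fromℤ-* (+ a) (+ b)))

fromℕ-mono : ∀ {a b} → a ≤ b → fromℕ a ≤ℚ fromℕ b
fromℕ-mono a≤b = *≤* (ℤ.*-monoʳ-≤-nonNeg (+ 1) (ℤ.+≤+ a≤b))

-- Membership in (1/`M`)ℤ, phrased by multiplication to avoid a division by `M`.
record Lattice (M : ℕ) (q : ℚ) : Set where
  constructor multiple
  field
    factor  : ℤ
    scaled  : q *ℚ fromℕ M ≡ fromℤ factor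

lattice-+ : ∀ {M p q} → Lattice M p → Lattice M q → Lattice M (p +ℚ q)
lattice-+ {M} {p} {q} (multiple a pa) (multiple b qb) = multiple (a ℤ.+ b)
  (trans (ℚ.*-distribʳ-+ (fromℕ M) p q) (trans (cong₂ _+ℚ_ pa qb) (fromℤ-+ a b)))

lattice-* : ∀ {M N p q} → Lattice M p → Lattice N q → Lattice (M * N) (p *ℚ q)
lattice-* {M} {N} {p} {q} (multiple a pa) (multiple b qb) = multiple (a ℤ.* b)
  (begin
    (p *ℚ q) *ℚ fromℕ (M * N)             ≡⟨ cong ((p *ℚ q) *ℚ_) (fromℕ-* M N) ⟩
    (p *ℚ q) *ℚ (fromℕ M *ℚ fromℕ N)      ≡⟨ solve 4 (λ p q m n → (p :* q) :* (m :* n) := (p :* m) :* (q :* n))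
                                               refl p q (fromℕ M) (fromℕ N) ⟩
    (p *ℚ fromℕ M) *ℚ (q *ℚ fromℕ N)      ≡⟨ cong₂ _*ℚ_ pa qb ⟩
    fromℤ a *ℚ fromℤ b                    ≡⟨ fromℤ-* a b ⟩
    fromℤ (a ℤ.* b)                       ∎)
  where open ≡-Reasoning

lattice-fromℤ : ∀ {M} a → Lattice M (fromℤ a)
lattice-fromℤ {M} a = multiple (a ℤ.* + M) (fromℤ-* a (+ M))

lattice-∣ : ∀ {M N q} → M ∣ N → Lattice M q → Lattice N q
lattice-∣ {M} {q = q} (divides k refl) (multiple a qa) = multiple (a ℤ.* + k)
  (begin
    q *ℚ fromℕ (k * M)             ≡⟨ cong (q *ℚ_) (fromℕ-* k M) ⟩
    q *ℚ (fromℕ k *ℚ fromℕ M)      ≡⟨ solve 3 (λ p m n → p :* (m :* n) := (p :* n) :* m) refl q (fromℕ k) (fromℕ M) ⟩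
    (q *ℚ fromℕ M) *ℚ fromℕ k      ≡⟨ cong (_*ℚ fromℕ k) qa ⟩
    fromℤ a *ℚ fromℤ (+ k)         ≡⟨ fromℤ-* a (+ k) ⟩
    fromℤ (a ℤ.* + k)              ∎)
  where open ≡-Reasoning

lattice-denominator : ∀ q → Lattice (↧ₙ q) q
lattice-denominator q@(mkℚ n d-1 _) = multiple n (ℚ.toℚᵘ-injective
  (ℚᵘ.≃-trans (ℚ.toℚᵘ-homo-* q (fromℕ (↧ₙ q))) (ℚᵘ.*≡* (begin
    n ℤ.* d ℤ.* + 1         ≡⟨ ℤ.*-identityʳ (n ℤ.* d) ⟩
    n ℤ.* d                 ≡⟨ cong (λ x → n ℤ.* + x) (ℕ.*-identityʳ (suc d-1)) ⟨
    n ℤ.* + (suc d-1 * 1)   ∎))))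
  where
  open ≡-Reasoning
  d = + suc d-1

-- With `q = n/d` in lowest terms, `n * M = a * d` shows that `d` divides `n * M`, and `d` is
-- coprime to `n`.
lattice⇒denominator∣ : ∀ {M} q → Lattice M q → ↧ₙ q ∣ M
lattice⇒denominator∣ {M} q@(mkℚ n d-1 coprime) (multiple a qa)
  with ℚᵘ.≃-trans (ℚᵘ.≃-sym (ℚ.toℚᵘ-homo-* q (fromℕ M))) (ℚᵘ.≃-reflexive (cong toℚᵘ qa))
... | ℚᵘ.*≡* eq = Coprime.coprime-divisor (Coprime.sym (Coprime.recompute coprime))
  (divides ℤ.∣ a ∣ (begin
    ℤ.∣ n ∣ * M                      ≡⟨ ℤ.∣i*j∣≡∣i∣*∣j∣ n (+ M) ⟨
    ℤ.∣ n ℤ.* + M ∣                  ≡⟨ cong ℤ.∣_∣ (ℤ.*-identityʳ (n ℤ.* + M)) ⟨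
    ℤ.∣ n ℤ.* + M ℤ.* + 1 ∣          ≡⟨ cong ℤ.∣_∣ eq ⟩
    ℤ.∣ a ℤ.* + (suc d-1 * 1) ∣      ≡⟨ ℤ.∣i*j∣≡∣i∣*∣j∣ a (+ (suc d-1 * 1)) ⟩
    ℤ.∣ a ∣ * (suc d-1 * 1)          ≡⟨ cong (ℤ.∣ a ∣ *_) (ℕ.*-identityʳ (suc d-1)) ⟩
    ℤ.∣ a ∣ * suc d-1                ∎))
  where open ≡-Reasoning

∣numerator∣≤ : ∀ {B} q → ℚ.∣ q ∣ ≤ℚ fromℕ B → ℤ.∣ ↥ q ∣ ≤ B * ↧ₙ q
∣numerator∣≤ {B} q@(mkℚ n d-1 _) (*≤* le) = ℤ.drop‿+≤+
  (subst₂ ℤ._≤_ (ℤ.*-identityʳ (+ ℤ.∣ n ∣)) (sym (ℤ.pos-* B (suc d-1))) le)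

∣∣≤numerator : ∀ q → ℚ.∣ q ∣ ≤ℚ fromℕ ℤ.∣ ↥ q ∣
∣∣≤numerator (mkℚ n d-1 _) = *≤* (ℤ.*-monoˡ-≤-nonNeg (+ ℤ.∣ n ∣) (ℤ.+≤+ (s≤s z≤n)))

-- Induction by halving, following the recurrence of the logarithm.
n≤2^⌈log₂n⌉ : ∀ n → n ≤ 2 ^ ⌈log₂ n ⌉
n≤2^⌈log₂n⌉ = <-rec (λ n → n ≤ 2 ^ ⌈log₂ n ⌉) go
  where
  open ℕ.≤-Reasoning
  go : ∀ n → (∀ {k} → k < n → k ≤ 2 ^ ⌈log₂ k ⌉) → n ≤ 2 ^ ⌈log₂ n ⌉
  go 0 rec = z≤n
  go 1 rec = s≤s z≤n
  go n@(suc (suc n-2)) rec = begin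
    n                                   ≡⟨ ℕ.⌊n/2⌋+⌈n/2⌉≡n n ⟨
    ⌊ n /2⌋ + ⌈ n /2⌉                   ≤⟨ ℕ.+-monoˡ-≤ ⌈ n /2⌉ (ℕ.⌊n/2⌋≤⌈n/2⌉ n) ⟩
    ⌈ n /2⌉ + ⌈ n /2⌉                   ≡⟨ cong (λ k → ⌈ n /2⌉ + k) (ℕ.+-identityʳ ⌈ n /2⌉) ⟨
    2 * ⌈ n /2⌉                         ≤⟨ ℕ.*-monoʳ-≤ 2 (rec (ℕ.⌈n/2⌉<n n-2)) ⟩
    2 * 2 ^ ⌈log₂ ⌈ n /2⌉ ⌉             ≡⟨ cong (λ k → 2 * 2 ^ k) (⌈log₂⌈n/2⌉⌉≡⌈log₂n⌉∸1 n) ⟩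
    2 ^ suc (⌈log₂ n ⌉ ∸ 1)             ≡⟨ cong (2 ^_) (ℕ.m+[n∸m]≡n (⌈log₂⌉-mono-≤ {2} {n} (s≤s (s≤s z≤n)))) ⟩
    2 ^ ⌈log₂ n ⌉                       ∎

⌈log₂suc⌉≤ : ∀ {n} k → n ≤ 2 ^ k → ⌈log₂ suc n ⌉ ≤ suc k
⌈log₂suc⌉≤ {n} k n≤ = subst (⌈log₂ suc n ⌉ ≤_) (⌈log₂2^n⌉≡n (suc k)) (⌈log₂⌉-mono-≤ (begin
  suc n               ≤⟨ s≤s n≤ ⟩
  1 + 2 ^ k           ≤⟨ ℕ.+-monoˡ-≤ (2 ^ k) (ℕ.m^n>0 2 k) ⟩
  2 ^ k + 2 ^ k       ≡⟨ cong (λ x → 2 ^ k + x) (ℕ.+-identityʳ (2 ^ k)) ⟨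
  2 ^ suc k           ∎))
  where open ℕ.≤-Reasoning

n≤2^n : ∀ n → n ≤ 2 ^ n
n≤2^n zero    = z≤n
n≤2^n (suc n) = begin
  1 + n               ≤⟨ ℕ.+-mono-≤ (ℕ.m^n>0 2 n) (n≤2^n n) ⟩
  2 ^ n + 2 ^ n       ≡⟨ cong (λ x → 2 ^ n + x) (ℕ.+-identityʳ (2 ^ n)) ⟨
  2 ^ suc n           ∎
  where open ℕ.≤-Reasoning

-- A linear bound is enough for indices, since the input length is itself at least `ℓ`.
bitsℕ≤ : ∀ n → bitsℕ n ≤ 2 + n
bitsℕ≤ n = s≤s (⌈log₂suc⌉≤ n (n≤2^n n))

-- A common multiple of denominator and (nonzero) numerator.
height : ℚ → ℕ
height q = (ℤ.∣ ↥ q ∣ ⊔ 1) * ↧ₙ q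

height≤ : ∀ q → height q ≤ 2 ^ bitsℚ q
height≤ q = begin
  (n ⊔ 1) * d                     ≤⟨ ℕ.*-mono-≤ (ℕ.⊔-lub (ℕ.n≤1+n n) (s≤s z≤n)) (ℕ.n≤1+n d) ⟩
  suc n * suc d                   ≤⟨ ℕ.*-mono-≤ (n≤2^⌈log₂n⌉ (suc n)) (n≤2^⌈log₂n⌉ (suc d)) ⟩
  2 ^ a * 2 ^ b                   ≡⟨ ℕ.^-distribˡ-+-* 2 a b ⟨
  2 ^ (a + b)                     ≤⟨ ℕ.^-monoʳ-≤ 2 (ℕ.n≤1+n (a + b)) ⟩
  2 ^ bitsℚ q                     ∎
  where
  open ℕ.≤-Reasoning
  n = ℤ.∣ ↥ q ∣
  d = ↧ₙ q
  a = ⌈log₂ suc n ⌉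
  b = ⌈log₂ suc d ⌉

∏ : ∀ {n} → (Fin n → ℕ) → ℕ
∏ {zero}  f = 1
∏ {suc n} f = f Fin.zero * ∏ (f ∘ Fin.suc)

∏-∣ : ∀ {n} (f : Fin n → ℕ) i → f i ∣ ∏ f
∏-∣ f Fin.zero    = m∣m*n _
∏-∣ f (Fin.suc i) = ∣-trans (∏-∣ (f ∘ Fin.suc) i) (n∣m*n (f Fin.zero))

∏≤2^ : ∀ {n} (f g : Fin n → ℕ) → (∀ i → f i ≤ 2 ^ g i) → ∏ f ≤ 2 ^ sumℕ g
∏≤2^ {zero}  f g f≤ = ℕ.≤-refl
∏≤2^ {suc n} f g f≤ = ℕ.≤-trans
  (ℕ.*-mono-≤ (f≤ _) (∏≤2^ (f ∘ Fin.suc) (g ∘ Fin.suc) (f≤ ∘ Fin.suc)))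
  (ℕ.≤-reflexive (sym (ℕ.^-distribˡ-+-* 2 (g Fin.zero) _)))

-- The denominator divides `M`, and the numerator is at most `B` times the denominator; the two
-- logarithms add up.
small⇒bits : ∀ {M B m b} q → 0 < M → M ≤ 2 ^ m → B ≤ 2 ^ b →
             Lattice M q → ℚ.∣ q ∣ ≤ℚ fromℕ B → bitsℚ q ≤ 3 + (b + m) + m
small⇒bits {M} {B} {m} {b} q 0<M M≤ B≤ lat bound = begin
  1 + ⌈log₂ suc ℤ.∣ ↥ q ∣ ⌉ + ⌈log₂ suc (↧ₙ q) ⌉ ≤⟨ ℕ.+-mono-≤ (s≤s (⌈log₂suc⌉≤ (b + m) num≤)) (⌈log₂suc⌉≤ m den≤) ⟩
  1 + suc (b + m) + suc m                       ≡⟨ ℕ.+-suc (2 + (b + m)) m ⟩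
  3 + (b + m) + m                               ∎
  where
  open ℕ.≤-Reasoning
  den≤ : ↧ₙ q ≤ 2 ^ m
  den≤ = ℕ.≤-trans (∣⇒≤ {{>-nonZero 0<M}} (lattice⇒denominator∣ q lat)) M≤
  num≤ : ℤ.∣ ↥ q ∣ ≤ 2 ^ (b + m)
  num≤ = begin
    ℤ.∣ ↥ q ∣     ≤⟨ ∣numerator∣≤ q bound ⟩
    B * ↧ₙ q      ≤⟨ ℕ.*-mono-≤ B≤ den≤ ⟩
    2 ^ b * 2 ^ m ≡⟨ ℕ.^-distribˡ-+-* 2 b m ⟨
    2 ^ (b + m)   ∎

denominator∣height : ∀ q → ↧ₙ q ∣ height q
denominator∣height q = n∣m*n (ℤ.∣ ↥ q ∣ ⊔ 1)

height-pos : ∀ q → 0 < height q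
height-pos q = ℕ.*-mono-≤ {1} {_} {1} (ℕ.m≤n⊔m ℤ.∣ ↥ q ∣ 1) (s≤s z≤n)

∏-pos : ∀ {n} (f : Fin n → ℕ) → (∀ i → 0 < f i) → 0 < ∏ f
∏-pos {zero}  f pos = s≤s z≤n
∏-pos {suc n} f pos = ℕ.*-mono-≤ {1} {_} {1} (pos _) (∏-pos (f ∘ Fin.suc) (pos ∘ Fin.suc))

lattice-height : ∀ {M} q → height q ∣ M → Lattice M q
lattice-height q h∣ = lattice-∣ (∣-trans (denominator∣height q) h∣) (lattice-denominator q)

∣∣≤height : ∀ q → ℚ.∣ q ∣ ≤ℚ fromℕ (height q)
∣∣≤height q = ℚ.≤-trans (∣∣≤numerator q) (fromℕ-mono (ℕ.≤-trans (ℕ.m≤m⊔n ℤ.∣ ↥ q ∣ 1)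
  (ℕ.m≤m*n (ℤ.∣ ↥ q ∣ ⊔ 1) (↧ₙ q))))

divide-* : ∀ p {q} → 0ℚ <ℚ q → divide p q *ℚ q ≡ p
divide-* p {q} 0<q with q ℚ.≟ 0ℚ
... | yes q≡0 = contradiction (sym q≡0) (ℚ.<⇒≢ 0<q)
... | no  q≢0 = trans (ℚ.*-assoc p _ q)
  (trans (cong (p *ℚ_) (ℚ.*-inverseˡ q {{ℚ.≢-nonZero q≢0}})) (ℚ.*-identityʳ p))

-- The denominator of the reciprocal is the numerator of `q`, and its size is at most the
-- denominator of `q`. Both divide `height q`, which is why the height contains the numerator.
height-divide : ∀ p {q} → 0ℚ <ℚ q →
  Lattice (height p * height q) (divide p q) × ℚ.∣ divide p q ∣ ≤ℚ fromℕ (height p * height q)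
height-divide p {q} 0<q with q ℚ.≟ 0ℚ
... | yes q≡0 = contradiction (sym q≡0) (ℚ.<⇒≢ 0<q)
height-divide p {mkℚ (+ zero) d _} 0<q | no q≢0 =
  contradiction (ℚ.↥p≡0⇒p≡0 (mkℚ (+ zero) d _) refl) q≢0
height-divide p {q@(mkℚ ℤ.-[1+ n ] d _)} 0<q | no q≢0 =
  contradiction 0<q (ℚ.<-asym (ℚ.negative⁻¹ q))
height-divide p {q@(mkℚ ℤ.+[1+ n ] d _)} 0<q | no q≢0 =
  lattice-* (lattice-height p ∣-refl)
    (lattice-∣ num∣ (lattice-denominator r)) ,
  (begin
    ℚ.∣ p *ℚ r ∣                          ≡⟨ ℚ.∣p*q∣≡∣p∣*∣q∣ p r ⟩
    ℚ.∣ p ∣ *ℚ ℚ.∣ r ∣                    ≤⟨ *-monoˡ-≤ (ℚ.0≤∣p∣ p) (ℚ.≤-trans (∣∣≤numerator r) (fromℕ-mono (∣⇒≤ {{>-nonZero (height-pos q)}} (denominator∣height q)))) ⟩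
    ℚ.∣ p ∣ *ℚ fromℕ (height q)           ≤⟨ ℚ.*-monoʳ-≤-nonNeg (fromℕ (height q)) (∣∣≤height p) ⟩
    fromℕ (height p) *ℚ fromℕ (height q)  ≡⟨ fromℕ-* (height p) (height q) ⟨
    fromℕ (height p * height q)           ∎)
  where
  open ℚ.≤-Reasoning
  r = (ℚ.1/ q) {{ℚ.≢-nonZero q≢0}}
  num∣ : suc n ∣ height q
  num∣ = subst (λ k → suc n ∣ suc k * suc d) (sym (ℕ.⊔-identityʳ n)) (m∣m*n (suc d))

-- The program

-- Memory layout.  Index arrays: 2 last support element of each class,
-- 3 position counter, 4 iteration counter, 5 phase of the scan, 6 and 7 right
-- ends of the two hulls the scan is in.  Rational arrays: 4 scaled demand of
-- the class of each position, 5 loads, 6 signs, 7 cost of the move,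
-- 8 direction, 9 step length.
cellᴺ : ℕ → NatExpr
cellᴺ a = a [ con 0 ]

cellᴿ : ℕ → RatExpr
cellᴿ a = a [ con 0 ]

pos classᴺ lastᴺ : NatExpr
pos    = cellᴺ 3
classᴺ = 1 [ pos ]
lastᴺ  = 2 [ classᴺ ]

advance : Program
advance = setᴺ 3 (con 0) (pos +ᴺ con 1)

forEach : Program → Program
forEach body = setᴺ 3 (con 0) (con 0) ⨾ while (pos +ᴺ con 1 ≤ᴺ cellᴺ 0) (body ⨾ advance)

scaleBody lastBody scanBody weighBody limitBody moveBody roundBody : Program

scaleBody =
  ifᵀ (0 [ classᴺ ] ≤ᴿ con 0ℚ) (setᴿ 4 pos (con 1ℚ)) (setᴿ 4 pos (0 [ classᴺ ]))
  ⨾ setᴿ 5 pos (4 [ pos ] *ᴿ 1 [ pos ])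

lastBody = ifᵀ (5 [ pos ] ≤ᴿ con 0ℚ) skip (setᴺ 2 classᴺ pos)

isOpen : Test
isOpen = andᵀ (notᵀ (5 [ pos ] ≤ᴿ con 0ℚ)) (pos +ᴺ con 1 ≤ᴺ lastᴺ)

-- Cell 6 holds the right end of the outer hull, so `1 [ cellᴺ 6 ]` is its class; the two
-- comparisons test equality of classes. Both demands have to be positive for opposite shifts of
-- load to cancel.
isChild : Test
isChild = andᵀ isOpen
  (andᵀ (notᵀ (andᵀ (classᴺ ≤ᴺ 1 [ cellᴺ 6 ]) (1 [ cellᴺ 6 ] ≤ᴺ classᴺ)))
  (andᵀ (notᵀ (0 [ 1 [ cellᴺ 6 ] ] ≤ᴿ con 0ℚ)) (notᵀ (0 [ classᴺ ] ≤ᴿ con 0ℚ))))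

scanBody =
  ifᵀ (cellᴺ 5 ≤ᴺ con 0)
    (ifᵀ isOpen
      (setᴿ 6 pos (con 1ℚ) ⨾ setᴺ 5 (con 0) (con 1) ⨾ setᴺ 6 (con 0) lastᴺ)
      (setᴿ 6 pos (con 0ℚ)))
  (ifᵀ (cellᴺ 5 ≤ᴺ con 1)
    (ifᵀ (cellᴺ 6 ≤ᴺ pos)
      (setᴿ 6 pos (con -1ℚ) ⨾ setᴺ 5 (con 0) (con 3))
    (ifᵀ isChild
      (setᴿ 6 pos (con -1ℚ) ⨾ setᴺ 5 (con 0) (con 2) ⨾ setᴺ 7 (con 0) lastᴺ)
      (setᴿ 6 pos (con 0ℚ))))
  (ifᵀ (cellᴺ 5 ≤ᴺ con 2)
    (ifᵀ (cellᴺ 7 ≤ᴺ pos)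
      (setᴿ 6 pos (con 1ℚ) ⨾ setᴺ 5 (con 0) (con 1))
      (setᴿ 6 pos (con 0ℚ)))
    (setᴿ 6 pos (con 0ℚ))))

-- The quotient is the cost per unit of load; array 4 holds scaled demands, which are positive.
weighBody = setᴿ 7 (con 0) (cellᴿ 7 +ᴿ (2 [ pos ] ÷ᴿ 4 [ pos ]) *ᴿ 6 [ pos ])

chooseDirection : Program
chooseDirection = ifᵀ (cellᴿ 7 ≤ᴿ con 0ℚ) (setᴿ 8 (con 0) (con 1ℚ)) (setᴿ 8 (con 0) (con -1ℚ))

limitBody =
  ifᵀ (andᵀ (notᵀ (con 0ℚ ≤ᴿ cellᴿ 8 *ᴿ 6 [ pos ]))
            (notᵀ (andᵀ (notᵀ (cellᴿ 9 ≤ᴿ con 0ℚ)) (cellᴿ 9 ≤ᴿ 5 [ pos ]))))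
    (setᴿ 9 (con 0) (5 [ pos ]))
    skip

moveBody = setᴿ 5 pos (5 [ pos ] +ᴿ (cellᴿ 8 *ᴿ cellᴿ 9) *ᴿ 6 [ pos ])

roundBody = ifᵀ (5 [ pos ] ≤ᴿ con 0ℚ) (setᴿ 3 pos (con 0ℚ)) (setᴿ 3 pos (con 1ℚ))

iteration : Program
iteration =
  forEach lastBody ⨾
  setᴺ 5 (con 0) (con 0) ⨾ forEach scanBody ⨾
  setᴿ 7 (con 0) (con 0ℚ) ⨾ forEach weighBody ⨾
  chooseDirection ⨾
  setᴿ 9 (con 0) (con 0ℚ) ⨾ forEach limitBody ⨾
  forEach moveBody

-- There is no test for being finished: on settled loads no position is open, all signs become 0,
-- and the iteration leaves the loads as they are.
program : Program
program =
  forEach scaleBody ⨾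
  (setᴺ 4 (con 0) (con 0) ⨾
   while (cellᴺ 4 +ᴺ con 1 ≤ᴺ cellᴺ 0) (iteration ⨾ setᴺ 4 (con 0) (cellᴺ 4 +ᴺ con 1))) ⨾
  forEach roundBody

-- scale replaces demand 0 by 1, so that it can be divided by; unit is the
-- factor that undoes this.  The scan moves classes of demand 0 on their own.
scale unit : ℚ → ℚ
scale q = if does (q ℚ.≤? 0ℚ) then 1ℚ else q
unit  q = if does (q ℚ.≤? 0ℚ) then 0ℚ else 1ℚ

scale-≤ : ∀ {q} → q ≤ℚ 0ℚ → scale q ≡ 1ℚ
scale-≤ {q} le = cong (if_then 1ℚ else q) (dec-true (q ℚ.≤? 0ℚ) le)

scale-≰ : ∀ {q} → ¬ q ≤ℚ 0ℚ → scale q ≡ q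
scale-≰ {q} nle = cong (if_then 1ℚ else q) (dec-false (q ℚ.≤? 0ℚ) nle)

unit-≤ : ∀ {q} → q ≤ℚ 0ℚ → unit q ≡ 0ℚ
unit-≤ {q} le = cong (if_then 0ℚ else 1ℚ) (dec-true (q ℚ.≤? 0ℚ) le)

unit-≰ : ∀ {q} → ¬ q ≤ℚ 0ℚ → unit q ≡ 1ℚ
unit-≰ {q} nle = cong (if_then 0ℚ else 1ℚ) (dec-false (q ℚ.≤? 0ℚ) nle)

scale-pos : ∀ q → 0ℚ <ℚ scale q
scale-pos q = case q ℚ.≤? 0ℚ of λ where
  (yes le) → subst (0ℚ <ℚ_) (sym (scale-≤ le)) (ℚ.positive⁻¹ 1ℚ)
  (no nle) → subst (0ℚ <ℚ_) (sym (scale-≰ nle)) (ℚ.≰⇒> nle)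

0≤unit : ∀ q → 0ℚ ≤ℚ unit q
0≤unit q = case q ℚ.≤? 0ℚ of λ where
  (yes le) → ℚ.≤-reflexive (sym (unit-≤ le))
  (no nle) → subst (0ℚ ≤ℚ_) (sym (unit-≰ nle)) (ℚ.nonNegative⁻¹ 1ℚ)

unit*scale : ∀ {q} → 0ℚ ≤ℚ q → unit q *ℚ scale q ≡ q
unit*scale {q} 0≤q = case q ℚ.≤? 0ℚ of λ where
  (yes le) → trans (cong (_*ℚ scale q) (unit-≤ le)) (trans (ℚ.*-zeroˡ (scale q)) (ℚ.≤-antisym 0≤q le))
  (no nle) → trans (cong₂ _*ℚ_ (unit-≰ nle) (scale-≰ nle)) (ℚ.*-identityˡ q)

height-scale : ∀ q → height (scale q) ∣ height q
height-scale q = case q ℚ.≤? 0ℚ of λ where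
  (yes le) → subst (λ x → height x ∣ height q) (sym (scale-≤ le)) (1∣ height q)
  (no nle) → subst (λ x → height x ∣ height q) (sym (scale-≰ nle)) ∣-refl

-- Correctness of the program

wp-mono : ∀ {w} p {Q Q′ : Memory → Set} {σ} → (∀ {σ′} → Q σ′ → Q′ σ′) → wp w p Q σ → wp w p Q′ σ
wp-mono skip         f q         = f q
wp-mono (setᴺ a i e) f (b , q)   = b , f q
wp-mono (setᴿ a i e) f (b , q)   = b , f q
wp-mono (p ⨾ q)      f h         = wp-mono p (wp-mono q f) h
wp-mono (ifᵀ b p q)  f (h₁ , h₂) = (λ h → wp-mono p f (h₁ h)) , (λ h → wp-mono q f (h₂ h))

-- A syntactic frame condition on index arrays. It lets the outer loop counter survive an iteration
-- without appearing in the invariants of the inner loops.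
avoids : ℕ → Program → Bool
avoids a skip         = true
avoids a (setᴺ b i e) = not (does (b ℕ.≟ a))
avoids a (setᴿ b i e) = true
avoids a (p ⨾ q)      = avoids a p ∧ avoids a q
avoids a (ifᵀ b p q)  = avoids a p ∧ avoids a q
avoids a (while b p)  = avoids a p

frame : ∀ {w p σ t σ′} a → T (avoids a p) → w ⊢ p , σ ⇓[ t ] σ′ → ∀ k → nat σ′ a k ≡ nat σ a k
frame a av skip k = refl
frame {σ = σ} a av (setᴺ {a = b} {i} {e} _) k with does (b ℕ.≟ a)
... | false = refl
frame a av (setᴿ _) k = refl
frame {p = p ⨾ q} a av (seq r r′) k with avoids a p in eq
... | true = trans (frame a av r′ k) (frame a (subst T (sym eq) _) r k)
frame {p = ifᵀ b p q} a av (if-true _ r) k with avoids a p in eq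
... | true = frame a (subst T (sym eq) _) r k
frame {p = ifᵀ b p q} a av (if-false _ r) k with avoids a p
... | true = frame a av r k
frame {p = while b p} a av (while-true _ r r′) k = trans (frame a av r′ k) (frame a av r k)
frame a av (while-false _) k = refl

preserving : ∀ {w t p σ Q} a {av : T (avoids a p)} → Reaches w t p σ Q →
             Reaches w t p σ (λ σ′ → nat σ′ a 0 ≡ nat σ a 0 × Q σ′)
preserving a {av} (reaches r t≤ q) = reaches r t≤ (frame a av r 0 , q)

-- The factor is constant on the class singled out by the indicator, and elsewhere the indicator
-- vanishes.
class-scaled : ∀ {w x : ℕ → ℚ} (cls : ℕ → ℕ) (G : ℕ → ℚ) q n → (∀ {p} → p < n → w p ≡ G (cls p) *ℚ x p) →
  ∑ (λ p → indicator (cls q) (cls p) *ℚ w p) n ≡ G (cls q) *ℚ ∑ (λ p → indicator (cls q) (cls p) *ℚ x p) n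
class-scaled {w} {x} cls G q n w≡ = trans (∑-cong n term) (∑-*-distribˡ (G (cls q)) _ n)
  where
  term : ∀ {p} → p < n →
         indicator (cls q) (cls p) *ℚ w p ≡ G (cls q) *ℚ (indicator (cls q) (cls p) *ℚ x p)
  term {p} p<n with cls q ℕ.≟ cls p
  ... | no neq = trans (cong (_*ℚ w p) (indicator-no neq)) (trans (ℚ.*-zeroˡ (w p))
          (sym (trans (cong (λ i → G (cls q) *ℚ (i *ℚ x p)) (indicator-no neq))
            (solve 2 (λ a b → a :* (con 0ℚ :* b) := con 0ℚ) refl (G (cls q)) (x p)))))
  ... | yes eq = trans (cong (indicator (cls q) (cls p) *ℚ_) (trans (w≡ p<n)
            (cong (λ k → G k *ℚ x p) (sym eq))))
          (solve 3 (λ i a b → i :* (a :* b) := a :* (i :* b)) refl (indicator (cls q) (cls p)) (G (cls q)) (x p))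

nextIteration : Program
nextIteration = setᴺ 4 (con 0) (cellᴺ 4 +ᴺ con 1)

guardTime : ℕ
guardTime = suc (costᵀ (pos +ᴺ con 1 ≤ᴺ cellᴺ 0))

module Times (ℓ : ℕ) where

  forEachTime : Program → ℕ
  -- The 3 is the cost of setting a cell to a constant; here it resets the position counter.
  forEachTime body = 3 + (guardTime + ℓ * (guardTime + cost (body ⨾ advance)))

  iterationTime : ℕ
  iterationTime = forEachTime lastBody + (3 + (forEachTime scanBody + (3 + (forEachTime weighBody +
    (cost chooseDirection + (3 + (forEachTime limitBody + forEachTime moveBody)))))))

  outerTime : ℕ
  outerTime = 3 + (guardTime + ℓ * (guardTime + (iterationTime + cost nextIteration)))

  programTime : ℕ
  programTime = forEachTime scaleBody + (outerTime + forEachTime roundBody)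

-- `dy∣M` puts the initial loads on the lattice, `cd∣M` the costs per unit of load. The bound
-- `suc ℓ * M` in `bits` accommodates the cost of a move, a sum of up to `ℓ` terms of size at most
-- `M`.
record Hypotheses (ℓ W M : ℕ) (cls : ℕ → ℕ) (d y c : ℕ → ℚ) : Set where
  field
    noncross : ∀ R → Supports.NonCrossing ℓ cls R
    0≤d      : ∀ k → 0ℚ ≤ℚ d k
    0≤y      : ∀ {p} → p < ℓ → 0ℚ ≤ℚ y p
    sums     : ∀ {q} → q < ℓ → ∑ (λ p → indicator (cls q) (cls p) *ℚ y p) ℓ ≡ 1ℚ
    dy∣M     : ∀ {p} → p < ℓ → height (d (cls p)) * height (y p) ∣ M
    cd∣M     : ∀ {p} → p < ℓ → height (c p) * height (d (cls p)) ∣ M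
    0<M      : 0 < M
    room     : 5 + ℓ ≤ W
    bits     : ∀ q → Lattice M q → ℚ.∣ q ∣ ≤ℚ fromℕ (suc ℓ * M) → bitsℚ q ≤ W

module Correct (ℓ W M : ℕ) (cls₀ : ℕ → ℕ) (d₀ y₀ c₀ : ℕ → ℚ)
               (hypotheses : Hypotheses ℓ W M cls₀ d₀ y₀ c₀) where

  open Hypotheses hypotheses
  open Times ℓ

  fits : ∀ {q} → Lattice M q → ℚ.∣ q ∣ ≤ℚ fromℕ M → bitsℚ q ≤ W
  fits {q} lat bound = bits q lat (ℚ.≤-trans bound (fromℕ-mono (ℕ.m≤m+n M (ℓ * M))))

  fits-0 : bitsℚ 0ℚ ≤ W
  fits-0 = fits (lattice-fromℤ (+ 0)) (fromℕ-mono z≤n)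

  fits-1 : bitsℚ 1ℚ ≤ W
  fits-1 = fits (lattice-fromℤ (+ 1)) (fromℕ-mono 0<M)

  fits-₋1 : bitsℚ -1ℚ ≤ W
  fits-₋1 = fits (lattice-fromℤ ℤ.-[1+ 0 ]) (fromℕ-mono 0<M)

  fitsᴺ : ∀ {n} → n ≤ 3 + ℓ → bitsℕ n ≤ W
  fitsᴺ {n} n≤ = ℕ.≤-trans (bitsℕ≤ n) (ℕ.≤-trans (s≤s (s≤s n≤)) room)

  fits-index : ∀ {n} → n ≤ ℓ → bitsℕ n ≤ W
  fits-index n≤ℓ = fitsᴺ (ℕ.m≤n⇒m≤o+n 3 n≤ℓ)

  -- These are the counter updates in exactly the form that `wp` produces; all arrays other than
  -- index array 3 are then unchanged by computation.
  reset tick : Memory → Memory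
  reset σ = mem (update (nat σ) 3 0 0) (rat σ)
  tick  σ = mem (update (nat σ) 3 0 (nat σ 3 0 + 1)) (rat σ)

  forEach-rule : ∀ body (Inv : ℕ → Memory → Set) →
    (∀ {i σ} → Inv i σ → nat σ 0 0 ≡ ℓ) →
    (∀ {σ} → nat σ 3 0 < ℓ → Inv (nat σ 3 0) σ →
      wp W body (λ σ′ → nat σ′ 3 0 ≡ nat σ 3 0 × Inv (suc (nat σ 3 0)) (tick σ′)) σ) →
    ∀ {σ} → Inv 0 (reset σ) → Reaches W (forEachTime body) (forEach body) σ (Inv ℓ)
  forEach-rule body Inv size step {σ} inv =
    wp-sound (setᴺ 3 (con 0) (con 0)) {Q = λ σ′ → nat σ′ 3 0 ≡ 0 × Inv 0 σ′}
      (fits-index z≤n , refl , inv)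
    thenʳ λ inv₀ → weaken ℕ.≤-refl proj₂
      (while-rule (λ i σ′ → nat σ′ 3 0 ≡ i × Inv i σ′) enter stay body-step ℓ refl inv₀)
    where
    enter : ∀ {i σ′} → nat σ′ 3 0 ≡ i × Inv i σ′ → i < ℓ → nat σ′ 3 0 + 1 ≤ nat σ′ 0 0
    enter (refl , inv) i<ℓ = subst₂ _≤_ (sym (ℕ.+-comm _ 1)) (sym (size inv)) i<ℓ
    stay : ∀ {i σ′} → nat σ′ 3 0 ≡ i × Inv i σ′ → nat σ′ 3 0 + 1 ≤ nat σ′ 0 0 → i < ℓ
    stay (refl , inv) le = subst₂ _≤_ (ℕ.+-comm _ 1) (size inv) le
    body-step : ∀ {i σ′} → i < ℓ → nat σ′ 3 0 ≡ i × Inv i σ′ →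
      Reaches W (cost (body ⨾ advance)) (body ⨾ advance) σ′ (λ σ″ → nat σ″ 3 0 ≡ suc i × Inv (suc i) σ″)
    body-step {σ′ = σ′} i<ℓ (refl , inv) = wp-sound (body ⨾ advance) (wp-mono body
      (λ {σ″} (eq , inv′) →
        let eq′ = trans (cong (_+ 1) eq) (ℕ.+-comm (nat σ′ 3 0) 1) in
        subst (λ n → bitsℕ n ≤ W) (sym eq′) (fits-index i<ℓ) , eq′ , inv′)
      (step i<ℓ inv))

  -- Ranges over array contents rather than memories: writes to other arrays leave these contents
  -- definitionally equal, so proofs carry over as they are, and equality of entire functions is
  -- available without extensionality.
  record Faithful (i n : ℕ) (cls : ℕ → ℕ) (d y c g : ℕ → ℚ) : Set where
    field
      n≡     : n ≡ ℓ
      cls≡   : cls ≡ cls₀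
      d≡     : d ≡ d₀
      y≡     : y ≡ y₀
      c≡     : c ≡ c₀
      scaled : ∀ {p} → p < i → g p ≡ scale (d (cls p))

  module _ {n : ℕ} {cls : ℕ → ℕ} {d y c g : ℕ → ℚ} (F : Faithful ℓ n cls d y c g) where
    open Faithful F

    noncrossing : Supports.NonCrossing ℓ cls (unit ∘ d)
    noncrossing = subst (λ k → Supports.NonCrossing ℓ k (unit ∘ d)) (sym cls≡) (noncross (unit ∘ d))

    demand-height : ∀ {p} → p < ℓ → d (cls p) ≡ d₀ (cls₀ p)
    demand-height {p} p<ℓ = trans (cong (λ f → f (cls p)) d≡) (cong (λ f → d₀ (f p)) cls≡)

    height-g∣ : ∀ {p} → p < ℓ → height (g p) ∣ height (d₀ (cls₀ p))
    height-g∣ {p} p<ℓ = subst₂ (λ a b → height a ∣ height b) (sym (scaled p<ℓ)) (demand-height p<ℓ)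
      (height-scale (d (cls p)))

    g-pos : ∀ {p} → p < ℓ → 0ℚ <ℚ g p
    g-pos {p} p<ℓ = subst (0ℚ <ℚ_) (sym (scaled p<ℓ)) (scale-pos (d (cls p)))

    initial-lattice : ∀ {p} → p < ℓ → Lattice M (g p *ℚ y p)
    initial-lattice {p} p<ℓ = subst (λ f → Lattice M (g p *ℚ f p)) (sym y≡)
      (lattice-∣ (dy∣M p<ℓ)
        (lattice-* (lattice-height (g p) (height-g∣ p<ℓ)) (lattice-height (y₀ p) ∣-refl)))

    cost-fits : ∀ {p} → p < ℓ → Lattice M (divide (c p) (g p)) × ℚ.∣ divide (c p) (g p) ∣ ≤ℚ fromℕ M
    cost-fits {p} p<ℓ with height-divide (c p) (g-pos p<ℓ)
    ... | lat , bound = lattice-∣ h∣M lat , ℚ.≤-trans bound (fromℕ-mono (∣⇒≤ {{>-nonZero 0<M}} h∣M))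
      where
      h∣M : height (c p) * height (g p) ∣ M
      h∣M = ∣-trans (*-pres-∣ (subst (λ f → height (c p) ∣ height (f p)) c≡ ∣-refl) (height-g∣ p<ℓ)) (cd∣M p<ℓ)

    g-fits : ∀ {p} → p < ℓ → Lattice M (g p) × g p ≤ℚ fromℕ M
    g-fits {p} p<ℓ = lattice-∣ h∣M (lattice-height (g p) ∣-refl) ,
      subst (_≤ℚ fromℕ M) (ℚ.0≤p⇒∣p∣≡p (ℚ.<⇒≤ (g-pos p<ℓ)))
        (ℚ.≤-trans (∣∣≤height (g p)) (fromℕ-mono (∣⇒≤ {{>-nonZero 0<M}} h∣M)))
      where
      h∣M : height (g p) ∣ M
      h∣M = ∣-trans (height-g∣ p<ℓ) (∣-trans (m∣m*n _) (dy∣M p<ℓ))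

  record State (it n : ℕ) (cls : ℕ → ℕ) (d y c g w : ℕ → ℚ) : Set where
    open Rounding ℓ cls (unit ∘ d) (scale ∘ d) (λ p → divide (c p) (g p)) (λ p → g p *ℚ y p)
    field
      faithful  : Faithful ℓ n cls d y c g
      invariant : Invariant w
      lattice   : ∀ {p} → p < ℓ → Lattice M (w p)
      progress  : Progress w it

    open Invariant invariant public

    -- No load exceeds the total of its class, which is the scaled demand and hence at most `M`.
    load-fits : ∀ {p} → p < ℓ → bitsℚ (w p) ≤ W
    load-fits {p} p<ℓ = fits (lattice p<ℓ) (subst (_≤ℚ fromℕ M) (sym (ℚ.0≤p⇒∣p∣≡p (nonneg p<ℓ)))
      (ℚ.≤-trans (w≤G p<ℓ)
        (subst (_≤ℚ fromℕ M) (Faithful.scaled faithful p<ℓ) (proj₂ (g-fits faithful p<ℓ)))))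

  StateOf : ℕ → Memory → Set
  StateOf it σ = State it (nat σ 0 0) (nat σ 1) (rat σ 0) (rat σ 1) (rat σ 2) (rat σ 4) (rat σ 5)

  module View (σ : Memory) = Rounding ℓ (nat σ 1) (unit ∘ rat σ 0) (scale ∘ rat σ 0)
    (λ p → divide (rat σ 2 p) (rat σ 4 p)) (λ p → rat σ 4 p *ℚ rat σ 1 p)

  size : ∀ {it σ} → StateOf it σ → nat σ 0 0 ≡ ℓ
  size s = Faithful.n≡ (State.faithful s)

  Scaling : ℕ → Memory → Set
  Scaling i σ = Faithful i (nat σ 0 0) (nat σ 1) (rat σ 0) (rat σ 1) (rat σ 2) (rat σ 4) ×
                (∀ {p} → p < i → rat σ 5 p ≡ rat σ 4 p *ℚ rat σ 1 p)

  below-suc : ∀ {P : ℕ → Set} {i} → (∀ {p} → p < i → P p) → P i → ∀ {p} → p < suc i → P p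
  below-suc {i = i} below at {p} p<1+i with p ℕ.≟ i
  ... | yes refl = at
  ... | no  p≢i  = below (ℕ.≤∧≢⇒< (ℕ.≤-pred p<1+i) p≢i)

  pos⇒≰ : ∀ {q} → 0ℚ <ℚ q → ¬ q ≤ℚ 0ℚ
  pos⇒≰ 0<q q≤0 = ℚ.<-irrefl refl (ℚ.<-≤-trans 0<q q≤0)

  fits-height : ∀ q → height q ∣ M → bitsℚ q ≤ W
  fits-height q h∣M = fits (lattice-height q h∣M)
    (ℚ.≤-trans (∣∣≤height q) (fromℕ-mono (∣⇒≤ {{>-nonZero 0<M}} h∣M)))

  fits-product : ∀ p q → height p * height q ∣ M → bitsℚ (p *ℚ q) ≤ W
  fits-product p q h∣M = fits
    (lattice-∣ h∣M (lattice-* (lattice-height p ∣-refl) (lattice-height q ∣-refl)))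
    (begin
      ℚ.∣ p *ℚ q ∣                           ≡⟨ ℚ.∣p*q∣≡∣p∣*∣q∣ p q ⟩
      ℚ.∣ p ∣ *ℚ ℚ.∣ q ∣                     ≤⟨ *-monoˡ-≤ (ℚ.0≤∣p∣ p) (∣∣≤height q) ⟩
      ℚ.∣ p ∣ *ℚ fromℕ (height q)            ≤⟨ ℚ.*-monoʳ-≤-nonNeg (fromℕ (height q)) (∣∣≤height p) ⟩
      fromℕ (height p) *ℚ fromℕ (height q)   ≡⟨ fromℕ-* (height p) (height q) ⟨
      fromℕ (height p * height q)            ≤⟨ fromℕ-mono (∣⇒≤ {{>-nonZero 0<M}} h∣M) ⟩
      fromℕ M                                ∎)
    where open ℚ.≤-Reasoning

  module _ {σ : Memory} (i<ℓ : nat σ 3 0 < ℓ) (S : Scaling (nat σ 3 0) σ) where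
    private
      i = nat σ 3 0
      module F = Faithful (proj₁ S)

      g∣ : height (scale (rat σ 0 (nat σ 1 i))) ∣ height (d₀ (cls₀ i))
      g∣ = subst (λ x → height (scale (rat σ 0 (nat σ 1 i))) ∣ height x)
        (trans (cong (λ f → f (nat σ 1 i)) F.d≡) (cong (λ f → d₀ (f i)) F.cls≡))
        (height-scale (rat σ 0 (nat σ 1 i)))

      dy : ∀ {v} → v ≡ scale (rat σ 0 (nat σ 1 i)) → height v * height (rat σ 1 i) ∣ M
      dy refl = ∣-trans (*-pres-∣ g∣ (subst (λ f → height (f i) ∣ height (y₀ i)) (sym F.y≡) ∣-refl)) (dy∣M i<ℓ)

    store-scaled : ∀ v → v ≡ scale (rat σ 0 (nat σ 1 i)) →
      bitsℚ v ≤ W × wp W (setᴿ 5 pos (4 [ pos ] *ᴿ 1 [ pos ]))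
        (λ σ′ → nat σ′ 3 0 ≡ i × Scaling (suc i) (tick σ′))
        (mem (nat σ) (update (rat σ) 4 i v))
    store-scaled v v≡ =
      fits-height v (∣-trans (m∣m*n _) (dy v≡)) ,
      subst (λ x → bitsℚ (x *ℚ rat σ 1 i) ≤ W) (sym new-g) (fits-product v (rat σ 1 i) (dy v≡)) ,
      refl ,
      record
        { n≡ = F.n≡ ; cls≡ = F.cls≡ ; d≡ = F.d≡ ; y≡ = F.y≡ ; c≡ = F.c≡
        ; scaled = below-suc
            (λ p<i → trans (old-g p<i) (F.scaled p<i))
            (trans new-g v≡)
        } ,
      below-suc
        (λ {p} p<i → trans (update-other (rat σ) 5 _ (ℕ.<⇒≢ p<i ∘ sym))
          (trans (proj₂ S p<i) (cong (_*ℚ rat σ 1 p) (sym (old-g p<i)))))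
        (update-same (update (rat σ) 4 i v) 5 i _)
      where
      new-g : update (rat σ) 4 i v 4 i ≡ v
      new-g = update-same (rat σ) 4 i v
      old-g : ∀ {p} → p < i → update (rat σ) 4 i v 4 p ≡ rat σ 4 p
      old-g p<i = update-other (rat σ) 4 v (ℕ.<⇒≢ p<i ∘ sym)

    scale-step : wp W scaleBody (λ σ′ → nat σ′ 3 0 ≡ i × Scaling (suc i) (tick σ′)) σ
    scale-step = (λ le → store-scaled 1ℚ (sym (scale-≤ le))) ,
                 (λ nle → store-scaled (rat σ 0 (nat σ 1 i)) (sym (scale-≰ nle)))

  initial : ∀ {n cls d y c g w} → Faithful ℓ n cls d y c g → (∀ {p} → p < ℓ → w p ≡ g p *ℚ y p) →
            State 0 n cls d y c g w
  initial {cls = cls} {d} {y} {c} {g} {w} F@(record { cls≡ = refl ; d≡ = refl ; y≡ = refl ; c≡ = refl }) w≡ = record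
    { faithful  = F
    ; invariant = record
      { nonneg = λ p<ℓ → subst (0ℚ ≤ℚ_) (sym (w≡ p<ℓ)) (0≤* (ℚ.<⇒≤ (g-pos F p<ℓ)) (0≤y p<ℓ))
      ; sums   = class-sum
      ; total  = V.weigh-cong (unit ∘ d) ℓ w≡
      ; prefix = λ j<ℓ → V.exact (V.weigh-cong (unit ∘ d) _ λ p<j → w≡ (ℕ.<-trans p<j j<ℓ))
      ; costs  = ℚ.≤-reflexive (∑-cong ℓ λ {p} p<ℓ → cong (divide (c p) (g p) *ℚ_) (w≡ p<ℓ))
      }
    ; lattice   = λ p<ℓ → subst (Lattice M) (sym (w≡ p<ℓ)) (initial-lattice F p<ℓ)
    ; progress  = inj₂ (support≤ w ℓ)
    }
    where
    module V = Rounding ℓ cls (unit ∘ d) (scale ∘ d) (λ p → divide (c p) (g p)) (λ p → g p *ℚ y p)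
    class-sum : ∀ {q} → q < ℓ → V.weigh (indicator (cls q)) w ℓ ≡ scale (d (cls q))
    class-sum {q} q<ℓ = trans
      (class-scaled cls (scale ∘ d) q ℓ λ {p} p<ℓ → trans (w≡ p<ℓ) (cong (_*ℚ y p) (Faithful.scaled F p<ℓ)))
      (trans (cong (scale (d (cls q)) *ℚ_) (sums q<ℓ)) (ℚ.*-identityʳ (scale (d (cls q)))))

  Lasting : ℕ → ℕ → Memory → Set
  Lasting it i σ = StateOf it σ × View.LastSupport σ (rat σ 5) (nat σ 2) i

  last-step : ∀ {it σ} → nat σ 3 0 < ℓ → Lasting it (nat σ 3 0) σ →
    wp W lastBody (λ σ′ → nat σ′ 3 0 ≡ nat σ 3 0 × Lasting it (suc (nat σ 3 0)) (tick σ′)) σ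
  last-step {it} {σ} i<ℓ (s , L) =
    (λ w≤0 → refl , s , below-suc
      (λ p<i p-pos → let (a , b , rest) = L p<i p-pos in a , ℕ.m<n⇒m<1+n b , rest)
      (λ i-pos → contradiction w≤0 (pos⇒≰ i-pos))) ,
    (λ w≰0 → fits-index (ℕ.<⇒≤ i<ℓ) , refl , s , below-suc
      (old (ℚ.≰⇒> w≰0))
      (λ i-pos → subst (λ k → i ≤ k × k < suc i × 0ℚ <ℚ w k × cls k ≡ cls i)
        (sym (update-same (nat σ) 2 (cls i) i)) (ℕ.≤-refl , ℕ.≤-refl , i-pos , refl)))
    where
    i = nat σ 3 0
    cls = nat σ 1
    w = rat σ 5
    last′ = update (nat σ) 2 (cls i) i 2
    old : 0ℚ <ℚ w i → ∀ {p} → p < i → 0ℚ <ℚ w p →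
          p ≤ last′ (cls p) × last′ (cls p) < suc i × 0ℚ <ℚ w (last′ (cls p)) × cls (last′ (cls p)) ≡ cls p
    old i-pos {p} p<i p-pos with cls i ℕ.≟ cls p
    ... | no neq = subst (λ k → p ≤ k × k < suc i × 0ℚ <ℚ w k × cls k ≡ cls p)
            (sym (update-other (nat σ) 2 i neq))
            (let (a , b , rest) = L p<i p-pos in a , ℕ.m<n⇒m<1+n b , rest)
    ... | yes eq = subst (λ k → p ≤ k × k < suc i × 0ℚ <ℚ w k × cls k ≡ cls p)
            (sym (trans (cong last′ (sym eq)) (update-same (nat σ) 2 (cls i) i)))
            (ℕ.<⇒≤ p<i , ℕ.≤-refl , i-pos , eq)

  Scanning : ℕ → ℕ → Memory → Set
  Scanning it i σ = StateOf it σ × View.LastSupport σ (rat σ 5) (nat σ 2) ℓ ×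
    View.Scan.Scanned σ (rat σ 5) (nat σ 2) (rat σ 6) i (nat σ 5 0) (nat σ 6 0) (nat σ 7 0)

  module _ {it : ℕ} {σ : Memory} (i<ℓ : nat σ 3 0 < ℓ) (inv : Scanning it (nat σ 3 0) σ) where
    private
      i   = nat σ 3 0
      cls = nat σ 1
      w   = rat σ 5
      d   = rat σ 0
      e   = nat σ 6 0
      t   = nat σ 7 0
      s   = proj₁ inv
      L   = proj₁ (proj₂ inv)

      open View.Scan σ w (nat σ 2)
      open Transitions (noncrossing (State.faithful s)) L

      After : Memory → Set
      After σ′ = nat σ′ 3 0 ≡ i × Scanning it (suc i) (tick σ′)

      S : ∀ {φ} → nat σ 5 0 ≡ φ → Scanned (rat σ 6) i φ e t
      S eq = subst (λ φ → Scanned (rat σ 6) i φ e t) eq (proj₂ (proj₂ inv))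

      sg′ : ℚ → ℕ → ℚ
      sg′ v = update (rat σ) 6 i v 6

      agree : ∀ v {p} → p < i → sg′ v p ≡ rat σ 6 p
      agree v p<i = update-other (rat σ) 6 v (ℕ.<⇒≢ p<i ∘ sym)

      new : ∀ v → sg′ v i ≡ v
      new v = update-same (rat σ) 6 i v

      opened : Holds isOpen σ → 0ℚ <ℚ w i × i < nat σ 2 (cls i)
      opened (w≰0 , i+1≤) = ℚ.≰⇒> w≰0 , subst (_≤ nat σ 2 (cls i)) (ℕ.+-comm i 1) i+1≤

      open⁻¹ : 0ℚ <ℚ w i → i < nat σ 2 (cls i) → Holds isOpen σ
      open⁻¹ i-pos i<last = pos⇒≰ i-pos , subst (_≤ nat σ 2 (cls i)) (sym (ℕ.+-comm i 1)) i<last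

      fits-last : Holds isOpen σ → bitsℕ (nat σ 2 (cls i)) ≤ W
      fits-last open? = fits-index (ℕ.<⇒≤ (proj₁ (proj₂ (L i<ℓ (proj₁ (opened open?))))))

      keep : ∀ {φ} → nat σ 5 0 ≡ φ → Scanned (sg′ 0ℚ) (suc i) φ e t →
             wp W (setᴿ 6 pos (con 0ℚ)) After σ
      keep eq S′ = fits-0 , refl , s , L , subst (λ φ → Scanned (sg′ 0ℚ) (suc i) φ e t) (sym eq) S′

      not-child : ¬ Holds isChild σ → 0ℚ <ℚ w i → i < nat σ 2 (cls i) →
                  unit (d (cls e)) ≡ 0ℚ ⊎ unit (d (cls i)) ≡ 0ℚ ⊎ cls i ≡ cls e
      not-child ¬child i-pos i<last = case d (cls e) ℚ.≤? 0ℚ of λ where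
        (yes de≤0) → inj₁ (unit-≤ de≤0)
        (no  de≰0) → inj₂ (case d (cls i) ℚ.≤? 0ℚ of λ where
          (yes di≤0) → inj₁ (unit-≤ di≤0)
          (no  di≰0) → inj₂ (case cls i ℕ.≟ cls e of λ where
            (yes same) → same
            (no  diff) → contradiction
              (open⁻¹ i-pos i<last , (λ (a , b) → diff (ℕ.≤-antisym a b)) , de≰0 , di≰0) ¬child))

      in-top : nat σ 5 0 ≡ 1 → wp W
        (ifᵀ (cellᴺ 6 ≤ᴺ pos)
          (setᴿ 6 pos (con -1ℚ) ⨾ setᴺ 5 (con 0) (con 3))
        (ifᵀ isChild
          (setᴿ 6 pos (con -1ℚ) ⨾ setᴺ 5 (con 0) (con 2) ⨾ setᴺ 7 (con 0) lastᴺ)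
          (setᴿ 6 pos (con 0ℚ)))) After σ
      in-top eq =
        (λ e≤i → fits-₋1 , fitsᴺ (ℕ.m≤m+n 3 ℓ) , refl , s , L ,
          top→done i<ℓ (agree -1ℚ) (S eq) e≤i (new -1ℚ)) ,
        (λ e≰i →
          (λ child@(open? , diff , de≰0 , di≰0) → fits-₋1 , fitsᴺ (s≤s (s≤s z≤n)) , fits-last open? , refl , s , L ,
            top→child i<ℓ (agree -1ℚ) (S eq) e≰i (proj₁ (opened open?)) (proj₂ (opened open?))
              (unit-≰ de≰0) (unit-≰ di≰0)
              (λ same → diff (ℕ.≤-reflexive same , ℕ.≤-reflexive (sym same))) (new -1ℚ)) ,
          (λ ¬child → keep eq (top→top i<ℓ (agree 0ℚ) (S eq) e≰i (not-child ¬child) (new 0ℚ))))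

      in-child : nat σ 5 0 ≡ 2 → wp W
        (ifᵀ (cellᴺ 7 ≤ᴺ pos)
          (setᴿ 6 pos (con 1ℚ) ⨾ setᴺ 5 (con 0) (con 1))
          (setᴿ 6 pos (con 0ℚ))) After σ
      in-child eq =
        (λ t≤i → fits-1 , fitsᴺ (s≤s z≤n) , refl , s , L , child→top i<ℓ (agree 1ℚ) (S eq) t≤i (new 1ℚ)) ,
        (λ t≰i → keep eq (child→child i<ℓ (agree 0ℚ) (S eq) t≰i (new 0ℚ)))

      -- `Phase` is inhabited at four indices only, so three failed comparisons leave the last.
      phase-done : ∀ {φ} → Phase (rat σ 6) i φ e t → ¬ φ ≤ 0 → ¬ φ ≤ 1 → ¬ φ ≤ 2 → φ ≡ 3
      phase-done (seek _ _)                      0≰ 1≰ 2≰ = contradiction z≤n 0≰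
      phase-done (top _ _ _ _ _ _)               0≰ 1≰ 2≰ = contradiction ℕ.≤-refl 1≰
      phase-done (child _ _ _ _ _ _ _ _ _ _ _ _) 0≰ 1≰ 2≰ = contradiction ℕ.≤-refl 2≰
      phase-done (done _ _ _ _ _)                0≰ 1≰ 2≰ = refl

    scan-step : wp W scanBody After σ
    scan-step =
      (λ φ≤0 →
        let eq = ℕ.n≤0⇒n≡0 φ≤0 in
        (λ open? → fits-1 , fitsᴺ (s≤s z≤n) , fits-last open? , refl , s , L ,
          seek→top i<ℓ (agree 1ℚ) (S eq) (proj₁ (opened open?)) (proj₂ (opened open?)) (new 1ℚ)) ,
        (λ ¬open → keep eq (seek→seek i<ℓ (agree 0ℚ) (S eq)
          (λ (i-pos , i<last) → ¬open (open⁻¹ i-pos i<last)) (new 0ℚ)))) ,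
      (λ φ≰0 →
        (λ φ≤1 → in-top (ℕ.≤-antisym φ≤1 (ℕ.≰⇒> φ≰0))) ,
        (λ φ≰1 →
          (λ φ≤2 → in-child (ℕ.≤-antisym φ≤2 (ℕ.≰⇒> φ≰1))) ,
          (λ φ≰2 →
            let eq = phase-done (Scanned.phase (proj₂ (proj₂ inv))) φ≰0 φ≰1 φ≰2 in
            keep eq (done→done i<ℓ (agree 0ℚ) (S eq) (new 0ℚ)))))

  StateWith : ℕ → (ℕ → ℚ) → Memory → Set
  StateWith it w σ = State it (nat σ 0 0) (nat σ 1) (rat σ 0) (rat σ 1) (rat σ 2) (rat σ 4) w

  -- Signs lie in the lattice with denominator 1, so multiplying by them does not refine the
  -- lattice; otherwise the denominators would grow with each iteration.
  lattice-sign : ∀ {q s} → Lattice M q → s ≡ 0ℚ ⊎ (s ≡ 1ℚ ⊎ s ≡ -1ℚ) → Lattice M (q *ℚ s)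
  lattice-sign {q} {s} lat s± = subst (λ N → Lattice N (q *ℚ s)) (ℕ.*-identityʳ M) (lattice-* lat (unit-lattice s±))
    where
    unit-lattice : ∀ {s} → s ≡ 0ℚ ⊎ (s ≡ 1ℚ ⊎ s ≡ -1ℚ) → Lattice 1 s
    unit-lattice (inj₁ refl)        = lattice-fromℤ (+ 0)
    unit-lattice (inj₂ (inj₁ refl)) = lattice-fromℤ (+ 1)
    unit-lattice (inj₂ (inj₂ refl)) = lattice-fromℤ ℤ.-[1+ 0 ]

  bound-sign : ∀ {q s B} → ℚ.∣ q ∣ ≤ℚ B → s ≡ 0ℚ ⊎ (s ≡ 1ℚ ⊎ s ≡ -1ℚ) → ℚ.∣ q *ℚ s ∣ ≤ℚ B
  bound-sign {q} {s} {B} bound s± = begin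
    ℚ.∣ q *ℚ s ∣          ≡⟨ ℚ.∣p*q∣≡∣p∣*∣q∣ q s ⟩
    ℚ.∣ q ∣ *ℚ ℚ.∣ s ∣    ≤⟨ *-monoˡ-≤ (ℚ.0≤∣p∣ q) (unit-bound s±) ⟩
    ℚ.∣ q ∣ *ℚ 1ℚ         ≡⟨ ℚ.*-identityʳ ℚ.∣ q ∣ ⟩
    ℚ.∣ q ∣               ≤⟨ bound ⟩
    B                     ∎
    where
    open ℚ.≤-Reasoning
    unit-bound : ∀ {s} → s ≡ 0ℚ ⊎ (s ≡ 1ℚ ⊎ s ≡ -1ℚ) → ℚ.∣ s ∣ ≤ℚ 1ℚ
    unit-bound (inj₁ refl)        = ℚ.nonNegative⁻¹ 1ℚ
    unit-bound (inj₂ (inj₁ refl)) = ℚ.≤-refl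
    unit-bound (inj₂ (inj₂ refl)) = ℚ.≤-refl

  sign-value : ∀ {P Q : Set} {s : ℚ} → s ≡ 0ℚ ⊎ (P × Q) → s ≡ 0ℚ ⊎ Q
  sign-value (inj₁ eq)       = inj₁ eq
  sign-value (inj₂ (_ , eq)) = inj₂ eq

  -- Each term is at most `M` in absolute value because its sign is 0, 1 or -1, so `i` terms stay
  -- within `i * M`.
  partial-fits : ∀ {n cls d y c g} {sg : ℕ → ℚ} → Faithful ℓ n cls d y c g →
    (∀ {p} → p < ℓ → sg p ≡ 0ℚ ⊎ (sg p ≡ 1ℚ ⊎ sg p ≡ -1ℚ)) →
    ∀ i → i ≤ ℓ → Lattice M (∑ (λ p → divide (c p) (g p) *ℚ sg p) i) ×
                  ℚ.∣ ∑ (λ p → divide (c p) (g p) *ℚ sg p) i ∣ ≤ℚ fromℕ (i * M)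
  partial-fits F signs zero i≤ℓ = lattice-fromℤ (+ 0) , ℚ.≤-refl
  partial-fits {c = c} {g} {sg} F signs (suc i) i<ℓ
    with partial-fits {sg = sg} F signs i (ℕ.<⇒≤ i<ℓ) | cost-fits F i<ℓ
  ... | lat , bound | lat′ , bound′ =
    lattice-+ lat (lattice-sign lat′ (signs i<ℓ)) ,
    (begin
      ℚ.∣ part +ℚ term ∣              ≤⟨ ℚ.∣p+q∣≤∣p∣+∣q∣ part term ⟩
      ℚ.∣ part ∣ +ℚ ℚ.∣ term ∣        ≤⟨ ℚ.+-mono-≤ bound (bound-sign bound′ (signs i<ℓ)) ⟩
      fromℕ (i * M) +ℚ fromℕ M        ≡⟨ fromℤ-+ (+ (i * M)) (+ M) ⟩
      fromℕ (i * M + M)               ≡⟨ cong fromℕ (ℕ.+-comm (i * M) M) ⟩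
      fromℕ (suc i * M)               ∎)
    where
    open ℚ.≤-Reasoning
    part = ∑ (λ p → divide (c p) (g p) *ℚ sg p) i
    term = divide (c i) (g i) *ℚ sg i

  moveCost : Memory → ℕ → ℚ
  moveCost σ = ∑ (λ p → divide (rat σ 2 p) (rat σ 4 p) *ℚ rat σ 6 p)

  Weighing : ℕ → ℕ → Memory → Set
  Weighing it i σ = StateOf it σ × View.Swept σ (rat σ 5) (rat σ 6) × rat σ 7 0 ≡ moveCost σ i

  weigh-step : ∀ {it σ} → nat σ 3 0 < ℓ → Weighing it (nat σ 3 0) σ →
    wp W weighBody (λ σ′ → nat σ′ 3 0 ≡ nat σ 3 0 × Weighing it (suc (nat σ 3 0)) (tick σ′)) σ
  weigh-step {it} {σ} i<ℓ (s , S , eq) =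
    subst (λ x → bitsℚ x ≤ W) (sym new) (bits _ (proj₁ part) (ℚ.≤-trans (proj₂ part)
      (fromℕ-mono (ℕ.*-monoˡ-≤ M (ℕ.≤-trans i<ℓ (ℕ.n≤1+n ℓ)))))) ,
    refl , s , S , new
    where
    part = partial-fits {sg = rat σ 6} (State.faithful s)
      (λ p<ℓ → sign-value (Supports.Swept.signs S p<ℓ)) (suc (nat σ 3 0)) i<ℓ
    new : rat σ 7 0 +ℚ divide (rat σ 2 (nat σ 3 0)) (rat σ 4 (nat σ 3 0)) *ℚ rat σ 6 (nat σ 3 0)
          ≡ moveCost σ (suc (nat σ 3 0))
    new = cong (_+ℚ divide (rat σ 2 (nat σ 3 0)) (rat σ 4 (nat σ 3 0)) *ℚ rat σ 6 (nat σ 3 0)) eq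

  Aimed : ℕ → (ℕ → ℚ) → Memory → Set
  Aimed it w σ = StateWith it w σ × View.Swept σ w (rat σ 6) ×
    (rat σ 8 0 ≡ 1ℚ ⊎ rat σ 8 0 ≡ -1ℚ) × rat σ 8 0 *ℚ moveCost σ ℓ ≤ℚ 0ℚ

  direction-step : ∀ {it σ} → Weighing it ℓ σ → wp W chooseDirection (λ σ′ → Aimed it (rat σ′ 5) σ′) σ
  direction-step {it} {σ} (s , S , eq) =
    (λ γ≤0 → fits-1 , s , S , inj₁ refl ,
      subst (_≤ℚ 0ℚ) (trans eq (sym (ℚ.*-identityˡ (moveCost σ ℓ)))) γ≤0) ,
    (λ γ≰0 → fits-₋1 , s , S , inj₂ refl ,
      subst (_≤ℚ 0ℚ) (trans (cong (λ x → -ℚ x) eq) (solve 1 (λ x → :- x := con -1ℚ :* x) refl (moveCost σ ℓ)))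
        (ℚ.neg-antimono-≤ (ℚ.<⇒≤ (ℚ.≰⇒> γ≰0))))

  Limiting : ℕ → ℕ → Memory → Set
  Limiting it i σ = Aimed it (rat σ 5) σ ×
    View.Bottleneck σ (rat σ 5) (rat σ 6) (rat σ 8 0) (rat σ 9 0) i

  limit-step : ∀ {it σ} → nat σ 3 0 < ℓ → Limiting it (nat σ 3 0) σ →
    wp W limitBody (λ σ′ → nat σ′ 3 0 ≡ nat σ 3 0 × Limiting it (suc (nat σ 3 0)) (tick σ′)) σ
  limit-step {it} {σ} i<ℓ (A@(s , S , dir± , cheap) , B) =
    (λ (i-neg , lower) → State.load-fits s i<ℓ , refl , A ,
      V.some ℕ.≤-refl (ℚ.≰⇒> i-neg) refl (below-suc (least lower B) (λ _ → ℚ.≤-refl))) ,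
    (λ ¬lower → refl , A , unchanged ¬lower B)
    where
    module V = View σ
    i   = nat σ 3 0
    w   = rat σ 5
    sg  = rat σ 6
    dir = rat σ 8 0
    δ   = rat σ 9 0

    δ-pos : ∀ {r} → r < i → dir *ℚ sg r <ℚ 0ℚ → δ ≡ w r → 0ℚ <ℚ δ
    δ-pos {r} r<i neg eq with Supports.Swept.signs S (ℕ.<-trans r<i i<ℓ)
    ... | inj₂ (r-pos , _) = subst (0ℚ <ℚ_) (sym eq) r-pos
    ... | inj₁ z = contradiction (subst (_<ℚ 0ℚ) (trans (cong (dir *ℚ_) z) (ℚ.*-zeroʳ dir)) neg) (ℚ.<-irrefl refl)

    least : ¬ (¬ δ ≤ℚ 0ℚ × δ ≤ℚ w i) → V.Bottleneck w sg dir δ i →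
            ∀ {p} → p < i → dir *ℚ sg p <ℚ 0ℚ → w i ≤ℚ w p
    least lower (V.none _ ¬neg)           p<i neg = contradiction neg (¬neg p<i)
    least lower (V.some r<i r-neg eq min) p<i neg = ℚ.≤-trans
      (ℚ.<⇒≤ (ℚ.≰⇒> λ δ≤wi → lower (pos⇒≰ (δ-pos r<i r-neg eq) , δ≤wi))) (min p<i neg)

    unchanged : ¬ (¬ 0ℚ ≤ℚ dir *ℚ sg i × ¬ (¬ δ ≤ℚ 0ℚ × δ ≤ℚ w i)) →
                V.Bottleneck w sg dir δ i → V.Bottleneck w sg dir δ (suc i)
    unchanged ¬lower (V.none δ≡0 ¬neg) = V.none δ≡0 (below-suc ¬neg
      λ neg → ¬lower ((λ 0≤ → ℚ.<-irrefl refl (ℚ.<-≤-trans neg 0≤)) ,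
        λ (δ≰0 , _) → δ≰0 (ℚ.≤-reflexive δ≡0)))
    unchanged ¬lower (V.some r<i r-neg eq min) = V.some (ℕ.m<n⇒m<1+n r<i) r-neg eq (below-suc min
      λ neg → case δ ℚ.≤? w i of λ where
        (yes δ≤wi) → δ≤wi
        (no  δ≰wi) → contradiction
          ((λ 0≤ → ℚ.<-irrefl refl (ℚ.<-≤-trans neg 0≤)) , λ (_ , δ≤wi) → δ≰wi δ≤wi) ¬lower)

  module _ {it : ℕ} {w : ℕ → ℚ} {σ : Memory} (A : Aimed it w σ) (B : View.Bottleneck σ w (rat σ 6) (rat σ 8 0) (rat σ 9 0) ℓ)
           {w′ : ℕ → ℚ} (moved : ∀ {p} → p < ℓ → w′ p ≡ w p +ℚ (rat σ 8 0 *ℚ rat σ 9 0) *ℚ rat σ 6 p) where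
    private
      s = proj₁ A
      S = proj₁ (proj₂ A)
      dir± = proj₁ (proj₂ (proj₂ A))
      open View σ
      open Moving (State.invariant s) S dir± (proj₂ (proj₂ (proj₂ A))) B

      δ-lattice : View.Bottleneck σ w (rat σ 6) (rat σ 8 0) (rat σ 9 0) ℓ → Lattice M (rat σ 9 0)
      δ-lattice (none eq _)       = subst (Lattice M) (sym eq) (lattice-fromℤ (+ 0))
      δ-lattice (some r<ℓ _ eq _) = subst (Lattice M) (sym eq) (State.lattice s r<ℓ)

    moved-state : StateWith (suc it) w′ σ
    moved-state = record
      { faithful  = State.faithful s
      ; invariant = invariant-move (State.invariant s) (move moved)
      ; lattice   = λ p<ℓ → subst (Lattice M) (sym (moved p<ℓ)) (lattice-+ (State.lattice s p<ℓ)
          (lattice-sign (subst (Lattice M) (ℚ.*-comm (rat σ 9 0) (rat σ 8 0)) (lattice-sign (δ-lattice B) (inj₂ dir±)))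
            (sign-value (Swept.signs S p<ℓ))))
      ; progress  = progress moved (State.progress s)
      }

  -- While the pass runs, array 5 mixes new and old loads and is not itself a valid state. The old
  -- loads survive as the ghost function `w`.
  Shifting : ℕ → ℕ → Memory → Set
  Shifting it i σ = Σ[ w ∈ (ℕ → ℚ) ]
    (Aimed it w σ × View.Bottleneck σ w (rat σ 6) (rat σ 8 0) (rat σ 9 0) ℓ ×
     (∀ {p} → p < i → rat σ 5 p ≡ w p +ℚ (rat σ 8 0 *ℚ rat σ 9 0) *ℚ rat σ 6 p) ×
     (∀ {p} → i ≤ p → rat σ 5 p ≡ w p))

  move-step : ∀ {it σ} → nat σ 3 0 < ℓ → Shifting it (nat σ 3 0) σ →
    wp W moveBody (λ σ′ → nat σ′ 3 0 ≡ nat σ 3 0 × Shifting it (suc (nat σ 3 0)) (tick σ′)) σ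
  move-step {it} {σ} i<ℓ (w , A , B , done , todo) =
    subst (λ x → bitsℚ x ≤ W) (sym new)
      -- The new entry is bounded through the fully moved load vector, which is a valid state
      -- although the array has not reached it yet.
      (State.load-fits (moved-state {σ = σ} A B {λ p → w p +ℚ (rat σ 8 0 *ℚ rat σ 9 0) *ℚ rat σ 6 p} (λ _ → refl)) i<ℓ) ,
    refl , w , A , B ,
    below-suc
      (λ p<i → trans (update-other (rat σ) 5 _ (ℕ.<⇒≢ p<i ∘ sym)) (done p<i))
      (trans (update-same (rat σ) 5 (nat σ 3 0) _) new) ,
    (λ i<p → trans (update-other (rat σ) 5 _ (ℕ.<⇒≢ i<p)) (todo (ℕ.<⇒≤ i<p)))
    where
    new : rat σ 5 (nat σ 3 0) +ℚ (rat σ 8 0 *ℚ rat σ 9 0) *ℚ rat σ 6 (nat σ 3 0)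
          ≡ w (nat σ 3 0) +ℚ (rat σ 8 0 *ℚ rat σ 9 0) *ℚ rat σ 6 (nat σ 3 0)
    new = cong (_+ℚ (rat σ 8 0 *ℚ rat σ 9 0) *ℚ rat σ 6 (nat σ 3 0)) (todo ℕ.≤-refl)

  iteration-rule : ∀ {it σ} → StateOf it σ →
                   Reaches W iterationTime iteration σ (StateOf (suc it))
  iteration-rule {it} {σ} s =
    forEach-rule lastBody (Lasting it) (λ {_} {σ} (s , _) → size {it} {σ} s)
      (λ {σ} → last-step {it} {σ}) (s , λ ()) thenʳ λ {σ} (s , L) →
    wp-sound (setᴺ 5 (con 0) (con 0)) {Q = λ σ → Scanning it 0 (reset σ)}
      (fits-index z≤n , s , L , View.Scan.start (reset σ) (rat σ 5) (nat σ 2)) thenʳ λ inv →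
    forEach-rule scanBody (Scanning it) (λ {_} {σ} (s , _) → size {it} {σ} s)
      (λ {σ} → scan-step {it} {σ}) inv thenʳ λ {σ} (s , L , S) →
    wp-sound (setᴿ 7 (con 0) (con 0ℚ)) {Q = λ σ → Weighing it 0 (reset σ)}
      (fits-0 , s , View.Scan.Transitions.finish σ (rat σ 5) (nat σ 2) (noncrossing (State.faithful s)) L S , refl) thenʳ λ inv →
    forEach-rule weighBody (Weighing it) (λ {_} {σ} (s , _) → size {it} {σ} s)
      (λ {σ} → weigh-step {it} {σ}) inv thenʳ λ {σ} inv →
    wp-sound chooseDirection (direction-step {it} {σ} inv) thenʳ λ {σ} A →
    wp-sound (setᴿ 9 (con 0) (con 0ℚ)) {Q = λ σ → Limiting it 0 (reset σ)}
      (fits-0 , A , Rounding.none refl (λ ())) thenʳ λ inv →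
    forEach-rule limitBody (Limiting it) (λ {_} {σ} ((s , _) , _) → size {it} {σ} s)
      (λ {σ} → limit-step {it} {σ}) inv thenʳ λ {σ} (A , B) →
    weaken ℕ.≤-refl (λ {σ} (w , A , B , done , _) → moved-state {σ = σ} A B done)
      (forEach-rule moveBody (Shifting it) (λ {_} {σ} (w , (s , _) , _) → Faithful.n≡ (State.faithful s))
        (λ {σ} → move-step {it} {σ}) (rat σ 5 , A , B , (λ ()) , λ _ → refl))

  outer-rule : ∀ {σ} → StateOf 0 σ →
    Reaches W outerTime
      (setᴺ 4 (con 0) (con 0) ⨾ while (cellᴺ 4 +ᴺ con 1 ≤ᴺ cellᴺ 0) (iteration ⨾ nextIteration))
      σ (StateOf ℓ)
  outer-rule {σ} s =
    wp-sound (setᴺ 4 (con 0) (con 0)) {Q = Outer 0} (fits-index z≤n , refl , s) thenʳ λ inv →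
    weaken ℕ.≤-refl proj₂ (while-rule Outer
      (λ {it} {σ} → enter {it} {σ}) (λ {it} {σ} → stay {it} {σ}) (λ {it} {σ} → body-step {it} {σ}) ℓ refl inv)
    where
    Outer : ℕ → Memory → Set
    Outer it σ = nat σ 4 0 ≡ it × StateOf it σ
    enter : ∀ {it σ} → Outer it σ → it < ℓ → nat σ 4 0 + 1 ≤ nat σ 0 0
    enter {it} {σ} (refl , s) it<ℓ = subst₂ _≤_ (sym (ℕ.+-comm _ 1)) (sym (size {it} {σ} s)) it<ℓ
    stay : ∀ {it σ} → Outer it σ → nat σ 4 0 + 1 ≤ nat σ 0 0 → it < ℓ
    stay {it} {σ} (refl , s) le = subst₂ _≤_ (ℕ.+-comm _ 1) (size {it} {σ} s) le
    body-step : ∀ {it σ} → it < ℓ → Outer it σ →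
      Reaches W (iterationTime + cost nextIteration) (iteration ⨾ nextIteration) σ (Outer (suc it))
    body-step {it} {σ} it<ℓ (eq , s) =
      preserving 4 (iteration-rule {it} {σ} s) thenʳ λ {σ′} (kept , s′) →
      let eq′ = trans (cong (_+ 1) (trans kept eq)) (ℕ.+-comm it 1) in
      wp-sound nextIteration (subst (λ n → bitsℕ n ≤ W) (sym eq′) (fits-index it<ℓ) , eq′ , s′)

  Rounded : ℕ → Memory → Set
  Rounded i σ = StateOf ℓ σ ×
    (∀ {p} → p < i → (rat σ 5 p ≤ℚ 0ℚ → rat σ 3 p ≡ 0ℚ) × (¬ rat σ 5 p ≤ℚ 0ℚ → rat σ 3 p ≡ 1ℚ))

  round-step : ∀ {σ} → nat σ 3 0 < ℓ → Rounded (nat σ 3 0) σ →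
    wp W roundBody (λ σ′ → nat σ′ 3 0 ≡ nat σ 3 0 × Rounded (suc (nat σ 3 0)) (tick σ′)) σ
  round-step {σ} i<ℓ (s , out) =
    (λ w≤0 → fits-0 , refl , s , below-suc (old 0ℚ) ((λ _ → update-same (rat σ) 3 _ 0ℚ) , contradiction w≤0)) ,
    (λ w≰0 → fits-1 , refl , s , below-suc (old 1ℚ) ((λ w≤0 → contradiction w≤0 w≰0) , λ _ → update-same (rat σ) 3 _ 1ℚ))
    where
    i = nat σ 3 0
    old : ∀ v {p} → p < i → (rat σ 5 p ≤ℚ 0ℚ → update (rat σ) 3 i v 3 p ≡ 0ℚ) ×
                            (¬ rat σ 5 p ≤ℚ 0ℚ → update (rat σ) 3 i v 3 p ≡ 1ℚ)
    old v p<i = let same = update-other (rat σ) 3 v (ℕ.<⇒≢ p<i ∘ sym) in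
      (λ w≤0 → trans same (proj₁ (out p<i) w≤0)) , (λ w≰0 → trans same (proj₂ (out p<i) w≰0))

  program-rule : ∀ {σ} → nat σ 0 0 ≡ ℓ → nat σ 1 ≡ cls₀ → rat σ 0 ≡ d₀ → rat σ 1 ≡ y₀ → rat σ 2 ≡ c₀ →
                 Reaches W programTime program σ (Rounded ℓ)
  program-rule {σ} n≡ cls≡ d≡ y≡ c≡ =
    forEach-rule scaleBody Scaling (λ (F , _) → Faithful.n≡ F) (λ {σ} → scale-step {σ})
      (record { n≡ = n≡ ; cls≡ = cls≡ ; d≡ = d≡ ; y≡ = y≡ ; c≡ = c≡ ; scaled = λ () } , λ ()) thenʳ λ {σ} (F , w≡) →
    outer-rule (initial F w≡) thenʳ λ {σ} s →
    forEach-rule roundBody Rounded (λ {_} {σ} (s , _) → size {ℓ} {σ} s) (λ {σ} → round-step {σ}) (s , λ ())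

  -- From the final loads back to selections and original demands

  record Outcome (z : ℕ → ℚ) : Set where
    field
      binary    : ∀ {p} → p < ℓ → z p ≡ 0ℚ ⊎ z p ≡ 1ℚ
      class-sum : ∀ {q} → q < ℓ → ∑ (λ p → indicator (cls₀ q) (cls₀ p) *ℚ z p) ℓ ≡ 1ℚ
      total     : ∑ (λ p → d₀ (cls₀ p) *ℚ z p) ℓ ≡ ∑ (λ p → d₀ (cls₀ p) *ℚ y₀ p) ℓ
      prefix    : ∀ {D} → 0ℚ ≤ℚ D → (∀ {q} → q < ℓ → d₀ (cls₀ q) ≤ℚ D) → ∀ {j} → j < ℓ →
                  ℚ.∣ ∑ (λ p → d₀ (cls₀ p) *ℚ y₀ p) j -ℚ ∑ (λ p → d₀ (cls₀ p) *ℚ z p) j ∣ ≤ℚ D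
      cheaper   : ∑ (λ p → c₀ p *ℚ z p) ℓ ≤ℚ ∑ (λ p → c₀ p *ℚ y₀ p) ℓ

  module _ {n : ℕ} {cls : ℕ → ℕ} {d y c g w z : ℕ → ℚ}
           (S : State ℓ n cls d y c g w)
           (read : ∀ {p} → p < ℓ → (w p ≤ℚ 0ℚ → z p ≡ 0ℚ) × (¬ w p ≤ℚ 0ℚ → z p ≡ 1ℚ)) where
    private
      module V = Rounding ℓ cls (unit ∘ d) (scale ∘ d) (λ p → divide (c p) (g p)) (λ p → g p *ℚ y p)
      open State S
      open Faithful faithful

      w≡ : ∀ {p} → p < ℓ → w p ≡ scale (d (cls p)) *ℚ z p
      w≡ {p} p<ℓ = case w p ℚ.≤? 0ℚ of λ where
        (yes w≤0) → trans (ℚ.≤-antisym w≤0 (nonneg p<ℓ))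
          (sym (trans (cong (scale (d (cls p)) *ℚ_) (proj₁ (read p<ℓ) w≤0)) (ℚ.*-zeroʳ (scale (d (cls p))))))
        -- In a settled vector the only positive entry of a class carries its whole total.
        (no w≰0) → trans (settled⇒full (V.progress⇒settled progress) p<ℓ (ℚ.≰⇒> w≰0))
          (sym (trans (cong (scale (d (cls p)) *ℚ_) (proj₂ (read p<ℓ) w≰0)) (ℚ.*-identityʳ (scale (d (cls p))))))

      -- The product of `unit` and `scale` is the true demand, including 0, so the weighted loads
      -- are the original ones.
      loads : ∀ {f x : ℕ → ℚ} → (∀ {p} → p < ℓ → f p ≡ scale (d (cls p)) *ℚ x p) →
              ∀ {j} → j ≤ ℓ → V.weigh (unit ∘ d) f j ≡ ∑ (λ p → d₀ (cls₀ p) *ℚ x p) j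
      loads {f} {x} f≡ {j} j≤ℓ = ∑-cong j λ {p} p<j → trans
        (cong (unit (d (cls p)) *ℚ_) (f≡ (ℕ.<-≤-trans p<j j≤ℓ)))
        (trans (sym (ℚ.*-assoc (unit (d (cls p))) (scale (d (cls p))) (x p)))
          (cong (_*ℚ x p) (trans (unit*scale (subst (λ f → 0ℚ ≤ℚ f (cls p)) (sym d≡) (0≤d (cls p))))
            (cong₂ (λ f k → f (k p)) d≡ cls≡))))

      costs-≡ : ∀ {f x : ℕ → ℚ} → (∀ {p} → p < ℓ → f p ≡ scale (d (cls p)) *ℚ x p) →
                ∑ (λ p → divide (c p) (g p) *ℚ f p) ℓ ≡ ∑ (λ p → c₀ p *ℚ x p) ℓ
      costs-≡ {f} {x} f≡ = ∑-cong ℓ λ {p} p<ℓ → trans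
        (cong (divide (c p) (g p) *ℚ_) (trans (f≡ p<ℓ) (cong (_*ℚ x p) (sym (scaled p<ℓ)))))
        (trans (sym (ℚ.*-assoc (divide (c p) (g p)) (g p) (x p)))
          (cong (_*ℚ x p) (trans (divide-* (c p) (g-pos faithful p<ℓ)) (cong (λ f → f p) c≡))))

      w₀≡ : ∀ {p} → p < ℓ → g p *ℚ y p ≡ scale (d (cls p)) *ℚ y₀ p
      w₀≡ {p} p<ℓ = cong₂ _*ℚ_ (scaled p<ℓ) (cong (λ f → f p) y≡)

    outcome : Outcome z
    outcome = record
      { binary    = λ {p} p<ℓ → case w p ℚ.≤? 0ℚ of λ where
          (yes w≤0) → inj₁ (proj₁ (read p<ℓ) w≤0)
          (no  w≰0) → inj₂ (proj₂ (read p<ℓ) w≰0)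
      ; class-sum = λ {q} q<ℓ → subst (λ k → ∑ (λ p → indicator (k q) (k p) *ℚ z p) ℓ ≡ 1ℚ) cls≡
          (cancel (scale-pos (d (cls q))) (trans (sym (class-scaled cls (scale ∘ d) q ℓ w≡)) (State.sums S q<ℓ)))
      ; total     = trans (sym (loads w≡ ℕ.≤-refl)) (trans (State.total S) (loads w₀≡ ℕ.≤-refl))
      ; prefix    = λ {D} 0≤D d≤D j<ℓ → subst₂ (λ a b → ℚ.∣ a -ℚ b ∣ ≤ℚ D)
          (loads w₀≡ (ℕ.<⇒≤ j<ℓ)) (loads w≡ (ℕ.<⇒≤ j<ℓ))
          (State.deviation S (λ k → 0≤unit (d k)) 0≤D
            (λ {q} q<ℓ → subst (_≤ℚ D) (sym (trans
              (unit*scale (subst (λ f → 0ℚ ≤ℚ f (cls q)) (sym d≡) (0≤d (cls q))))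
              (cong₂ (λ f k → f (k q)) d≡ cls≡))) (d≤D q<ℓ)) j<ℓ)
      ; cheaper   = subst₂ _≤ℚ_ (costs-≡ w≡) (costs-≡ w₀≡) costs
      }
      where
      cancel : ∀ {a x} → 0ℚ <ℚ a → a *ℚ x ≡ a → x ≡ 1ℚ
      cancel {a} {x} 0<a eq = ℚ.≤-antisym
        (ℚ.*-cancelˡ-≤-pos a {{ℚ.positive 0<a}} (ℚ.≤-reflexive (trans eq (sym (ℚ.*-identityʳ a)))))
        (ℚ.*-cancelˡ-≤-pos a {{ℚ.positive 0<a}} (ℚ.≤-reflexive (trans (ℚ.*-identityʳ a) (sym eq))))

-- Running time

affine≤ : ∀ {x s} a b → x ≤ s → a + x * b ≤ (a + b) * suc s
affine≤ {x} {s} a b x≤s = begin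
  a + x * b                 ≤⟨ ℕ.+-mono-≤ (ℕ.m≤m*n a (suc s)) (ℕ.*-monoˡ-≤ b (ℕ.≤-trans x≤s (ℕ.n≤1+n s))) ⟩
  a * suc s + suc s * b     ≡⟨ cong (λ y → a * suc s + y) (ℕ.*-comm (suc s) b) ⟩
  a * suc s + b * suc s     ≡⟨ ℕ.*-distribʳ-+ (suc s) a b ⟨
  (a + b) * suc s           ∎
  where open ℕ.≤-Reasoning

-- Wrapped in a record so that `rate` and `time` can be inferred, which the bare inequality with its
-- product would not allow. The successor makes room for constants when `s` is 0.
record Linear (s rate time : ℕ) : Set where
  constructor linear
  field bound : time ≤ rate * suc s

open Linear

constant : ∀ {s} k → Linear s k k
constant {s} k = linear (ℕ.m≤m*n k (suc s))

infixr 5 _⊕_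

_⊕_ : ∀ {s k l a b} → Linear s k a → Linear s l b → Linear s (k + l) (a + b)
_⊕_ {s} {k} {l} (linear a≤) (linear b≤) =
  linear (ℕ.≤-trans (ℕ.+-mono-≤ a≤ b≤) (ℕ.≤-reflexive (sym (ℕ.*-distribʳ-+ (suc s) k l))))

forEachRate : Program → ℕ
forEachRate body = 3 + guardTime + (guardTime + cost (body ⨾ advance))

forEach-linear : ∀ {ℓ s} body → ℓ ≤ s → Linear s (forEachRate body) (Times.forEachTime ℓ body)
forEach-linear body ℓ≤s = linear (affine≤ (3 + guardTime) (guardTime + cost (body ⨾ advance)) ℓ≤s)

iterationRate : ℕ
iterationRate = forEachRate lastBody + (3 + (forEachRate scanBody + (3 + (forEachRate weighBody +
  (cost chooseDirection + (3 + (forEachRate limitBody + forEachRate moveBody)))))))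

iteration-linear : ∀ ℓ → Linear ℓ iterationRate (Times.iterationTime ℓ)
iteration-linear ℓ = each lastBody ⊕ constant 3 ⊕ each scanBody ⊕ constant 3 ⊕ each weighBody ⊕
  constant (cost chooseDirection) ⊕ constant 3 ⊕ each limitBody ⊕ each moveBody
  where
  each : ∀ body → Linear ℓ (forEachRate body) (Times.forEachTime ℓ body)
  each body = forEach-linear {ℓ} body ℕ.≤-refl

stepRate programRate : ℕ
stepRate    = guardTime + (iterationRate + cost nextIteration)
-- The factor 2 comes from `ℓ * suc ℓ = ℓ + ℓ * ℓ`, where each summand is at most `s`.
programRate = forEachRate scaleBody + ((3 + (guardTime + stepRate * 2)) + forEachRate roundBody)

program-linear : ∀ {ℓ s} → ℓ ≤ s → ℓ * ℓ ≤ s → Linear s programRate (Times.programTime ℓ)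
program-linear {ℓ} {s} ℓ≤s ℓℓ≤s =
  forEach-linear {ℓ} scaleBody ℓ≤s ⊕
  (constant 3 ⊕ constant guardTime ⊕ linear {s} {stepRate * 2} steps) ⊕
  forEach-linear {ℓ} roundBody ℓ≤s
  where
  open ℕ.≤-Reasoning
  stepTime = guardTime + (Times.iterationTime ℓ + cost nextIteration)
  step : Linear ℓ stepRate stepTime
  step = constant guardTime ⊕ iteration-linear ℓ ⊕ constant (cost nextIteration)
  ℓ*suc : ℓ * suc ℓ ≤ 2 * suc s
  ℓ*suc = begin
    ℓ * suc ℓ       ≡⟨ ℕ.*-suc ℓ ℓ ⟩
    ℓ + ℓ * ℓ       ≤⟨ ℕ.+-mono-≤ (ℕ.m≤n⇒m≤1+n ℓ≤s) (ℕ.m≤n⇒m≤1+n ℓℓ≤s) ⟩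
    suc s + suc s   ≡⟨ cong (λ y → suc s + y) (ℕ.+-identityʳ (suc s)) ⟨
    2 * suc s       ∎
  rearrange : ∀ r → ℓ * (r * suc ℓ) ≤ r * 2 * suc s
  rearrange r = begin
    ℓ * (r * suc ℓ)     ≡⟨ ℕ.*-assoc ℓ r (suc ℓ) ⟨
    ℓ * r * suc ℓ       ≡⟨ cong (_* suc ℓ) (ℕ.*-comm ℓ r) ⟩
    r * ℓ * suc ℓ       ≡⟨ ℕ.*-assoc r ℓ (suc ℓ) ⟩
    r * (ℓ * suc ℓ)     ≤⟨ ℕ.*-monoʳ-≤ r ℓ*suc ⟩
    r * (2 * suc s)     ≡⟨ ℕ.*-assoc r 2 (suc s) ⟨
    r * 2 * suc s       ∎
  steps : ℓ * stepTime ≤ stepRate * 2 * suc s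
  steps = ℕ.≤-trans (ℕ.*-monoʳ-≤ ℓ (bound step)) (rearrange stepRate)

-- Sums over Fin

∑-shift : ∀ f n → ∑ f (suc n) ≡ f 0 +ℚ ∑ (f ∘ suc) n
∑-shift f zero    = ℚ.+-comm 0ℚ (f 0)
∑-shift f (suc n) = trans (cong (_+ℚ f (suc n)) (∑-shift f n)) (ℚ.+-assoc (f 0) (∑ (f ∘ suc) n) (f (suc n)))

sum≡∑ : ∀ {n} {h : Fin n → ℚ} (f : ℕ → ℚ) → (∀ i → h i ≡ f (toℕ i)) → sumℚ h ≡ ∑ f n
sum≡∑ {zero}  f eq = refl
sum≡∑ {suc n} f eq = trans (cong₂ _+ℚ_ (eq Fin.zero) (sum≡∑ (f ∘ suc) (eq ∘ Fin.suc))) (sym (∑-shift f n))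

padded-< : ∀ {A : Set} {n p} (default : A) (f : Fin n → A) (p<n : p < n) → padded default f p ≡ f (fromℕ< p<n)
padded-< {n = n} {p} default f p<n with p ℕ.<? n
... | yes _  = refl
... | no p≮n = contradiction p<n p≮n

padded-toℕ : ∀ {A : Set} {n} (default : A) (f : Fin n → A) i → padded default f (toℕ i) ≡ f i
padded-toℕ default f i = trans (padded-< default f (Fin.toℕ<n i)) (cong f (Fin.fromℕ<-toℕ i (Fin.toℕ<n i)))

padded-elim : ∀ {A : Set} {n} (P : A → Set) {default : A} {f : Fin n → A} → P default → (∀ i → P (f i)) →
              ∀ p → P (padded default f p)
padded-elim {n = n} P base step p with p ℕ.<? n
... | yes p<n = step (fromℕ< p<n)
... | no  _   = base

-- Circular intervals

when : Bool → ℚ → ℚ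
when b x = if b then x else 0ℚ

below : ℕ → (ℕ → ℚ) → ℕ → ℚ
below m f p = when (does (p ℕ.<? m)) (f p)

below-yes : ∀ {m p} f → p < m → below m f p ≡ f p
below-yes {m} {p} f p<m = cong (λ b → when b (f p)) (dec-true (p ℕ.<? m) p<m)

below-no : ∀ {m p} f → ¬ p < m → below m f p ≡ 0ℚ
below-no {m} {p} f p≮m = cong (λ b → when b (f p)) (dec-false (p ℕ.<? m) p≮m)

∑-below : ∀ f {m n} → m ≤ n → ∑ (below m f) n ≡ ∑ f m
∑-below f {m} {n} m≤n with m ℕ.≟ n
... | yes refl = ∑-cong m (below-yes f)
∑-below f {m} {zero}  m≤n | no m≢n = contradiction (ℕ.n≤0⇒n≡0 m≤n) m≢n
∑-below f {m} {suc n} m≤n | no m≢n = trans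
  (cong₂ _+ℚ_ (∑-below f m≤n′) (below-no f (ℕ.≤⇒≯ m≤n′))) (ℚ.+-identityʳ (∑ f m))
  where m≤n′ = ℕ.≤-pred (ℕ.≤∧≢⇒< m≤n m≢n)

∑-minus : ∀ {f g h} n → (∀ {p} → p < n → h p ≡ f p -ℚ g p) → ∑ h n ≡ ∑ f n -ℚ ∑ g n
∑-minus {f} {g} n eq = trans
  (∑-linear {f = f} {g} -1ℚ n λ {p} p<n → trans (eq p<n) (solve 2 (λ a b → a :- b := a :+ con -1ℚ :* b) refl (f p) (g p)))
  (solve 2 (λ a b → a :+ con -1ℚ :* b := a :- b) refl (∑ f n) (∑ g n))

∑-plus : ∀ {f g h} n → (∀ {p} → p < n → h p ≡ f p +ℚ g p) → ∑ h n ≡ ∑ f n +ℚ ∑ g n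
∑-plus {f} {g} n eq = trans
  (∑-linear {f = f} {g} 1ℚ n λ {p} p<n → trans (eq p<n) (cong (f p +ℚ_) (sym (ℚ.*-identityˡ (g p)))))
  (cong (∑ f n +ℚ_) (ℚ.*-identityˡ (∑ g n)))

between : ∀ f {a b} p → a ≤ b →
  when (does (a ℕ.≤? p) ∧ does (p ℕ.≤? b)) (f p) ≡ below (suc b) f p -ℚ below a f p
between f {a} {b} p a≤b with a ℕ.≤? p | p ℕ.≤? b
... | yes a≤p | yes p≤b = trans
        (cong₂ (λ x y → when (x ∧ y) (f p)) (dec-true (a ℕ.≤? p) a≤p) (dec-true (p ℕ.≤? b) p≤b))
        (trans (solve 1 (λ x → x := x :- con 0ℚ) refl (f p))
          (sym (cong₂ _-ℚ_ (below-yes f (s≤s p≤b)) (below-no f (ℕ.≤⇒≯ a≤p)))))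
... | yes a≤p | no p≰b = trans
        (cong₂ (λ x y → when (x ∧ y) (f p)) (dec-true (a ℕ.≤? p) a≤p) (dec-false (p ℕ.≤? b) p≰b))
        (sym (cong₂ _-ℚ_ (below-no f λ p<1+b → p≰b (ℕ.≤-pred p<1+b)) (below-no f (ℕ.≤⇒≯ a≤p))))
... | no a≰p | _ = trans
        (cong (λ x → when (x ∧ does (p ℕ.≤? b)) (f p)) (dec-false (a ℕ.≤? p) a≰p))
        (trans (sym (ℚ.+-inverseʳ (f p)))
          (sym (cong₂ _-ℚ_ (below-yes f (ℕ.<-trans (ℕ.≰⇒> a≰p) (s≤s a≤b))) (below-yes f (ℕ.≰⇒> a≰p)))))

outside : ∀ f {a b} p → b < a →
  when (does (a ℕ.≤? p) ∨ does (p ℕ.≤? b)) (f p) ≡ (f p -ℚ below a f p) +ℚ below (suc b) f p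
outside f {a} {b} p b<a with a ℕ.≤? p | p ℕ.≤? b
... | yes a≤p | yes p≤b = contradiction (ℕ.≤-trans a≤p p≤b) (ℕ.<⇒≱ b<a)
... | yes a≤p | no p≰b = trans
        (cong (λ x → when (x ∨ does (p ℕ.≤? b)) (f p)) (dec-true (a ℕ.≤? p) a≤p))
        (trans (solve 1 (λ x → x := (x :- con 0ℚ) :+ con 0ℚ) refl (f p))
          (sym (cong₂ (λ x y → (f p -ℚ x) +ℚ y) (below-no f (ℕ.≤⇒≯ a≤p)) (below-no f λ p<1+b → p≰b (ℕ.≤-pred p<1+b)))))
... | no a≰p | yes p≤b = trans
        (cong₂ (λ x y → when (x ∨ y) (f p)) (dec-false (a ℕ.≤? p) a≰p) (dec-true (p ℕ.≤? b) p≤b))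
        (trans (solve 1 (λ x → x := (x :- x) :+ x) refl (f p))
          (sym (cong₂ (λ x y → (f p -ℚ x) +ℚ y) (below-yes f (ℕ.≰⇒> a≰p)) (below-yes f (s≤s p≤b)))))
... | no a≰p | no p≰b = trans
        (cong₂ (λ x y → when (x ∨ y) (f p)) (dec-false (a ℕ.≤? p) a≰p) (dec-false (p ℕ.≤? b) p≰b))
        (trans (solve 1 (λ x → con 0ℚ := (x :- x) :+ con 0ℚ) refl (f p))
          (sym (cong₂ (λ x y → (f p -ℚ x) +ℚ y) (below-yes f (ℕ.≰⇒> a≰p)) (below-no f λ p<1+b → p≰b (ℕ.≤-pred p<1+b)))))

module _ {ℓ : ℕ} (f : ℕ → ℚ) (h : Fin ℓ → ℚ) (h≡ : ∀ k → h k ≡ f (toℕ k)) {i j : Fin ℓ} where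
  private
    a = toℕ i
    b = toℕ j

    -- Abstracting the outcome of the comparison as `t` resolves the conditional inside `arc` for
    -- either case.
    entry : ∀ {t} k → does (a ℕ.≤? b) ≡ t → when (Vec.lookup (arc i j) k) (h k) ≡
      when (if t then does (a ℕ.≤? toℕ k) ∧ does (toℕ k ℕ.≤? b)
                 else does (a ℕ.≤? toℕ k) ∨ does (toℕ k ℕ.≤? b)) (f (toℕ k))
    entry k refl = cong₂ when (Vec.lookup∘tabulate _ k) (h≡ k)

  ∑-arc-≤ : a ≤ b → h ⟨ arc i j ⟩ ≡ ∑ f (suc b) -ℚ ∑ f a
  ∑-arc-≤ a≤b = trans
    (sum≡∑ (λ p → when (does (a ℕ.≤? p) ∧ does (p ℕ.≤? b)) (f p)) λ k → entry k (dec-true (a ℕ.≤? b) a≤b))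
    (trans (∑-minus ℓ λ {p} _ → between f p a≤b)
      (cong₂ _-ℚ_ (∑-below f (Fin.toℕ<n j)) (∑-below f (ℕ.<⇒≤ (Fin.toℕ<n i)))))

  ∑-arc-> : ¬ a ≤ b → h ⟨ arc i j ⟩ ≡ (∑ f ℓ -ℚ ∑ f a) +ℚ ∑ f (suc b)
  ∑-arc-> a≰b = trans
    (sum≡∑ (λ p → when (does (a ℕ.≤? p) ∨ does (p ℕ.≤? b)) (f p)) λ k → entry k (dec-false (a ℕ.≤? b) a≰b))
    (trans (∑-plus ℓ λ {p} _ → outside f p (ℕ.≰⇒> a≰b))
      (cong₂ _+ℚ_
        (trans (∑-minus {f = f} {below a f} ℓ λ _ → refl)
          (cong (λ x → ∑ f ℓ -ℚ x) (∑-below f (ℕ.<⇒≤ (Fin.toℕ<n i)))))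
        (∑-below f (Fin.toℕ<n j))))

maximum-≤ : ∀ {xs B} → 0ℚ ≤ℚ B → All (_≤ℚ B) xs → maximum xs ≤ℚ B
maximum-≤ 0≤B []         = 0≤B
maximum-≤ 0≤B (x≤ ∷ xs≤) = ℚ.⊔-lub x≤ (maximum-≤ 0≤B xs≤)

≤maximum : ∀ {n} (f : Fin n → ℚ) i → f i ≤ℚ maximum (tabulate f)
≤maximum f Fin.zero    = ℚ.p≤p⊔q (f Fin.zero) (maximum (tabulate (f ∘ Fin.suc)))
≤maximum f (Fin.suc i) = ℚ.≤-trans (≤maximum (f ∘ Fin.suc) i) (ℚ.p≤q⊔p (f Fin.zero) (maximum (tabulate (f ∘ Fin.suc))))

0≤maximum : ∀ xs → 0ℚ ≤ℚ maximum xs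
0≤maximum []       = ℚ.≤-refl
0≤maximum (x ∷ xs) = ℚ.≤-trans (0≤maximum xs) (ℚ.p≤q⊔p x (maximum xs))

-- The theorem

0≤double : ∀ {D} → 0ℚ ≤ℚ D → 0ℚ ≤ℚ (+ 2 / 1) *ℚ D
0≤double 0≤D = 0≤* (ℚ.nonNegative⁻¹ (+ 2 / 1)) 0≤D

∣-∣≤double : ∀ {x y D} → ℚ.∣ x ∣ ≤ℚ D → ℚ.∣ y ∣ ≤ℚ D → ℚ.∣ x -ℚ y ∣ ≤ℚ (+ 2 / 1) *ℚ D
∣-∣≤double {x} {y} {D} x≤ y≤ = ℚ.≤-trans (ℚ.∣p-q∣≤∣p∣+∣q∣ x y) (ℚ.≤-trans (ℚ.+-mono-≤ x≤ y≤)
  (ℚ.≤-reflexive (solve 1 (λ D → D :+ D := con (+ 2 / 1) :* D) refl D)))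

n≤sum : ∀ {n} (f : Fin n → ℕ) → (∀ i → 0 < f i) → n ≤ sumℕ f
n≤sum {zero}  f pos = z≤n
n≤sum {suc n} f pos = ℕ.+-mono-≤ (pos Fin.zero) (n≤sum (f ∘ Fin.suc) (pos ∘ Fin.suc))

-- `K` stays a variable with two lower bounds, so no closed numeral for the rate has to be computed.
-- The bound 3 serves the encoding length, `programRate` the running time.
module Instance (K : ℕ) (3≤K : 3 ≤ K) (rate≤K : programRate ≤ K)
                (I : WPCS) (nonInterleaving : NonInterleaving (WPCS.S I)) (c : Fin (WPCS.ℓ I) → ℚ) where

  open WPCS I
  module Y = FractionalSelection fractional

  cls₀ : ℕ → ℕ
  cls₀ = padded 0 (λ j → toℕ (classOf j))

  d₀ y₀ c₀ : ℕ → ℚ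
  d₀ = padded 0ℚ d
  y₀ = padded 0ℚ y
  c₀ = padded 0ℚ c

  cls₀-toℕ : ∀ i → cls₀ (toℕ i) ≡ toℕ (classOf i)
  cls₀-toℕ = padded-toℕ 0 (λ j → toℕ (classOf j))

  demand-toℕ : ∀ i → d₀ (cls₀ (toℕ i)) ≡ d (classOf i)
  demand-toℕ i = trans (cong d₀ (cls₀-toℕ i)) (padded-toℕ 0ℚ d (classOf i))

  atFin : ∀ {P : ℕ → Set} → (∀ i → P (toℕ i)) → ∀ {p} → p < ℓ → P p
  atFin {P} f p<ℓ = subst P (Fin.toℕ-fromℕ< p<ℓ) (f (fromℕ< p<ℓ))

  own-class : ∀ i → i ∈ S (classOf i)
  own-class i = proj₁ (proj₂ (cover i))

  noncross : ∀ R → Supports.NonCrossing ℓ cls₀ R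
  noncross R {a} {b} {a′} {b′} a<b b<a′ a′<b′ b′<ℓ a~a′ b~b′ = case Fin._≟_ (classOf i) (classOf j) of λ where
      (yes eq) → trans (at a<ℓ) (trans (cong toℕ eq) (sym (at b<ℓ)))
      (no neq) → contradiction
        (i , i′ , j , j′ , own-class i ,
          subst (λ k → i′ ∈ S k) (sym (Fin.toℕ-injective (trans (sym (at a<ℓ)) (trans a~a′ (at a′<ℓ))))) (own-class i′) ,
          own-class j ,
          subst (λ k → j′ ∈ S k) (sym (Fin.toℕ-injective (trans (sym (at b<ℓ)) (trans b~b′ (at b′<ℓ))))) (own-class j′) ,
          inj₁ ( subst₂ _<_ (sym (Fin.toℕ-fromℕ< a<ℓ)) (sym (Fin.toℕ-fromℕ< b<ℓ)) a<b
               , subst₂ _<_ (sym (Fin.toℕ-fromℕ< b<ℓ)) (sym (Fin.toℕ-fromℕ< a′<ℓ)) b<a′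
               , subst₂ _<_ (sym (Fin.toℕ-fromℕ< a′<ℓ)) (sym (Fin.toℕ-fromℕ< b′<ℓ)) a′<b′))
        (nonInterleaving (classOf i) (classOf j) neq)
    where
    a′<ℓ = ℕ.<-trans a′<b′ b′<ℓ
    b<ℓ  = ℕ.<-trans b<a′ a′<ℓ
    a<ℓ  = ℕ.<-trans a<b b<ℓ
    i  = fromℕ< a<ℓ
    j  = fromℕ< b<ℓ
    i′ = fromℕ< a′<ℓ
    j′ = fromℕ< b′<ℓ
    at : ∀ {p} (p<ℓ : p < ℓ) → cls₀ p ≡ toℕ (classOf (fromℕ< p<ℓ))
    at = padded-< 0 (λ j → toℕ (classOf j))

  lookup-class : ∀ k i x → when (Vec.lookup (S k) i) x ≡ indicator (toℕ k) (toℕ (classOf i)) *ℚ x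
  lookup-class k i x with Vec.lookup (S k) i in eq
  ... | true  = sym (trans
          (cong (_*ℚ x) (indicator-yes (cong toℕ (sym (proj₂ (proj₂ (cover i)) (Vec.lookup⇒[]= i (S k) eq))))))
          (ℚ.*-identityˡ x))
  ... | false = sym (trans (cong (_*ℚ x) (indicator-no λ k≡ → contradiction
          (trans (sym eq) (Vec.[]=⇒lookup (subst (λ k → i ∈ S k) (sym (Fin.toℕ-injective k≡)) (own-class i)))) λ ()))
          (ℚ.*-zeroˡ x))

  class-total : ∀ (q : Fin ℓ → ℚ) (x : ℕ → ℚ) → (∀ i → q i ≡ x (toℕ i)) → ∀ k →
    q ⟨ S k ⟩ ≡ ∑ (λ p → indicator (toℕ k) (cls₀ p) *ℚ x p) ℓ
  class-total q x q≡ k = sum≡∑ (λ p → indicator (toℕ k) (cls₀ p) *ℚ x p) λ i →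
    trans (lookup-class k i (q i)) (cong₂ (λ a b → indicator (toℕ k) a *ℚ b) (sym (cls₀-toℕ i)) (q≡ i))

  M : ℕ
  -- A load uses one demand and one entry of `y`, a cost per load one demand and one entry of `c`;
  -- either product of heights divides `M`. The logarithm of `M` is at most the sum of the encoding
  -- lengths.
  M = ∏ (height ∘ d) * (∏ (height ∘ y) * ∏ (height ∘ c))

  bitsM N W : ℕ
  bitsM = sumℕ (bitsℚ ∘ d) + (sumℕ (bitsℚ ∘ y) + sumℕ (bitsℚ ∘ c))
  N     = bitLength I c
  W     = K * N

  M≤2^ : M ≤ 2 ^ bitsM
  M≤2^ = ℕ.≤-trans
    (ℕ.*-mono-≤ (∏≤2^ (height ∘ d) (bitsℚ ∘ d) (height≤ ∘ d))
      (ℕ.*-mono-≤ (∏≤2^ (height ∘ y) (bitsℚ ∘ y) (height≤ ∘ y)) (∏≤2^ (height ∘ c) (bitsℚ ∘ c) (height≤ ∘ c))))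
    (ℕ.≤-reflexive (sym (trans (ℕ.^-distribˡ-+-* 2 (sumℕ (bitsℚ ∘ d)) _)
      (cong (2 ^ sumℕ (bitsℚ ∘ d) *_) (ℕ.^-distribˡ-+-* 2 (sumℕ (bitsℚ ∘ y)) _)))))

  -- The 2 is paid for by the encodings of `ℓ` and `m`, and `ℓ` by the class indices; each takes at
  -- least one bit.
  2+ℓ+bitsM≤N : 2 + ℓ + bitsM ≤ N
  2+ℓ+bitsM≤N = begin
    2 + ℓ + (D + (Yᵇ + C))         ≡⟨ trans (sym (ℕ.+-assoc (2 + ℓ) D (Yᵇ + C))) (sym (ℕ.+-assoc (2 + ℓ + D) Yᵇ C)) ⟩
    2 + ℓ + D + Yᵇ + C             ≤⟨ ℕ.+-monoˡ-≤ C (ℕ.+-monoˡ-≤ Yᵇ (ℕ.+-monoˡ-≤ D (ℕ.+-mono-≤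
                                      (ℕ.+-mono-≤ {1} {bitsℕ ℓ} {1} (s≤s z≤n) (s≤s z≤n))
                                      (n≤sum (λ i → bitsℕ (toℕ (classOf i))) λ i → s≤s z≤n)))) ⟩
    N                              ∎
    where
    open ℕ.≤-Reasoning
    D  = sumℕ (bitsℚ ∘ d)
    Yᵇ = sumℕ (bitsℚ ∘ y)
    C  = sumℕ (bitsℚ ∘ c)

  3N≤W : 3 * N ≤ W
  3N≤W = ℕ.*-monoˡ-≤ N 3≤K

  ℓ≤N : ℓ ≤ N
  ℓ≤N = ℕ.≤-trans (ℕ.≤-trans (ℕ.m≤n+m ℓ 2) (ℕ.m≤m+n (2 + ℓ) bitsM)) 2+ℓ+bitsM≤N

  1≤N : 1 ≤ N
  1≤N = ℕ.≤-trans (s≤s z≤n) 2+ℓ+bitsM≤N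

  -- `bitsM` occurs three times: twice for the numerator, through the magnitude bound and through
  -- the denominator, and once for the denominator itself. This is the origin of `3 ≤ K`.
  bits-room : 3 + (suc ℓ + bitsM + bitsM) + bitsM ≤ W
  bits-room = ℕ.≤-trans (begin
    3 + (suc ℓ + bitsM + bitsM) + bitsM     ≤⟨ ℕ.+-monoˡ-≤ bitsM (ℕ.+-monoˡ-≤ bitsM (ℕ.m≤m+n (4 + ℓ + bitsM) (2 + ℓ + ℓ))) ⟩
    4 + ℓ + bitsM + (2 + ℓ + ℓ) + bitsM + bitsM
                                            ≡⟨ ℕ-Solver.solve 2 (λ l b → ℕ-Solver.con 4 ℕ-Solver.:+ l ℕ-Solver.:+ b ℕ-Solver.:+ (ℕ-Solver.con 2 ℕ-Solver.:+ l ℕ-Solver.:+ l) ℕ-Solver.:+ b ℕ-Solver.:+ b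
                                                 ℕ-Solver.:= ℕ-Solver.con 3 ℕ-Solver.:* (ℕ-Solver.con 2 ℕ-Solver.:+ l ℕ-Solver.:+ b)) refl ℓ bitsM ⟩
    3 * (2 + ℓ + bitsM)                     ≤⟨ ℕ.*-monoʳ-≤ 3 2+ℓ+bitsM≤N ⟩
    3 * N                                   ∎) 3N≤W
    where
    open ℕ.≤-Reasoning

  ℓ-room : 5 + ℓ ≤ W
  ℓ-room = ℕ.≤-trans (begin
    5 + ℓ                       ≤⟨ ℕ.m≤m+n (5 + ℓ) (1 + (ℓ + ℓ)) ⟩
    5 + ℓ + (1 + (ℓ + ℓ))       ≡⟨ ℕ-Solver.solve 1 (λ l → ℕ-Solver.con 5 ℕ-Solver.:+ l ℕ-Solver.:+ (ℕ-Solver.con 1 ℕ-Solver.:+ (l ℕ-Solver.:+ l)) ℕ-Solver.:= ℕ-Solver.con 3 ℕ-Solver.:* (ℕ-Solver.con 2 ℕ-Solver.:+ l)) refl ℓ ⟩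
    3 * (2 + ℓ)                 ≤⟨ ℕ.*-monoʳ-≤ 3 (ℕ.≤-trans (ℕ.m≤m+n (2 + ℓ) bitsM) 2+ℓ+bitsM≤N) ⟩
    3 * N                       ∎) 3N≤W
    where
    open ℕ.≤-Reasoning

  0<M : 0 < M
  0<M = ℕ.*-mono-≤ {1} {_} {1} (∏-pos (height ∘ d) (height-pos ∘ d))
    (ℕ.*-mono-≤ {1} {_} {1} (∏-pos (height ∘ y) (height-pos ∘ y)) (∏-pos (height ∘ c) (height-pos ∘ c)))

  hypotheses : Hypotheses ℓ W M cls₀ d₀ y₀ c₀
  hypotheses = record
    { noncross = noncross
    ; 0≤d      = padded-elim (0ℚ ≤ℚ_) ℚ.≤-refl 0≤d
    ; 0≤y      = λ {p} _ → padded-elim (0ℚ ≤ℚ_) ℚ.≤-refl Y.0≤y p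
    ; sums     = atFin λ i → subst (λ k → ∑ (λ p → indicator k (cls₀ p) *ℚ y₀ p) ℓ ≡ 1ℚ) (sym (cls₀-toℕ i))
        (trans (sym (class-total y y₀ (λ i → sym (padded-toℕ 0ℚ y i)) (classOf i))) (Y.sums (classOf i)))
    ; dy∣M     = atFin λ i → subst₂ (λ a b → height a * height b ∣ M) (sym (demand-toℕ i)) (sym (padded-toℕ 0ℚ y i))
        (*-pres-∣ (∏-∣ (height ∘ d) (classOf i)) (∣-trans (∏-∣ (height ∘ y) i) (m∣m*n (∏ (height ∘ c)))))
    ; cd∣M     = atFin λ i → subst₂ (λ a b → height a * height b ∣ M) (sym (padded-toℕ 0ℚ c i)) (sym (demand-toℕ i))
        (subst (_∣ M) (ℕ.*-comm (height (d (classOf i))) (height (c i)))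
          (*-pres-∣ (∏-∣ (height ∘ d) (classOf i)) (∣-trans (∏-∣ (height ∘ c) i) (n∣m*n (∏ (height ∘ y))))))
    ; 0<M      = 0<M
    ; room     = ℓ-room
    ; bits     = λ q lat bound → ℕ.≤-trans
        (small⇒bits {b = suc ℓ + bitsM} q 0<M M≤2^ B≤2^ lat bound) bits-room
    }
    where
    B≤2^ : suc ℓ * M ≤ 2 ^ (suc ℓ + bitsM)
    B≤2^ = ℕ.≤-trans (ℕ.*-mono-≤ (n≤2^n (suc ℓ)) M≤2^) (ℕ.≤-reflexive (sym (ℕ.^-distribˡ-+-* 2 (suc ℓ) bitsM)))

  open Correct ℓ W M cls₀ d₀ y₀ c₀ hypotheses

  module _ {x : ℕ → ℚ} (O : Outcome x) where
    open Outcome O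

    private
      z : Fin ℓ → ℚ
      z i = x (toℕ i)

      D : ℚ
      D = dmax I

      0≤D : 0ℚ ≤ℚ D
      0≤D = 0≤maximum (tabulate d)

      A : (ℕ → ℚ) → ℕ → ℚ
      A q = ∑ (λ p → d₀ (cls₀ p) *ℚ q p)

      Δ : ℕ → ℚ
      Δ j = A y₀ j -ℚ A x j

      -- The full prefix needs a separate argument: there the total load is unchanged, so the
      -- deviation is 0.
      ∣Δ∣≤ : ∀ {j} → j ≤ ℓ → ℚ.∣ Δ j ∣ ≤ℚ D
      ∣Δ∣≤ {j} j≤ℓ = case j ℕ.≟ ℓ of λ where
        (yes refl) → subst (λ a → ℚ.∣ a ∣ ≤ℚ D) (sym (trans (cong (λ a → A y₀ ℓ -ℚ a) total) (ℚ.+-inverseʳ (A y₀ ℓ)))) 0≤D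
        (no j≢ℓ)   → prefix 0≤D (atFin λ i → subst (_≤ℚ D) (sym (demand-toℕ i)) (≤maximum d (classOf i))) (ℕ.≤∧≢⇒< j≤ℓ j≢ℓ)

      load-toℕ : ∀ (q : Fin ℓ → ℚ) (f : ℕ → ℚ) → (∀ i → q i ≡ f (toℕ i)) → ∀ i →
                 load I q i ≡ d₀ (cls₀ (toℕ i)) *ℚ f (toℕ i)
      load-toℕ q f q≡ i = cong₂ _*ℚ_ (sym (demand-toℕ i)) (q≡ i)

      y≡y₀ : ∀ i → y i ≡ y₀ (toℕ i)
      y≡y₀ i = sym (padded-toℕ 0ℚ y i)

    selection : IntegralSelection S z
    selection = record
      { binary = λ i → binary (Fin.toℕ<n i)
      ; sums   = λ k → let (i , i∈) = IsPartition.nonempty isPartition k in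
          trans (class-total z x (λ _ → refl) k)
            (subst (λ k → ∑ (λ p → indicator k (cls₀ p) *ℚ x p) ℓ ≡ 1ℚ)
              (trans (cls₀-toℕ i) (cong toℕ (proj₂ (proj₂ (cover i)) i∈)))
              (class-sum (Fin.toℕ<n i)))
      }

    -- In both cases the difference of loads is `Δ` at the successor of `j` minus `Δ` at `i`; for a
    -- wrapping arc the two total loads cancel.
    arc-discrepancy : ∀ i j → discrepancyOn I y z (arc i j) ≤ℚ (+ 2 / 1) *ℚ D
    arc-discrepancy i j = case (toℕ i ℕ.≤? toℕ j) of λ where
        (yes i≤j) → subst (λ a → ℚ.∣ a ∣ ≤ℚ (+ 2 / 1) *ℚ D)
          (sym (trans (cong₂ _-ℚ_ (∑-arc-≤ (F y₀) (load I y) (load-toℕ y y₀ y≡y₀) i≤j) (∑-arc-≤ (F x) (load I z) (load-toℕ z x λ _ → refl) i≤j))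
            (solve 4 (λ a b a′ b′ → (a :- b) :- (a′ :- b′) := (a :- a′) :- (b :- b′)) refl
              (A y₀ (suc (toℕ j))) (A y₀ (toℕ i)) (A x (suc (toℕ j))) (A x (toℕ i)))))
          (∣-∣≤double (∣Δ∣≤ (Fin.toℕ<n j)) (∣Δ∣≤ (ℕ.<⇒≤ (Fin.toℕ<n i))))
        (no i≰j) → subst (λ a → ℚ.∣ a ∣ ≤ℚ (+ 2 / 1) *ℚ D)
          (sym (trans (cong₂ _-ℚ_ (∑-arc-> (F y₀) (load I y) (load-toℕ y y₀ y≡y₀) i≰j) (∑-arc-> (F x) (load I z) (load-toℕ z x λ _ → refl) i≰j))
            (trans (cong (λ t → ((A y₀ ℓ -ℚ A y₀ (toℕ i)) +ℚ A y₀ (suc (toℕ j))) -ℚ ((t -ℚ A x (toℕ i)) +ℚ A x (suc (toℕ j)))) total)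
              (solve 5 (λ t a b a′ b′ → ((t :- b) :+ a) :- ((t :- b′) :+ a′) := (a :- a′) :- (b :- b′)) refl
                (A y₀ ℓ) (A y₀ (suc (toℕ j))) (A y₀ (toℕ i)) (A x (suc (toℕ j))) (A x (toℕ i))))))
          (∣-∣≤double (∣Δ∣≤ (Fin.toℕ<n j)) (∣Δ∣≤ (ℕ.<⇒≤ (Fin.toℕ<n i))))
      where
      F : (ℕ → ℚ) → ℕ → ℚ
      F q p = d₀ (cls₀ p) *ℚ q p

    empty-discrepancy : discrepancyOn I y z Subset.⊥ ≤ℚ (+ 2 / 1) *ℚ D
    empty-discrepancy = subst (λ a → ℚ.∣ a ∣ ≤ℚ (+ 2 / 1) *ℚ D)
      (sym (cong₂ _-ℚ_ (empty (load I y)) (empty (load I z)))) (0≤double 0≤D)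
      where
      empty : ∀ (q : Fin ℓ → ℚ) → q ⟨ Subset.⊥ ⟩ ≡ 0ℚ
      empty q = trans (sum≡∑ (λ _ → 0ℚ) λ i → cong (λ b → when b (q i)) (Vec.lookup-replicate i false))
        (∑-zero ℓ λ _ → refl)

    small-discrepancy : discrepancy I y z ≤ℚ (+ 2 / 1) *ℚ D
    small-discrepancy = maximum-≤ (0≤double 0≤D) (All.map⁺ {f = discrepancyOn I y z} intervals)
      where
      intervals : All (λ U → discrepancyOn I y z U ≤ℚ (+ 2 / 1) *ℚ D) (circularIntervals ℓ)
      intervals = empty-discrepancy ∷ All.cartesianProductWith⁺ (setoid (Fin ℓ)) (setoid (Fin ℓ))
        arc (allFin ℓ) (allFin ℓ) λ {i} {j} _ _ → arc-discrepancy i j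

    cheap : c · z ≤ℚ c · y
    cheap = subst₂ _≤ℚ_
      (sym (sum≡∑ (λ p → c₀ p *ℚ x p) λ i → cong (_*ℚ z i) (sym (padded-toℕ 0ℚ c i))))
      (sym (sum≡∑ (λ p → c₀ p *ℚ y₀ p) λ i → cong₂ _*ℚ_ (sym (padded-toℕ 0ℚ c i)) (y≡y₀ i)))
      cheaper

  run : Reaches W (Times.programTime ℓ) program (inputMemory I c) (Rounded ℓ)
  run = program-rule refl refl refl refl refl

  time-bound : Times.programTime ℓ ≤ K * suc (ℓ * N)
  time-bound = ℕ.≤-trans
    (Linear.bound (program-linear {ℓ} {ℓ * N}
      (subst (_≤ ℓ * N) (ℕ.*-identityʳ ℓ) (ℕ.*-monoʳ-≤ ℓ 1≤N)) (ℕ.*-monoʳ-≤ ℓ ℓ≤N)))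
    (ℕ.*-monoˡ-≤ (suc (ℓ * N)) rate≤K)

  computes : Reaches W (Times.programTime ℓ) program (inputMemory I c) (Rounded ℓ) →
    Σ[ t ∈ ℕ ] Σ[ σ ∈ Memory ]
      ((W ⊢ program , inputMemory I c ⇓[ t ] σ) ×
       t ≤ K * suc (ℓ * N) ×
       IntegralSelection S (output σ) ×
       discrepancy I y (output σ) ≤ℚ (+ 2 / 1) *ℚ dmax I ×
       c · output σ ≤ℚ c · y)
  computes (reaches {t} {σ} run time≤ (state , read)) =
    t , σ , run , ℕ.≤-trans time≤ time-bound , selection O , small-discrepancy O , cheap O
    where
    O : Outcome (rat σ 3)
    O = outcome state read

computation : ∀ K → 3 ≤ K → programRate ≤ K →
  (I : WPCS) → NonInterleaving (WPCS.S I) → (c : Fin (WPCS.ℓ I) → ℚ) →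
  Σ[ t ∈ ℕ ] Σ[ σ ∈ Memory ]
    ((K * bitLength I c ⊢ program , inputMemory I c ⇓[ t ] σ) ×
     t ≤ K * suc (WPCS.ℓ I * bitLength I c) ×
     IntegralSelection (WPCS.S I) (output σ) ×
     discrepancy I (WPCS.y I) (output σ) ≤ℚ (+ 2 / 1) *ℚ dmax I ×
     c · output σ ≤ℚ c · WPCS.y I)
computation K 3≤K rate≤K I ni c = computes run
  where open Instance K 3≤K rate≤K I ni c

mainTheorem9 : ((I : WPCS) → NonInterleaving (WPCS.S I) → (c : Fin (WPCS.ℓ I) → ℚ) →
    Σ[ z ∈ (Fin (WPCS.ℓ I) → ℚ) ]
    (IntegralSelection (WPCS.S I) z ×
    discrepancy I (WPCS.y I) z ≤ℚ (+ 2 / 1) *ℚ dmax I ×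
    c · z ≤ℚ c · WPCS.y I))
    ×
    (Σ[ p ∈ Program ] Σ[ K ∈ ℕ ]
    ((I : WPCS) → NonInterleaving (WPCS.S I) → (c : Fin (WPCS.ℓ I) → ℚ) →
    Σ[ t ∈ ℕ ] Σ[ σ ∈ Memory ]
    ((K * bitLength I c ⊢ p , inputMemory I c ⇓[ t ] σ) ×
    t ≤ K * suc (WPCS.ℓ I * bitLength I c) ×
    IntegralSelection (WPCS.S I) (output σ) ×
    discrepancy I (WPCS.y I) (output σ) ≤ℚ (+ 2 / 1) *ℚ dmax I ×
    c · output σ ≤ℚ c · WPCS.y I)))
mainTheorem9 =
  -- Existence is read off the output of the computation.
  (λ I ni c → let (_ , σ , _ , _ , rest) = compute I ni c in output σ , rest) , (program , K , compute)
  where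
  K = 3 + programRate
  compute = computation K (ℕ.m≤m+n 3 programRate) (ℕ.m≤n+m programRate 3)
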